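{- Let $n\geq1$ and $d\geq0$. Then \[\mathbb{Q}[x_1,\ldots,x_n]_d=\bigoplus_{\lambda\vdash n}\ \bigoplus_{M\in\operatorname{SSYT}_d(\lambda)}V_M ,\] and the sum on the right is direct. Moreover, for every multiset $\mu$ of $n$ non-negative integers with sum $d$, the subrepresentation $\mathbb{Q}[x_1,\ldots,x_n]_\mu$ equals the partial sum $\bigoplus_{\lambda\vdash n}\bigoplus_{M\in\operatorname{SSYT}_\mu(\lambda)}V_M$.
   Context: $S_n$ acts on $\mathbb{Q}[x_1,\ldots,x_n]$ by $\sigma\cdot x_i=x_{\sigma(i)}$, and this action is extended linearly to the group algebra. $\mathbb{Q}[x_1,\ldots,x_n]_d$ denotes the homogeneous part of degree $d$. For a multiset $\mu$ of $n$ non-negative integers, $\mathbb{Q}[x_1,\ldots,x_n]_\mu$ is the span of the monomials $x_1^{a_1}\cdots x_n^{a_n}$ with $\{a_1,\ldots,a_n\}=\mu$ as multisets. Partitions $\lambda\vdash n$ are identified with their Ferrers diagrams (English convention). $\operatorname{SSYT}(\lambda)$ is the set of fillings of $\lambda$ by non-negative integers that weakly increase along rows and strictly increase down columns. For $M\in\operatorname{SSYT}(\lambda)$, $\Sigma(M)$ is its entry sum and its content is the multiset of its entries. $\operatorname{SSYT}_d(\lambda)$ is the set of $M$ with $\Sigma(M)=d$, and $\operatorname{SSYT}_\mu(\lambda)$ is the set of $M$ with content $\mu$. For a filling $T$ of $\lambda$ by $1,\ldots,n$, each used once: - $R(T)$ and $C(T)$ are the subgroups of $S_n$ preserving the set of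 entries of each row, respectively of each column. - $\varepsilon_T=\sum_{\sigma\in C(T)}\sum_{\tau\in R(T)}\operatorname{sgn}(\sigma)\sigma\tau$. - For $M\in\operatorname{SSYT}(\lambda)$, $p_{M,T}=\prod_{i=1}^n x_i^{h_i}$, where $h_i$ is the entry of $M$ in the box containing $i$ in $T$. - $s_{M,T}$ is the number of $\tau\in R(T)$ fixing $p_{M,T}$. - $F_{M,T}=\varepsilon_T p_{M,T}/s_{M,T}$. $V_M$ is the $\mathbb{Q}$-span of all $F_{M,T}$, where $T$ runs over all such fillings of $\lambda$. -}

module Defs where

open import Data.Bool using (Bool; true; false; _∧_; _∨_; not; if_then_else_)
open import Data.Nat as ℕ using (ℕ; zero; suc; _≤_; _<_; _≥_)
open import Data.Fin as Fin using (Fin)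
import Data.Fin.Properties as FinP
open import Data.Vec as Vec using (Vec; []; _∷_; lookup; tabulate)
import Data.Vec.Properties as VecP
open import Data.List as List using (List; []; _∷_; [_]; map; concat; concatMap; length; filterᵇ; allFin; zip; zipWith; take; _++_)
open import Data.List.Relation.Unary.All using (All)
open import Data.List.Relation.Unary.Unique.Propositional using (Unique)
open import Data.List.Relation.Unary.Linked using (Linked)
open import Data.List.Relation.Binary.Pointwise using (Pointwise)
open import Data.List.Relation.Binary.Permutation.Propositional using (_↭_)
open import Data.Integer as ℤ using (ℤ)
open import Data.Rational as ℚ using (ℚ; 0ℚ; 1ℚ)
open import Data.Bool.ListAction using (all; any)
open import Data.Nat.ListAction using (sum)
open import Data.Product using (Σ; _×_; _,_; proj₁; proj₂)
open import Relation.Nullary.Decidable using (⌊_⌋)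
open import Relation.Binary.PropositionalEquality using (_≡_; _≢_)

-- Polynomials in n variables over ℚ.
-- A monomial x_1^{a_1}⋯x_n^{a_n} is its exponent vector (Vec ℕ n);
-- variable x_{i+1} corresponds to index i : Fin n.
-- A polynomial is a finite formal ℚ-linear combination of monomials,
-- and two polynomials are equal when all their coefficients agree.

Mon : ℕ → Set
Mon n = Vec ℕ n

Poly : ℕ → Set
Poly n = List (ℚ × Mon n)

_≟ₘ_ : ∀ {n} → (a b : Mon n) → Bool
a ≟ₘ b = ⌊ VecP.≡-dec ℕ._≟_ a b ⌋

coeff : ∀ {n} → Poly n → Mon n → ℚ
coeff [] a = 0ℚ
coeff ((c , b) ∷ p) a = if b ≟ₘ a then c ℚ.+ coeff p a else coeff p a

_≈ₚ_ : ∀ {n} → Poly n → Poly n → Set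
p ≈ₚ q = ∀ a → coeff p a ≡ coeff q a

0ₚ : ∀ {n} → Poly n
0ₚ = []

_+ₚ_ : ∀ {n} → Poly n → Poly n → Poly n
p +ₚ q = p ++ q

_·ₚ_ : ∀ {n} → ℚ → Poly n → Poly n
c ·ₚ p = map (λ t → (c ℚ.* proj₁ t , proj₂ t)) p

sumₚ : ∀ {n} → List (Poly n) → Poly n
sumₚ = concat

Homog : ∀ {n} → ℕ → Poly n → Set
Homog d p = ∀ a → coeff p a ≢ 0ℚ → Vec.sum a ≡ d

InMultidegree : ∀ {n} → List ℕ → Poly n → Set
InMultidegree μ p = ∀ a → coeff p a ≢ 0ℚ → Vec.toList a ↭ μ

-- The symmetric group S_n: a permutation σ is given by its table
-- (σ(0),…,σ(n-1)) and must be injective.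

Map : ℕ → Set
Map n = Vec (Fin n) n

app : ∀ {n} → Map n → Fin n → Fin n
app σ i = lookup σ i

_≟ᶠ_ : ∀ {n} → Fin n → Fin n → Bool
i ≟ᶠ j = ⌊ i FinP.≟ j ⌋

allVecs : ∀ {n} (k : ℕ) → List (Vec (Fin n) k)
allVecs zero = [ [] ]
allVecs {n} (suc k) = concatMap (λ v → map (_∷ v) (allFin n)) (allVecs k)

isInjectiveᵇ : ∀ {n} → Map n → Bool
isInjectiveᵇ {n} σ =
  all (λ i → all (λ j → (i ≟ᶠ j) ∨ not (app σ i ≟ᶠ app σ j)) (allFin n)) (allFin n)

allPerms : (n : ℕ) → List (Map n)
allPerms n = filterᵇ isInjectiveᵇ (allVecs n)

inversions : ∀ {n} → Map n → ℕ
inversions {n} σ =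
  length (filterᵇ (λ ij → ⌊ proj₁ ij Fin.<? proj₂ ij ⌋ ∧ ⌊ app σ (proj₂ ij) Fin.<? app σ (proj₁ ij) ⌋)
                  (List.cartesianProduct (allFin n) (allFin n)))

signOf : ℕ → ℚ
signOf zero = 1ℚ
signOf (suc k) = ℚ.- signOf k

sgn : ∀ {n} → Map n → ℚ
sgn σ = signOf (inversions σ)

-- σ · x^a = ∏_i x_{σ(i)}^{a_i}: the exponent of x_j is Σ_{σ(i)=j} a_i
actMon : ∀ {n} → Map n → Mon n → Mon n
actMon {n} σ a = tabulate (λ j → sum (map (lookup a) (filterᵇ (λ i → app σ i ≟ᶠ j) (allFin n))))

act : ∀ {n} → Map n → Poly n → Poly n
act σ p = map (λ t → (proj₁ t , actMon σ (proj₂ t))) p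

-- Partitions and tableaux.  A Ferrers diagram / tableau is the list of its
-- rows (top to bottom, English convention), each row listed left to right.

Tab : Set → Set
Tab A = List (List A)

shape : ∀ {A} → Tab A → List ℕ
shape = map length

IsPartition : ℕ → List ℕ → Set
IsPartition n λ' = All (1 ≤_) λ' × Linked _≥_ λ' × sum λ' ≡ n

StrictBelow : List ℕ → List ℕ → Set
StrictBelow r r' = Pointwise _<_ (take (length r') r) r'

IsSSYT : ℕ → Tab ℕ → Set
IsSSYT n M = IsPartition n (shape M) × All (Linked _≤_) M × Linked StrictBelow M

entrySum : Tab ℕ → ℕ
entrySum M = sum (map sum M)

-- content of M (as a list; compared as multisets via ↭)
content : Tab ℕ → List ℕ
content M = concat M

IsFilling : (n : ℕ) → List ℕ → Tab (Fin n) → Set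
IsFilling n λ' T = shape T ≡ λ' × concat T ↭ allFin n

-- columns of a left-justified diagram with weakly decreasing row lengths
mergeCol : ∀ {A : Set} → List A → Tab A → Tab A
mergeCol [] cs = cs
mergeCol (x ∷ xs) [] = [ x ] ∷ mergeCol xs []
mergeCol (x ∷ xs) (c ∷ cs) = (x ∷ c) ∷ mergeCol xs cs

columns : ∀ {A : Set} → Tab A → Tab A
columns [] = []
columns (r ∷ rs) = mergeCol r (columns rs)

memᵇ : ∀ {n} → Fin n → List (Fin n) → Bool
memᵇ i xs = any (i ≟ᶠ_) xs

-- σ preserves (maps into, hence onto) the set of entries of each block
preservesᵇ : ∀ {n} → Tab (Fin n) → Map n → Bool
preservesᵇ blocks σ = all (λ b → all (λ i → memᵇ (app σ i) b) b) blocks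

rowGroup : ∀ {n} → Tab (Fin n) → List (Map n)
rowGroup {n} T = filterᵇ (preservesᵇ T) (allPerms n)

colGroup : ∀ {n} → Tab (Fin n) → List (Map n)
colGroup {n} T = filterᵇ (preservesᵇ (columns T)) (allPerms n)

epsilon : ∀ {n} → Tab (Fin n) → Poly n → Poly n
epsilon T p =
  sumₚ (concatMap (λ σ → map (λ τ → sgn σ ·ₚ act σ (act τ p)) (rowGroup T)) (colGroup T))

-- exponent vector of p_{M,T}: h_i = entry of M in the box of T containing i
pExp : ∀ {n} → Tab ℕ → Tab (Fin n) → Mon n
pExp {n} M T =
  tabulate (λ i → sum (map proj₂ (filterᵇ (λ jh → proj₁ jh ≟ᶠ i) (concat (zipWith zip T M)))))

pMT : ∀ {n} → Tab ℕ → Tab (Fin n) → Poly n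
pMT M T = [ (1ℚ , pExp M T) ]

sMT : ∀ {n} → Tab ℕ → Tab (Fin n) → ℕ
sMT M T = length (filterᵇ (λ τ → actMon τ (pExp M T) ≟ₘ pExp M T) (rowGroup T))

-- 1/k  (k = s_{M,T} ≥ 1 always, as the identity lies in R(T))
recip : ℕ → ℚ
recip zero = 0ℚ
recip (suc k) = ℤ.+ 1 ℚ./ suc k

F : ∀ {n} → Tab ℕ → Tab (Fin n) → Poly n
F M T = recip (sMT M T) ·ₚ epsilon T (pMT M T)

InV : (n : ℕ) → Tab ℕ → Poly n → Set
InV n M v = Σ (List (ℚ × Tab (Fin n))) λ cs →
  All (λ cT → IsFilling n (shape M) (proj₂ cT)) cs ×
  v ≈ₚ sumₚ (map (λ cT → proj₁ cT ·ₚ F M (proj₂ cT)) cs)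

-- Finite families (M, v_M) of summands, used to express (direct) sums
-- of the subspaces V_M over an index set of tableaux M.

Family : ℕ → Set
Family n = List (Tab ℕ × Poly n)

Admissible : (n : ℕ) → (Tab ℕ → Set) → Family n → Set
Admissible n I fam = All (λ Mv → I (proj₁ Mv) × InV n (proj₁ Mv) (proj₂ Mv)) fam

familySum : ∀ {n} → Family n → Poly n
familySum fam = sumₚ (map proj₂ fam)

IndexDeg : ℕ → ℕ → Tab ℕ → Set
IndexDeg n d M = IsSSYT n M × entrySum M ≡ d

IndexMulti : ℕ → List ℕ → Tab ℕ → Set
IndexMulti n μ M = IsSSYT n M × content M ↭ μ

{-# OPTIONS --safe #-}

-- Let a_T and b_T be the row symmetrizer and the column antisymmetrizer of T, so that F_{M,T} = b_T a_T p_{M,T} / s_{M,T};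
-- both are self-adjoint for the inner product that makes the monomials orthonormal.
--
-- Spanning.  Let u be orthogonal to all F_{M,T}.  Then a_T b_T u has coefficient 0 at p_{M,T} for every semistandard M.
-- Symmetrizing over one cell too many in two adjacent rows kills a_T b_T u, and these Garnir relations propagate the
-- vanishing to all monomials, so a_T b_T u = 0 for all T.  Consider now symmetrizers a_r and antisymmetrizers b_k of
-- arbitrary set partitions r and k, with block sizes s_i and t_j.  Once a_{r′} u = 0 for every r′ obtained by moving an
-- element of r to a block at least as large, the central element Σ_{x≠y} (x y) acts on a_r u by the scalar
-- Σ_i s_i (s_i - 1) - Σ_{i≠j} min(s_i, s_j), and likewise on b_k u by the negative of the same expression in the t_j.
-- Hence a_r b_k u = 0 unless the two scalars agree; if they agree and no block of r meets a block of k twice, counting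
-- common elements shows that r and k are the rows and columns of a tableau, and again a_r b_k u = 0.  Induction reaches
-- the partitions into singletons, so u = 0, and orthogonal projection to the span of the F_{M,T} is the identity.
--
-- Directness.  Let Σ v_M = 0 with v_M ∈ V_M.  The operators b_T a_T g annihilate V_M unless T has the shape of M, and
-- otherwise map V_M to the line of F_{M,T}.  For fixed T the F_{M,T} are linearly independent, because p_{M,T} is the
-- monomial of F_{M,T} with the largest Σ (column · exponent).  So b_T a_T g v_M = 0 for all T and g, which makes
-- ‖a_T b_T v_M‖² = |R(T)| ⟨v_M, b_T a_T b_T v_M⟩ vanish; then v_M is orthogonal to V_M, hence 0.

module Submission where

open import Defs
open import Data.Nat using (ℕ; _≤_)
open import Data.Nat.ListAction using (sum)
open import Data.List using (List; length; map)
open import Data.List.Relation.Unary.All using (All)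
open import Data.List.Relation.Unary.Unique.Propositional using (Unique)
open import Data.Product using (Σ; _×_; proj₁; proj₂)
open import Relation.Binary.PropositionalEquality using (_≡_)

open import Algebra.Structures using (IsCommutativeMonoid)
open import Data.Bool using (Bool; true; false; if_then_else_; not; _∧_; _∨_)
open import Data.Bool.ListAction using (all; any)
open import Data.Empty using (⊥; ⊥-elim)
open import Data.Fin as Fin using (Fin; toℕ)
import Data.Fin.Properties as FinP
open import Data.List as List using ([]; _∷_; [_]; _++_; concat; concatMap; filterᵇ; allFin; upTo; zip; zipWith; take; cartesianProduct)
import Data.List.Properties as ListP
open import Data.List.Membership.Propositional using (_∈_; _∉_; lose; find)
import Data.List.Membership.Propositional.Properties as ∈P
open import Data.List.Relation.Unary.Any using (here; there)
open import Data.List.Relation.Unary.All using ([]; _∷_)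
import Data.List.Relation.Unary.All as All
import Data.List.Relation.Unary.All.Properties as AllP
open import Data.List.Relation.Unary.AllPairs using (AllPairs; []; _∷_)
import Data.List.Relation.Unary.Unique.Propositional.Properties as Unique
open import Data.List.Relation.Unary.Linked as Linked using (Linked; []; [-]; _∷_)
import Data.List.Relation.Unary.Linked.Properties as LinkedP
open import Data.List.Relation.Binary.Pointwise as Pointwise using (Pointwise; []; _∷_)
open import Data.List.Relation.Binary.Permutation.Propositional as ↭ using (_↭_; ↭-refl; ↭-sym; ↭-trans; prep; swap)
import Data.List.Relation.Binary.Permutation.Propositional.Properties as ↭P
open import Data.Nat as ℕ using (zero; suc; _<_; z≤n; s≤s; _∸_)
import Data.Nat.Properties as ℕP
import Data.Nat.ListAction.Properties as SumP
import Data.Nat.Tactic.RingSolver as ℕSolver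
open import Data.Product using (_,_; ∃; ∃₂)
open import Data.Rational as ℚ using (ℚ; 0ℚ; 1ℚ; _+_; _*_; -_)
import Data.Rational.Properties as ℚP
open import Data.Sum using (_⊎_; inj₁; inj₂)
open import Data.Unit using (⊤; tt)
open import Data.Vec as Vec using (Vec; []; _∷_; lookup; tabulate; _[_]≔_)
import Data.Vec.Properties as VecP
open import Function using (_∘_; id)
open import Relation.Binary.Definitions using (DecidableEquality; tri<; tri≈; tri>)
open import Relation.Binary.PropositionalEquality
  using (_≢_; refl; sym; trans; cong; cong₂; subst; subst₂; _≗_; module ≡-Reasoning)
open import Relation.Nullary using (¬_; Dec; yes; no; contradiction)
open import Relation.Nullary.Decidable using (⌊_⌋; _×-dec_; _⊎-dec_; ¬?)
open import Tactic.RingSolver.Core.AlmostCommutativeRing using (AlmostCommutativeRing; fromCommutativeRing)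
open import Data.Maybe using (Maybe; just; nothing)
import Tactic.RingSolver as Solver
import Algebra.Properties.Group as GroupP

-- The scalar Σ s_i (s_i - 1) - Σ_{i≠j} min(s_i, s_j) is twice the sum of the contents of the
-- partition with parts s_i; by this number the sum of all (x y) over ordered pairs acts on the
-- corresponding Specht module, and transposing the diagram negates it. Different partitions of n
-- can have equal content sums, so the scalars alone cannot separate the shapes; the case of equal
-- scalars is left to a count of the pairs that lie in a common block. The induction runs through
-- pairs of set partitions that are not the rows and columns of any tableau. Symmetrizers are
-- therefore attached to arbitrary labellings of the n points, and a tableau is a pair of
-- labellings, by row number and by column number. Two shapes are compared through the sum of the
-- row numbers, which takes the place of the dominance order. The operators act on arbitrary
-- functions of the exponent vector. Finiteness enters with the inner product, which runs over the
-- exponents at most d.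

private variable
  A B : Set
  P Q : Set
  n k : ℕ

ℚring : AlmostCommutativeRing _ _
ℚring = fromCommutativeRing ℚP.+-*-commutativeRing isZero
  where
  isZero : ∀ x → Maybe (0ℚ ≡ x)
  isZero x with 0ℚ ℚ.≟ x
  ... | yes e = just e
  ... | no _ = nothing

-- Finite sums and products over lists

module BigOp {D : Set} {_•_ : D → D → D} {ε : D} (isCM : IsCommutativeMonoid _≡_ _•_ ε) where
  open IsCommutativeMonoid isCM using (assoc; identityˡ; identityʳ; comm)

  fold : List A → (A → D) → D
  fold [] f = ε
  fold (x ∷ xs) f = f x • fold xs f

  fold-cong : (xs : List A) {f g : A → D} → (∀ {x} → x ∈ xs → f x ≡ g x) → fold xs f ≡ fold xs g
  fold-cong [] h = refl
  fold-cong (x ∷ xs) h = cong₂ _•_ (h (here refl)) (fold-cong xs (h ∘ there))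

  fold-≗ : (xs : List A) {f g : A → D} → f ≗ g → fold xs f ≡ fold xs g
  fold-≗ xs h = fold-cong xs (λ {x} _ → h x)

  interchange : ∀ a b c d → (a • b) • (c • d) ≡ (a • c) • (b • d)
  interchange a b c d = begin
    (a • b) • (c • d) ≡⟨ assoc a b (c • d) ⟩
    a • (b • (c • d)) ≡⟨ cong (a •_) (sym (assoc b c d)) ⟩
    a • ((b • c) • d) ≡⟨ cong (λ z → a • (z • d)) (comm b c) ⟩
    a • ((c • b) • d) ≡⟨ cong (a •_) (assoc c b d) ⟩
    a • (c • (b • d)) ≡⟨ sym (assoc a c (b • d)) ⟩
    (a • c) • (b • d) ∎
    where open ≡-Reasoning

  fold-• : (xs : List A) (f g : A → D) → fold xs (λ x → f x • g x) ≡ fold xs f • fold xs g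
  fold-• [] f g = sym (identityˡ ε)
  fold-• (x ∷ xs) f g = trans (cong ((f x • g x) •_) (fold-• xs f g)) (interchange _ _ _ _)

  fold-ε : (xs : List A) {f : A → D} → (∀ {x} → x ∈ xs → f x ≡ ε) → fold xs f ≡ ε
  fold-ε [] h = refl
  fold-ε (x ∷ xs) h = trans (cong₂ _•_ (h (here refl)) (fold-ε xs (h ∘ there))) (identityˡ ε)

  fold-swap : (xs : List A) (ys : List B) (f : A → B → D) →
    fold xs (λ x → fold ys (f x)) ≡ fold ys (λ y → fold xs (λ x → f x y))
  fold-swap [] ys f = sym (fold-ε ys (λ _ → refl))
  fold-swap (x ∷ xs) ys f = trans (cong (fold ys (f x) •_) (fold-swap xs ys f)) (sym (fold-• ys _ _))

  fold-↭ : {xs ys : List A} (f : A → D) → xs ↭ ys → fold xs f ≡ fold ys f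
  fold-↭ f ↭.refl = refl
  fold-↭ f (prep x p) = cong (f x •_) (fold-↭ f p)
  fold-↭ f (swap {xs} {ys} x y p) = begin
    f x • (f y • fold xs f) ≡⟨ sym (assoc _ _ _) ⟩
    (f x • f y) • fold xs f ≡⟨ cong₂ _•_ (comm _ _) (fold-↭ f p) ⟩
    (f y • f x) • fold ys f ≡⟨ assoc _ _ _ ⟩
    f y • (f x • fold ys f) ∎
    where open ≡-Reasoning
  fold-↭ f (↭.trans p q) = trans (fold-↭ f p) (fold-↭ f q)

  fold-map : (xs : List A) (h : A → B) (f : B → D) → fold (map h xs) f ≡ fold xs (f ∘ h)
  fold-map [] h f = refl
  fold-map (x ∷ xs) h f = cong (f (h x) •_) (fold-map xs h f)

  fold-++ : (xs ys : List A) (f : A → D) → fold (xs ++ ys) f ≡ fold xs f • fold ys f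
  fold-++ [] ys f = sym (identityˡ _)
  fold-++ (x ∷ xs) ys f = trans (cong (f x •_) (fold-++ xs ys f)) (sym (assoc _ _ _))

  fold-concatMap : (xs : List A) (h : A → List B) (f : B → D) →
    fold (concatMap h xs) f ≡ fold xs (λ x → fold (h x) f)
  fold-concatMap [] h f = refl
  fold-concatMap (x ∷ xs) h f =
    trans (fold-++ (h x) (concatMap h xs) f) (cong (fold (h x) f •_) (fold-concatMap xs h f))

  fold-cartesian : (xs : List A) (ys : List B) (f : A × B → D) →
    fold (cartesianProduct xs ys) f ≡ fold xs (λ x → fold ys (λ y → f (x , y)))
  fold-cartesian [] ys f = refl
  fold-cartesian (x ∷ xs) ys f =
    trans (fold-++ (map (x ,_) ys) _ f) (cong₂ _•_ (fold-map ys (x ,_) f) (fold-cartesian xs ys f))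

  fold-single : {xs : List A} (f : A → D) {a : A} → Unique xs → a ∈ xs →
    (∀ {x} → x ∈ xs → x ≢ a → f x ≡ ε) → fold xs f ≡ f a
  fold-single f (x∉ ∷ u) (here refl) h =
    trans (cong (f _ •_) (fold-ε _ (λ p → h (there p) (λ e → All.lookup x∉ p (sym e))))) (identityʳ _)
  fold-single f (x∉ ∷ u) (there a∈) h =
    trans (cong₂ _•_ (h (here refl) (All.lookup x∉ a∈)) (fold-single f u a∈ (h ∘ there))) (identityˡ _)

module ∑ = BigOp ℚP.+-0-isCommutativeMonoid
module ∑ₙ = BigOp ℕP.+-0-isCommutativeMonoid
module ∏ = BigOp ℚP.*-1-isCommutativeMonoid
open ∑ using () renaming (fold to ∑)
open ∑ₙ using () renaming (fold to ∑ₙ)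
open ∏ using () renaming (fold to ∏)

-- Iverson brackets

⟦_⟧ₙ : Dec P → ℕ
⟦ yes _ ⟧ₙ = 1
⟦ no _ ⟧ₙ = 0

⟦_⟧ : Dec P → ℚ
⟦ yes _ ⟧ = 1ℚ
⟦ no _ ⟧ = 0ℚ

⟦⟧ₙ-yes : (d : Dec P) → P → ⟦ d ⟧ₙ ≡ 1
⟦⟧ₙ-yes (yes _) p = refl
⟦⟧ₙ-yes (no ¬p) p = ⊥-elim (¬p p)

⟦⟧ₙ-no : (d : Dec P) → ¬ P → ⟦ d ⟧ₙ ≡ 0
⟦⟧ₙ-no (yes p) ¬p = ⊥-elim (¬p p)
⟦⟧ₙ-no (no _) ¬p = refl

⟦⟧-yes : (d : Dec P) → P → ⟦ d ⟧ ≡ 1ℚ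
⟦⟧-yes (yes _) p = refl
⟦⟧-yes (no ¬p) p = ⊥-elim (¬p p)

⟦⟧-no : (d : Dec P) → ¬ P → ⟦ d ⟧ ≡ 0ℚ
⟦⟧-no (yes p) ¬p = ⊥-elim (¬p p)
⟦⟧-no (no _) ¬p = refl

⟦⟧-cong : (d : Dec P) (e : Dec Q) → (P → Q) → (Q → P) → ⟦ d ⟧ ≡ ⟦ e ⟧
⟦⟧-cong (yes p) e f g = sym (⟦⟧-yes e (f p))
⟦⟧-cong (no ¬p) e f g = sym (⟦⟧-no e (¬p ∘ g))

⟦⟧ₙ-cong : (d : Dec P) (e : Dec Q) → (P → Q) → (Q → P) → ⟦ d ⟧ₙ ≡ ⟦ e ⟧ₙ
⟦⟧ₙ-cong (yes p) e f g = sym (⟦⟧ₙ-yes e (f p))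
⟦⟧ₙ-cong (no ¬p) e f g = sym (⟦⟧ₙ-no e (¬p ∘ g))

⟦⟧ₙ≤1 : (d : Dec P) → ⟦ d ⟧ₙ ≤ 1
⟦⟧ₙ≤1 (yes _) = s≤s z≤n
⟦⟧ₙ≤1 (no _) = z≤n

⟦⟧ₙ-mono : (d : Dec P) (e : Dec Q) → (P → Q) → ⟦ d ⟧ₙ ≤ ⟦ e ⟧ₙ
⟦⟧ₙ-mono (yes p) e f = ℕP.≤-reflexive (sym (⟦⟧ₙ-yes e (f p)))
⟦⟧ₙ-mono (no _) e f = z≤n

⟦⟧-guard : (d : Dec P) {a b : ℚ} → (P → a ≡ b) → ⟦ d ⟧ * a ≡ ⟦ d ⟧ * b
⟦⟧-guard (yes p) h = cong (1ℚ *_) (h p)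
⟦⟧-guard (no _) {a} {b} h = trans (ℚP.*-zeroˡ a) (sym (ℚP.*-zeroˡ b))

⟦⟧ₙ-×ˡ : (d : Dec P) (e : Dec Q) → ⟦ d ×-dec e ⟧ₙ ≡ ⟦ d ⟧ₙ ℕ.* ⟦ e ⟧ₙ
⟦⟧ₙ-×ˡ (yes _) (yes _) = refl
⟦⟧ₙ-×ˡ (yes _) (no _) = refl
⟦⟧ₙ-×ˡ (no _) _ = refl

∑-*ˡ : (xs : List A) (c : ℚ) (f : A → ℚ) → c * ∑ xs f ≡ ∑ xs (λ x → c * f x)
∑-*ˡ [] c f = ℚP.*-zeroʳ c
∑-*ˡ (x ∷ xs) c f = trans (ℚP.*-distribˡ-+ c _ _) (cong (c * f x +_) (∑-*ˡ xs c f))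

∑-*ʳ : (xs : List A) (c : ℚ) (f : A → ℚ) → ∑ xs f * c ≡ ∑ xs (λ x → f x * c)
∑-*ʳ xs c f = trans (ℚP.*-comm _ c) (trans (∑-*ˡ xs c f) (∑.fold-≗ xs (λ x → ℚP.*-comm c (f x))))

∑ₙ-*ˡ : (xs : List A) (c : ℕ) (f : A → ℕ) → c ℕ.* ∑ₙ xs f ≡ ∑ₙ xs (λ x → c ℕ.* f x)
∑ₙ-*ˡ [] c f = ℕP.*-zeroʳ c
∑ₙ-*ˡ (x ∷ xs) c f = trans (ℕP.*-distribˡ-+ c _ _) (cong (c ℕ.* f x ℕ.+_) (∑ₙ-*ˡ xs c f))

∑ₙ-*ʳ : (xs : List A) (c : ℕ) (f : A → ℕ) → ∑ₙ xs f ℕ.* c ≡ ∑ₙ xs (λ x → f x ℕ.* c)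
∑ₙ-*ʳ xs c f = trans (ℕP.*-comm _ c) (trans (∑ₙ-*ˡ xs c f) (∑ₙ.fold-≗ xs (λ x → ℕP.*-comm c (f x))))

∑ₙ-mono : (xs : List A) {f g : A → ℕ} → (∀ {x} → x ∈ xs → f x ≤ g x) → ∑ₙ xs f ≤ ∑ₙ xs g
∑ₙ-mono [] h = z≤n
∑ₙ-mono (x ∷ xs) h = ℕP.+-mono-≤ (h (here refl)) (∑ₙ-mono xs (h ∘ there))

∑ₙ-term : (xs : List A) (f : A → ℕ) {x : A} → x ∈ xs → f x ≤ ∑ₙ xs f
∑ₙ-term (x ∷ xs) f (here refl) = ℕP.m≤m+n _ _
∑ₙ-term (x ∷ xs) f (there p) = ℕP.≤-trans (∑ₙ-term xs f p) (ℕP.m≤n+m _ _)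

+-≤-tight : ∀ {a b c d} → a ≤ c → b ≤ d → a ℕ.+ b ≡ c ℕ.+ d → a ≡ c × b ≡ d
+-≤-tight {a} {b} {c} {d} p q e = a≡c , ℕP.+-cancelˡ-≡ a b d (trans e (cong (ℕ._+ d) (sym a≡c)))
  where
  a≡c : a ≡ c
  a≡c = ℕP.≤-antisym p (ℕP.+-cancelʳ-≤ d c a (ℕP.≤-trans (ℕP.≤-reflexive (sym e)) (ℕP.+-monoʳ-≤ a q)))

-- The equality cases of later estimates, such as `nested`, `sorted-unique` and `depth≡`, are read
-- off through this.
∑ₙ-tight : (xs : List A) {f g : A → ℕ} → (∀ {x} → x ∈ xs → f x ≤ g x) → ∑ₙ xs f ≡ ∑ₙ xs g →
  ∀ {x} → x ∈ xs → f x ≡ g x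
∑ₙ-tight (y ∷ ys) h e p with +-≤-tight (h (here refl)) (∑ₙ-mono ys (h ∘ there)) e
∑ₙ-tight (y ∷ ys) h e (here refl) | e₁ , e₂ = e₁
∑ₙ-tight (y ∷ ys) h e (there p) | e₁ , e₂ = ∑ₙ-tight ys (h ∘ there) e₂ p

∑ₙ-atMostOne : {xs : List A} {R : A → Set} (R? : ∀ x → Dec (R x)) → Unique xs →
  (∀ {x y} → R x → R y → x ≡ y) → ∑ₙ xs (λ x → ⟦ R? x ⟧ₙ) ≤ 1
∑ₙ-atMostOne {xs = []} R? u h = z≤n
∑ₙ-atMostOne {xs = x ∷ xs} R? (x∉ ∷ u) h with R? x
... | no _ = ∑ₙ-atMostOne R? u h
... | yes r = ℕP.≤-reflexive (cong suc (∑ₙ.fold-ε xs (λ {y} p → ⟦⟧ₙ-no (R? y) (λ s → All.lookup x∉ p (h r s)))))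

-- Natural numbers in ℚ, positivity, and counting

ι : ℕ → ℚ
ι zero = 0ℚ
ι (suc n) = 1ℚ + ι n

ι-+ : ∀ m n → ι (m ℕ.+ n) ≡ ι m + ι n
ι-+ zero n = sym (ℚP.+-identityˡ _)
ι-+ (suc m) n = trans (cong (1ℚ +_) (ι-+ m n)) (sym (ℚP.+-assoc 1ℚ (ι m) (ι n)))

ι-≥0 : ∀ n → 0ℚ ℚ.≤ ι n
ι-≥0 zero = ℚP.≤-refl
ι-≥0 (suc n) = ℚP.+-mono-≤ (ℚP.<⇒≤ (ℚP.positive⁻¹ 1ℚ)) (ι-≥0 n)

ι-suc≢0 : ∀ n → ι (suc n) ≢ 0ℚ
ι-suc≢0 n e = ℚP.<⇒≢ (ℚP.+-mono-<-≤ (ℚP.positive⁻¹ 1ℚ) (ι-≥0 n)) (sym e)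

ι≢0 : ∀ {n} → 1 ≤ n → ι n ≢ 0ℚ
ι≢0 {suc n} _ = ι-suc≢0 n

ι-injective : ∀ m n → ι m ≡ ι n → m ≡ n
ι-injective zero zero e = refl
ι-injective zero (suc n) e = ⊥-elim (ι-suc≢0 n (sym e))
ι-injective (suc m) zero e = ⊥-elim (ι-suc≢0 m e)
ι-injective (suc m) (suc n) e = cong suc (ι-injective m n (GroupP.∙-cancelˡ ℚP.+-0-group 1ℚ (ι m) (ι n) e))

ι-⟦⟧ : (d : Dec P) → ι ⟦ d ⟧ₙ ≡ ⟦ d ⟧
ι-⟦⟧ (yes _) = ℚP.+-identityʳ 1ℚ
ι-⟦⟧ (no _) = refl

ι-∑ : (xs : List A) (f : A → ℕ) → ι (∑ₙ xs f) ≡ ∑ xs (ι ∘ f)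
ι-∑ [] f = refl
ι-∑ (x ∷ xs) f = trans (ι-+ (f x) _) (cong (ι (f x) +_) (ι-∑ xs f))

-- Divisions by a number of permutations rest on this, with the identity as the witness.
∑-⟦⟧≢0 : (xs : List A) {R : A → Set} (R? : ∀ x → Dec (R x)) {x : A} → x ∈ xs → R x →
  ∑ xs (λ x → ⟦ R? x ⟧) ≢ 0ℚ
∑-⟦⟧≢0 xs R? {x} x∈ r e = ι≢0 {∑ₙ xs (λ x → ⟦ R? x ⟧ₙ)}
  (ℕP.≤-trans (ℕP.≤-reflexive (sym (⟦⟧ₙ-yes (R? x) r))) (∑ₙ-term xs (λ x → ⟦ R? x ⟧ₙ) x∈))
  (trans (ι-∑ xs _) (trans (∑.fold-≗ xs (λ x → ι-⟦⟧ (R? x))) e))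

*≡0⇒ : ∀ {a b} → a ≢ 0ℚ → a * b ≡ 0ℚ → b ≡ 0ℚ
*≡0⇒ {a} {b} a≢0 e = begin
  b                        ≡⟨ sym (ℚP.*-identityˡ b) ⟩
  1ℚ * b                   ≡⟨ cong (_* b) (sym (ℚP.*-inverseˡ a)) ⟩
  (ℚ.1/ a) * a * b         ≡⟨ ℚP.*-assoc (ℚ.1/ a) a b ⟩
  (ℚ.1/ a) * (a * b)       ≡⟨ cong ((ℚ.1/ a) *_) e ⟩
  (ℚ.1/ a) * 0ℚ            ≡⟨ ℚP.*-zeroʳ (ℚ.1/ a) ⟩
  0ℚ ∎
  where
  open ≡-Reasoning
  instance _ = ℚ.≢-nonZero a≢0

square≥0 : ∀ a → 0ℚ ℚ.≤ a * a
square≥0 a with ℚP.≤-total 0ℚ a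
... | inj₁ p = subst (ℚ._≤ a * a) (ℚP.*-zeroˡ a) (ℚP.*-monoʳ-≤-nonNeg a p)
  where instance _ = ℚ.nonNegative p
... | inj₂ p = subst (ℚ._≤ a * a) (ℚP.*-zeroˡ a) (ℚP.*-monoʳ-≤-nonPos a p)
  where instance _ = ℚ.nonPositive p

square≡0 : ∀ a → a * a ≡ 0ℚ → a ≡ 0ℚ
square≡0 a e with a ℚ.≟ 0ℚ
... | yes p = p
... | no a≢0 = *≡0⇒ a≢0 e

∑-square≥0 : (xs : List A) (f : A → ℚ) → 0ℚ ℚ.≤ ∑ xs (λ x → f x * f x)
∑-square≥0 [] f = ℚP.≤-refl
∑-square≥0 (x ∷ xs) f = ℚP.+-mono-≤ (square≥0 (f x)) (∑-square≥0 xs f)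

nonneg-sum-zero : ∀ {a b} → 0ℚ ℚ.≤ a → 0ℚ ℚ.≤ b → a + b ≡ 0ℚ → a ≡ 0ℚ × b ≡ 0ℚ
nonneg-sum-zero {a} {b} p q e = a≡0 , trans (sym (ℚP.+-identityˡ b)) (trans (cong (_+ b) (sym a≡0)) e)
  where
  a≡0 : a ≡ 0ℚ
  a≡0 = ℚP.≤-antisym
    (ℚP.≤-trans (ℚP.≤-reflexive (sym (ℚP.+-identityʳ a)))
      (ℚP.≤-trans (ℚP.+-monoʳ-≤ a q) (ℚP.≤-reflexive e))) p

∑-square≡0 : (xs : List A) (f : A → ℚ) → ∑ xs (λ x → f x * f x) ≡ 0ℚ → ∀ {x} → x ∈ xs → f x ≡ 0ℚ
∑-square≡0 (y ∷ ys) f e p with nonneg-sum-zero (square≥0 (f y)) (∑-square≥0 ys f) e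
∑-square≡0 (y ∷ ys) f e (here refl) | e₁ , e₂ = square≡0 (f y) e₁
∑-square≡0 (y ∷ ys) f e (there p) | e₁ , e₂ = ∑-square≡0 ys f e₂ p

-- Double counting of the matching pairs: each `x` with `R` has a partner, and injectivity of `key`
-- on `R` leaves at most one `x` to each `y`.
count-≤ : {xs : List A} {ys : List B} {D : Set} (_≟_ : DecidableEquality D)
  {R : A → Set} (R? : ∀ x → Dec (R x)) {S : B → Set} (S? : ∀ y → Dec (S y))
  (key : A → D) (key′ : B → D) → Unique xs →
  (∀ {x y} → R x → R y → key x ≡ key y → x ≡ y) →
  (∀ {x} → R x → ∃ λ y → y ∈ ys × S y × key x ≡ key′ y) →
  ∑ₙ xs (λ x → ⟦ R? x ⟧ₙ) ≤ ∑ₙ ys (λ y → ⟦ S? y ⟧ₙ)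
count-≤ {xs = xs} {ys} _≟_ {R} R? {S} S? key key′ u inj partner = begin
  ∑ₙ xs (λ x → ⟦ R? x ⟧ₙ)                                        ≤⟨ ∑ₙ-mono xs (λ {x} _ → lo x) ⟩
  ∑ₙ xs (λ x → ∑ₙ ys (λ y → ⟦ match x y ⟧ₙ))                     ≡⟨ ∑ₙ.fold-swap xs ys _ ⟩
  ∑ₙ ys (λ y → ∑ₙ xs (λ x → ⟦ match x y ⟧ₙ))                     ≤⟨ ∑ₙ-mono ys (λ {y} _ → hi y) ⟩
  ∑ₙ ys (λ y → ⟦ S? y ⟧ₙ)                                        ∎
  where
  open ℕP.≤-Reasoning
  match : ∀ x y → Dec (S y × R x × key x ≡ key′ y)
  match x y = S? y ×-dec R? x ×-dec (key x ≟ key′ y)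
  lo : ∀ x → ⟦ R? x ⟧ₙ ≤ ∑ₙ ys (λ y → ⟦ match x y ⟧ₙ)
  lo x with R? x
  ... | no _ = z≤n
  ... | yes r with partner r
  ... | y , y∈ , s , e = ℕP.≤-trans (ℕP.≤-reflexive (sym (trans (⟦⟧ₙ-×ˡ (S? y) (yes r ×-dec (key x ≟ key′ y)))
            (cong₂ ℕ._*_ (⟦⟧ₙ-yes (S? y) s) (⟦⟧ₙ-yes (yes r ×-dec (key x ≟ key′ y)) (r , e))))))
          (∑ₙ-term ys (λ y → ⟦ S? y ×-dec yes r ×-dec (key x ≟ key′ y) ⟧ₙ) y∈)
  hi : ∀ y → ∑ₙ xs (λ x → ⟦ match x y ⟧ₙ) ≤ ⟦ S? y ⟧ₙ
  hi y = begin
    ∑ₙ xs (λ x → ⟦ match x y ⟧ₙ)                      ≡⟨ ∑ₙ.fold-≗ xs (λ x → ⟦⟧ₙ-×ˡ (S? y) _) ⟩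
    ∑ₙ xs (λ x → ⟦ S? y ⟧ₙ ℕ.* ⟦ R? x ×-dec (key x ≟ key′ y) ⟧ₙ) ≡⟨ sym (∑ₙ-*ˡ xs ⟦ S? y ⟧ₙ _) ⟩
    ⟦ S? y ⟧ₙ ℕ.* ∑ₙ xs (λ x → ⟦ R? x ×-dec (key x ≟ key′ y) ⟧ₙ)
      ≤⟨ ℕP.*-monoʳ-≤ ⟦ S? y ⟧ₙ (∑ₙ-atMostOne (λ x → R? x ×-dec (key x ≟ key′ y)) u
           (λ (r , e) (r′ , e′) → inj r r′ (trans e (sym e′)))) ⟩
    ⟦ S? y ⟧ₙ ℕ.* 1                                   ≡⟨ ℕP.*-identityʳ _ ⟩
    ⟦ S? y ⟧ₙ                                         ∎

unique-⊆-↭ : {xs ys : List A} → Unique xs → (∀ {x} → x ∈ xs → x ∈ ys) → length ys ≤ length xs → xs ↭ ys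
unique-⊆-↭ {xs = []} {ys} u s l with ys
... | [] = ↭-refl
unique-⊆-↭ {xs = x ∷ xs} {ys} (x∉ ∷ u) s l with ∈P.∈-∃++ (s (here refl))
... | as , bs , refl = ↭-trans (prep x (unique-⊆-↭ u sub len)) (↭-sym (↭P.shift x as bs))
  where
  sub : ∀ {z} → z ∈ xs → z ∈ as ++ bs
  sub {z} z∈ with ∈P.∈-++⁻ as (s (there z∈))
  ... | inj₁ p = ∈P.∈-++⁺ˡ p
  ... | inj₂ (here z≡x) = ⊥-elim (All.lookup x∉ z∈ (sym z≡x))
  ... | inj₂ (there p) = ∈P.∈-++⁺ʳ as p
  len : length (as ++ bs) ≤ length xs
  len = ℕ.s≤s⁻¹ (ℕP.≤-trans (ℕP.≤-reflexive (sym (↭P.↭-length (↭P.shift x as bs)))) l)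

-- Pigeonhole principle. Sums are reindexed with it, and injective tables are inverted with it.
map-↭-self : {xs : List A} {f : A → A} → Unique xs → (∀ {x} → x ∈ xs → f x ∈ xs) →
  (∀ {x y} → x ∈ xs → y ∈ xs → f x ≡ f y → x ≡ y) → map f xs ↭ xs
map-↭-self {A} {xs} {f} u into inj =
  unique-⊆-↭ (go u id) (λ p → let (_ , q , e) = ∈P.∈-map⁻ f p in subst (_∈ xs) (sym e) (into q))
    (ℕP.≤-reflexive (sym (ListP.length-map f xs)))
  where
  go : {ys : List A} → Unique ys → (∀ {x} → x ∈ ys → x ∈ xs) → Unique (map f ys)
  go [] s = []
  go (x∉ ∷ v) s = AllP.map⁺ (All.tabulate (λ p e → All.lookup x∉ p (inj (s (here refl)) (s (there p)) e)))
    ∷ go v (s ∘ there)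

unique-length : {xs ys : List A} → Unique ys → (∀ {x} → x ∈ ys → x ∈ xs) → length ys ≤ length xs
unique-length {ys = []} _ _ = z≤n
unique-length {xs = xs} {y ∷ ys} (y∉ ∷ v) t with ∈P.∈-∃++ (t (here refl))
... | as , bs , refl = ℕP.≤-trans (s≤s (unique-length v sub)) (ℕP.≤-reflexive (sym (↭P.↭-length (↭P.shift y as bs))))
  where
  sub : ∀ {z} → z ∈ ys → z ∈ as ++ bs
  sub {z} z∈ with ∈P.∈-++⁻ as (t (there z∈))
  ... | inj₁ p = ∈P.∈-++⁺ˡ p
  ... | inj₂ (here z≡y) = ⊥-elim (All.lookup y∉ z∈ (sym z≡y))
  ... | inj₂ (there p) = ∈P.∈-++⁺ʳ as p

unique-set-↭ : {xs ys : List A} → Unique xs → Unique ys → (∀ {x} → x ∈ xs → x ∈ ys) → (∀ {x} → x ∈ ys → x ∈ xs) → xs ↭ ys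
unique-set-↭ u v s t = unique-⊆-↭ u s (unique-length v t)

-- Permutations and their action on exponent vectors

infixl 8 _∙_

-- m ∙ σ is the function m ∘ σ, so that σ acts on functions f of exponent vectors by (σ f) m = f (m ∙ σ).
_∙_ : Vec A n → Map n → Vec A n
m ∙ σ = tabulate (λ i → lookup m (lookup σ i))

lookup-∙ : (m : Vec A n) (σ : Map n) (i : Fin n) → lookup (m ∙ σ) i ≡ lookup m (lookup σ i)
lookup-∙ m σ i = VecP.lookup∘tabulate _ i

vec-ext : {u v : Vec A n} → (∀ i → lookup u i ≡ lookup v i) → u ≡ v
vec-ext {u = u} {v} h = trans (sym (VecP.tabulate∘lookup u)) (trans (VecP.tabulate-cong h) (VecP.tabulate∘lookup v))

≡-lookup : {u v : Vec A n} → u ≡ v → ∀ i → lookup u i ≡ lookup v i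
≡-lookup refl i = refl

∙-assoc : (m : Vec A n) (σ τ : Map n) → m ∙ (σ ∙ τ) ≡ (m ∙ σ) ∙ τ
∙-assoc m σ τ = vec-ext λ i → trans (lookup-∙ m (σ ∙ τ) i)
  (trans (cong (lookup m) (lookup-∙ σ τ i)) (sym (trans (lookup-∙ (m ∙ σ) τ i) (lookup-∙ m σ _))))

idₘ : Map n
idₘ = tabulate id

lookup-id : (i : Fin n) → lookup idₘ i ≡ i
lookup-id i = VecP.lookup∘tabulate id i

∙-id : (m : Vec A n) → m ∙ idₘ ≡ m
∙-id m = vec-ext λ i → trans (lookup-∙ m idₘ i) (cong (lookup m) (lookup-id i))

id-∙ : (σ : Map n) → idₘ ∙ σ ≡ σ
id-∙ σ = vec-ext λ i → trans (lookup-∙ idₘ σ i) (lookup-id _)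

record Inj (σ : Map n) : Set where
  constructor mkInj
  field cancel : ∀ {i j} → lookup σ i ≡ lookup σ j → i ≡ j

open Inj

id-inj : Inj (idₘ {n})
id-inj .cancel e = trans (sym (lookup-id _)) (trans e (lookup-id _))

∙-inj : {σ τ : Map n} → Inj σ → Inj τ → Inj (σ ∙ τ)
∙-inj {σ = σ} {τ} p q .cancel e = cancel q (cancel p (trans (sym (lookup-∙ σ τ _)) (trans e (lookup-∙ σ τ _))))

inj-surjective : {σ : Map n} → Inj σ → ∀ j → ∃ λ i → lookup σ i ≡ j
inj-surjective {n} {σ} p j
  with i , _ , e ← ∈P.∈-map⁻ (lookup σ)
    (↭P.∈-resp-↭ (↭-sym (map-↭-self {f = lookup σ} (Unique.allFin⁺ n) (λ _ → ∈P.∈-allFin _) (λ _ _ → cancel p))) (∈P.∈-allFin j))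
  = i , sym e

inv : {σ : Map n} → Inj σ → Map n
inv p = tabulate (proj₁ ∘ inj-surjective p)

∙-inv : {σ : Map n} (p : Inj σ) → σ ∙ inv p ≡ idₘ
∙-inv {σ = σ} p = vec-ext λ i → trans (lookup-∙ σ (inv p) i)
  (trans (cong (lookup σ) (VecP.lookup∘tabulate _ i)) (trans (proj₂ (inj-surjective p i)) (sym (lookup-id i))))

inv-∙ : {σ : Map n} (p : Inj σ) → inv p ∙ σ ≡ idₘ
inv-∙ {σ = σ} p = vec-ext λ i → trans (lookup-∙ (inv p) σ i)
  (trans (VecP.lookup∘tabulate _ (lookup σ i)) (trans (cancel p (proj₂ (inj-surjective p (lookup σ i)))) (sym (lookup-id i))))

inv-inj : {σ : Map n} (p : Inj σ) → Inj (inv p)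
inv-inj {σ = σ} p .cancel {i} {j} e = begin
  i                            ≡⟨ sym (lookup-id i) ⟩
  lookup idₘ i                 ≡⟨ cong (λ v → lookup v i) (sym (∙-inv p)) ⟩
  lookup (σ ∙ inv p) i         ≡⟨ lookup-∙ σ (inv p) i ⟩
  lookup σ (lookup (inv p) i)  ≡⟨ cong (lookup σ) e ⟩
  lookup σ (lookup (inv p) j)  ≡⟨ sym (lookup-∙ σ (inv p) j) ⟩
  lookup (σ ∙ inv p) j         ≡⟨ cong (λ v → lookup v j) (∙-inv p) ⟩
  lookup idₘ j                 ≡⟨ lookup-id j ⟩
  j ∎
  where open ≡-Reasoning

∙-inv-cancel : (m : Vec A n) {σ : Map n} (p : Inj σ) → m ∙ σ ∙ inv p ≡ m
∙-inv-cancel m {σ} p = trans (sym (∙-assoc m σ (inv p))) (trans (cong (m ∙_) (∙-inv p)) (∙-id m))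

∙-cancel-inv : (m : Vec A n) {σ : Map n} (p : Inj σ) → m ∙ inv p ∙ σ ≡ m
∙-cancel-inv m {σ} p = trans (sym (∙-assoc m (inv p) σ)) (trans (cong (m ∙_) (inv-∙ p)) (∙-id m))

∙-cancelʳ : {u v : Vec A n} {σ : Map n} → Inj σ → u ∙ σ ≡ v ∙ σ → u ≡ v
∙-cancelʳ {u = u} {v} p e = trans (sym (∙-inv-cancel u p)) (trans (cong (_∙ inv p) e) (∙-inv-cancel v p))

∙-cancelˡ : {σ u v : Map n} → Inj σ → σ ∙ u ≡ σ ∙ v → u ≡ v
∙-cancelˡ {σ = σ} {u} {v} p e = vec-ext λ i → cancel p (trans (sym (lookup-∙ σ u i)) (trans (≡-lookup e i) (lookup-∙ σ v i)))

-- Transpositions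

trf : Fin n → Fin n → Fin n → Fin n
trf x y z with z FinP.≟ x
... | yes _ = y
... | no _ with z FinP.≟ y
... | yes _ = x
... | no _ = z

tr : Fin n → Fin n → Map n
tr x y = tabulate (trf x y)

lookup-tr : (x y z : Fin n) → lookup (tr x y) z ≡ trf x y z
lookup-tr x y z = VecP.lookup∘tabulate (trf x y) z

trf-x : (x y : Fin n) → trf x y x ≡ y
trf-x x y with x FinP.≟ x
... | yes _ = refl
... | no ¬p = ⊥-elim (¬p refl)

trf-y : (x y : Fin n) → trf x y y ≡ x
trf-y x y with y FinP.≟ x
... | yes e = e
... | no _ with y FinP.≟ y
... | yes _ = refl
... | no ¬p = ⊥-elim (¬p refl)

trf-z : {x y z : Fin n} → z ≢ x → z ≢ y → trf x y z ≡ z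
trf-z {x = x} {y} {z} p q with z FinP.≟ x
... | yes e = ⊥-elim (p e)
... | no _ with z FinP.≟ y
... | yes e = ⊥-elim (q e)
... | no _ = refl

trf-elim : (x y z : Fin n) (R : Fin n → Set) → (z ≡ x → R y) → (z ≡ y → R x) → (z ≢ x → z ≢ y → R z) → R (trf x y z)
trf-elim x y z R a b c with z FinP.≟ x
... | yes e = a e
... | no p with z FinP.≟ y
... | yes e = b e
... | no q = c p q

trf-invol : (x y z : Fin n) → trf x y (trf x y z) ≡ z
trf-invol x y z = trf-elim x y z (λ w → trf x y w ≡ z)
  (λ e → trans (trf-y x y) (sym e)) (λ e → trans (trf-x x y) (sym e)) trf-z

tr-invol : (x y : Fin n) → tr x y ∙ tr x y ≡ idₘ
tr-invol x y = vec-ext λ i → trans (lookup-∙ (tr x y) (tr x y) i)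
  (trans (lookup-tr x y _) (trans (cong (trf x y) (lookup-tr x y i)) (trans (trf-invol x y i) (sym (lookup-id i)))))

∙-tr-invol : (m : Vec A n) (x y : Fin n) → m ∙ tr x y ∙ tr x y ≡ m
∙-tr-invol m x y = trans (sym (∙-assoc m (tr x y) (tr x y))) (trans (cong (m ∙_) (tr-invol x y)) (∙-id m))

tr-inj : (x y : Fin n) → Inj (tr x y)
tr-inj x y .cancel {i} {j} e = trans (sym (trf-invol x y i))
  (trans (cong (trf x y) (trans (sym (lookup-tr x y i)) (trans e (lookup-tr x y j)))) (trf-invol x y j))

tr-same : (x : Fin n) → tr x x ≡ idₘ
tr-same x = vec-ext λ i → trans (lookup-tr x x i)
  (trans (trf-elim x x i (_≡ i) sym sym (λ _ _ → refl)) (sym (lookup-id i)))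

∙-tr : (m : Vec A n) (x y : Fin n) → lookup m x ≡ lookup m y → m ∙ tr x y ≡ m
∙-tr m x y e = vec-ext λ i → trans (lookup-∙ m (tr x y) i) (trans (cong (lookup m) (lookup-tr x y i))
  (trf-elim x y i (λ w → lookup m w ≡ lookup m i)
    (λ { refl → sym e }) (λ { refl → e }) (λ _ _ → refl)))

tr-conj : {σ : Map n} → Inj σ → (x y : Fin n) → σ ∙ tr x y ≡ tr (lookup σ x) (lookup σ y) ∙ σ
tr-conj {σ = σ} p x y = vec-ext λ i → begin
  lookup (σ ∙ tr x y) i                              ≡⟨ lookup-∙ σ (tr x y) i ⟩
  lookup σ (lookup (tr x y) i)                       ≡⟨ cong (lookup σ) (lookup-tr x y i) ⟩
  lookup σ (trf x y i)                               ≡⟨ trf-elim x y i (λ w → lookup σ w ≡ trf (lookup σ x) (lookup σ y) (lookup σ i))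
     (λ { refl → sym (trf-x (lookup σ x) (lookup σ y)) })
     (λ { refl → sym (trf-y (lookup σ x) (lookup σ y)) })
     (λ a b → sym (trf-z (a ∘ cancel p) (b ∘ cancel p))) ⟩
  trf (lookup σ x) (lookup σ y) (lookup σ i)         ≡⟨ sym (lookup-tr _ _ _) ⟩
  lookup (tr (lookup σ x) (lookup σ y)) (lookup σ i) ≡⟨ sym (lookup-∙ (tr (lookup σ x) (lookup σ y)) σ i) ⟩
  lookup (tr (lookup σ x) (lookup σ y) ∙ σ) i        ∎
  where open ≡-Reasoning

tr-comm : (x y : Fin n) → tr x y ≡ tr y x
tr-comm x y = vec-ext λ i → trans (lookup-tr x y i)
  (trans (trf-elim x y i (λ w → w ≡ trf y x i)
    (λ { refl → sym (trf-y y x) }) (λ { refl → sym (trf-x y x) }) (λ a b → sym (trf-z b a))) (sym (lookup-tr y x i)))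

-- Boolean tests and the list of all permutations

T-all : {p : A → Bool} (xs : List A) → all p xs ≡ true → ∀ {x} → x ∈ xs → p x ≡ true
T-all {p = p} (y ∷ xs) e q with p y in py
T-all (y ∷ xs) e (here refl) | true = py
T-all (y ∷ xs) e (there q) | true = T-all xs e q

all-T : {p : A → Bool} (xs : List A) → (∀ {x} → x ∈ xs → p x ≡ true) → all p xs ≡ true
all-T [] h = refl
all-T {p = p} (x ∷ xs) h rewrite h (here refl) = all-T xs (h ∘ there)

⌊⌋-yes : (d : Dec P) → P → ⌊ d ⌋ ≡ true
⌊⌋-yes (yes _) p = refl
⌊⌋-yes (no ¬p) p = ⊥-elim (¬p p)

⌊⌋-no : (d : Dec P) → ¬ P → ⌊ d ⌋ ≡ false
⌊⌋-no (yes p) ¬p = ⊥-elim (¬p p)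
⌊⌋-no (no _) ¬p = refl

⌊⌋-true : (d : Dec P) → ⌊ d ⌋ ≡ true → P
⌊⌋-true (yes p) _ = p

isInjective-sound : (σ : Map n) → isInjectiveᵇ σ ≡ true → Inj σ
isInjective-sound {n} σ e .cancel {i} {j} eq with i FinP.≟ j | T-all (allFin n) (T-all (allFin n) e (∈P.∈-allFin i)) (∈P.∈-allFin j)
... | yes p | _ = p
... | no _ | t rewrite ⌊⌋-yes (lookup σ i FinP.≟ lookup σ j) eq with () ← t

isInjective-complete : (σ : Map n) → Inj σ → isInjectiveᵇ σ ≡ true
isInjective-complete {n} σ p = all-T (allFin n) (λ {i} _ → all-T (allFin n) (λ {j} _ → go i j))
  where
  go : ∀ i j → ((i ≟ᶠ j) ∨ not (app σ i ≟ᶠ app σ j)) ≡ true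
  go i j with i FinP.≟ j
  ... | yes _ = refl
  ... | no ¬p rewrite ⌊⌋-no (lookup σ i FinP.≟ lookup σ j) (¬p ∘ cancel p) = refl

filterᵇ-⊆ : (p : A → Bool) (xs : List A) {x : A} → x ∈ filterᵇ p xs → x ∈ xs × p x ≡ true
filterᵇ-⊆ p (y ∷ xs) q with p y in py
filterᵇ-⊆ p (y ∷ xs) (here refl) | true = here refl , py
filterᵇ-⊆ p (y ∷ xs) (there q) | true = let (a , b) = filterᵇ-⊆ p xs q in there a , b
filterᵇ-⊆ p (y ∷ xs) q | false = let (a , b) = filterᵇ-⊆ p xs q in there a , b

filterᵇ-∈ : (p : A → Bool) {xs : List A} {x : A} → x ∈ xs → p x ≡ true → x ∈ filterᵇ p xs
filterᵇ-∈ p {y ∷ xs} (here refl) e rewrite e = here refl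
filterᵇ-∈ p {y ∷ xs} (there q) e with p y
... | true = there (filterᵇ-∈ p q e)
... | false = filterᵇ-∈ p q e

filterᵇ-unique : (p : A → Bool) {xs : List A} → Unique xs → Unique (filterᵇ p xs)
filterᵇ-unique p [] = []
filterᵇ-unique p {x ∷ xs} (x∉ ∷ u) with p x
... | true = All.tabulate (λ q → All.lookup x∉ (proj₁ (filterᵇ-⊆ p xs q))) ∷ filterᵇ-unique p u
... | false = filterᵇ-unique p u

allVecs-complete : (v : Vec (Fin n) k) → v ∈ allVecs k
allVecs-complete [] = here refl
allVecs-complete (x ∷ v) = ∈P.∈-concatMap⁺ (λ v → map (_∷ v) (allFin _))
  (lose (allVecs-complete v) (∈P.∈-map⁺ (_∷ v) (∈P.∈-allFin x)))

allVecs-unique : ∀ k → Unique (allVecs {n} k)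
allVecs-unique zero = [] ∷ []
allVecs-unique {n} (suc k) = go (allVecs-unique k)
  where
  ext : Vec (Fin n) k → List (Vec (Fin n) (suc k))
  ext v = map (_∷ v) (allFin n)
  go : {vs : List (Vec (Fin n) k)} → Unique vs → Unique (concatMap ext vs)
  go [] = []
  go {v ∷ vs} (v∉ ∷ u) = Unique.++⁺ (Unique.map⁺ (λ e → VecP.∷-injectiveˡ e) (Unique.allFin⁺ n)) (go u) disj
    where
    disj : ∀ {w} → w ∈ ext v × w ∈ concatMap ext vs → ⊥
    disj (p , q) with _ , _ , refl ← ∈P.∈-map⁻ (_∷ v) p
      with v′ , v′∈ , q′ ← find (∈P.∈-concatMap⁻ ext {vs} q)
      with _ , _ , e ← ∈P.∈-map⁻ (_∷ v′) q′
      = All.lookup v∉ v′∈ (VecP.∷-injectiveʳ e)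

∈-allPerms : {σ : Map n} → Inj σ → σ ∈ allPerms n
∈-allPerms {σ = σ} p = filterᵇ-∈ isInjectiveᵇ (allVecs-complete σ) (isInjective-complete σ p)

allPerms-inj : {σ : Map n} → σ ∈ allPerms n → Inj σ
allPerms-inj {n} {σ} p = isInjective-sound σ (proj₂ (filterᵇ-⊆ isInjectiveᵇ (allVecs n) p))

allPerms-unique : ∀ n → Unique (allPerms n)
allPerms-unique n = filterᵇ-unique isInjectiveᵇ (allVecs-unique n)

∑-left : {π : Map n} → Inj π → (φ : Map n → ℚ) → ∑ (allPerms n) (λ σ → φ (π ∙ σ)) ≡ ∑ (allPerms n) φ
∑-left {n} {π} p φ = trans (sym (∑.fold-map (allPerms n) (π ∙_) φ))
  (∑.fold-↭ φ (map-↭-self (allPerms-unique n) (λ q → ∈-allPerms (∙-inj p (allPerms-inj q))) (λ _ _ → ∙-cancelˡ p)))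

∑-right : {π : Map n} → Inj π → (φ : Map n → ℚ) → ∑ (allPerms n) (λ σ → φ (σ ∙ π)) ≡ ∑ (allPerms n) φ
∑-right {n} {π} p φ = trans (sym (∑.fold-map (allPerms n) (_∙ π) φ))
  (∑.fold-↭ φ (map-↭-self (allPerms-unique n) (λ q → ∈-allPerms (∙-inj (allPerms-inj q) p)) (λ _ _ → ∙-cancelʳ p)))

∑ₙ-relabel : {σ : Map n} → Inj σ → (f : Fin n → ℕ) → ∑ₙ (allFin n) (f ∘ lookup σ) ≡ ∑ₙ (allFin n) f
∑ₙ-relabel {n} {σ} p f = trans (sym (∑ₙ.fold-map (allFin n) (lookup σ) f))
  (∑ₙ.fold-↭ f (map-↭-self (Unique.allFin⁺ n) (λ _ → ∈P.∈-allFin _) (λ _ _ → cancel p)))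

∑-relabel : {σ : Map n} → Inj σ → (f : Fin n → ℚ) → ∑ (allFin n) (f ∘ lookup σ) ≡ ∑ (allFin n) f
∑-relabel {n} {σ} p f = trans (sym (∑.fold-map (allFin n) (lookup σ) f))
  (∑.fold-↭ f (map-↭-self (Unique.allFin⁺ n) (λ _ → ∈P.∈-allFin _) (λ _ _ → cancel p)))

-- Sign: with sg a b = ±1 according to the order of a and b, sgn σ is the product over i < j of sg (σ i) (σ j).

-1ℚ : ℚ
-1ℚ = - 1ℚ

signOf-suc : ∀ k → signOf (suc k) ≡ -1ℚ * signOf k
signOf-suc k = trans (cong -_ (sym (ℚP.*-identityˡ (signOf k)))) (ℚP.neg-distribˡ-* 1ℚ (signOf k))

-1*-1 : -1ℚ * -1ℚ ≡ 1ℚ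
-1*-1 = refl

*-interchange : ∀ a b c d → (a * b) * (c * d) ≡ (a * c) * (b * d)
*-interchange = ∏.interchange

signOf-sq : ∀ k → signOf k * signOf k ≡ 1ℚ
signOf-sq zero = refl
signOf-sq (suc k) = begin
  signOf (suc k) * signOf (suc k)         ≡⟨ cong₂ _*_ (signOf-suc k) (signOf-suc k) ⟩
  (-1ℚ * signOf k) * (-1ℚ * signOf k)     ≡⟨ *-interchange -1ℚ (signOf k) -1ℚ (signOf k) ⟩
  (-1ℚ * -1ℚ) * (signOf k * signOf k)     ≡⟨ cong₂ _*_ -1*-1 (signOf-sq k) ⟩
  1ℚ * 1ℚ                                 ≡⟨ ℚP.*-identityˡ 1ℚ ⟩
  1ℚ ∎
  where open ≡-Reasoning

signOf-length : (p : A → Bool) (xs : List A) →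
  signOf (length (filterᵇ p xs)) ≡ ∏ xs (λ x → if p x then -1ℚ else 1ℚ)
signOf-length p [] = refl
signOf-length p (x ∷ xs) with p x
... | true = trans (signOf-suc (length (filterᵇ p xs))) (cong (-1ℚ *_) (signOf-length p xs))
... | false = trans (signOf-length p xs) (sym (ℚP.*-identityˡ _))

∏-filterᵇ : (p : A → Bool) (xs : List A) (f : A → ℚ) → ∏ (filterᵇ p xs) f ≡ ∏ xs (λ x → if p x then f x else 1ℚ)
∏-filterᵇ p [] f = refl
∏-filterᵇ p (x ∷ xs) f with p x
... | true = cong (f x *_) (∏-filterᵇ p xs f)
... | false = trans (∏-filterᵇ p xs f) (sym (ℚP.*-identityˡ _))

sg : Fin n → Fin n → ℚ
sg a b = if ⌊ a Fin.<? b ⌋ then 1ℚ else -1ℚ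

sg-< : {a b : Fin n} → a Fin.< b → sg a b ≡ 1ℚ
sg-< {a = a} {b} p rewrite ⌊⌋-yes (a Fin.<? b) p = refl

sg-≮ : {a b : Fin n} → ¬ a Fin.< b → sg a b ≡ -1ℚ
sg-≮ {a = a} {b} p rewrite ⌊⌋-no (a Fin.<? b) p = refl

sg-sq : (a b : Fin n) → sg a b * sg a b ≡ 1ℚ
sg-sq a b with ⌊ a Fin.<? b ⌋
... | true = refl
... | false = refl

sg-flip : {a b : Fin n} → a ≢ b → sg b a ≡ -1ℚ * sg a b
sg-flip {a = a} {b} a≢b with FinP.<-cmp a b
... | tri< p _ q = trans (sg-≮ q) (cong (-1ℚ *_) (sym (sg-< p)))
... | tri≈ _ e _ = ⊥-elim (a≢b e)
... | tri> q _ p = trans (sg-< p) (cong (-1ℚ *_) (sym (sg-≮ q)))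

isLess : Fin n × Fin n → Bool
isLess (i , j) = ⌊ i Fin.<? j ⌋

pairs : ∀ n → List (Fin n × Fin n)
pairs n = filterᵇ isLess (cartesianProduct (allFin n) (allFin n))

∈-pairs : {i j : Fin n} → i Fin.< j → (i , j) ∈ pairs n
∈-pairs {i = i} {j} p = filterᵇ-∈ isLess (∈P.∈-cartesianProduct⁺ (∈P.∈-allFin i) (∈P.∈-allFin j)) (⌊⌋-yes (i Fin.<? j) p)

pairs-< : {i j : Fin n} → (i , j) ∈ pairs n → i Fin.< j
pairs-< {n} {i} {j} p = ⌊⌋-true (i Fin.<? j) (proj₂ (filterᵇ-⊆ isLess (cartesianProduct (allFin n) (allFin n)) p))

pairs-unique : ∀ n → Unique (pairs n)
pairs-unique n = filterᵇ-unique isLess (Unique.cartesianProduct⁺ (Unique.allFin⁺ n) (Unique.allFin⁺ n))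

sgn-∏ : {σ : Map n} → Inj σ → sgn σ ≡ ∏ (pairs n) (λ (i , j) → sg (lookup σ i) (lookup σ j))
sgn-∏ {n} {σ} p = trans (signOf-length isInversion grid)
  (trans (∏.fold-≗ grid (λ (i , j) → go i j)) (sym (∏-filterᵇ isLess grid (λ (i , j) → sg (lookup σ i) (lookup σ j)))))
  where
  grid : List (Fin n × Fin n)
  grid = cartesianProduct (allFin n) (allFin n)
  isInversion : Fin n × Fin n → Bool
  isInversion ij = ⌊ proj₁ ij Fin.<? proj₂ ij ⌋ ∧ ⌊ app σ (proj₂ ij) Fin.<? app σ (proj₁ ij) ⌋
  go : ∀ i j → (if ⌊ i Fin.<? j ⌋ ∧ ⌊ lookup σ j Fin.<? lookup σ i ⌋ then -1ℚ else 1ℚ)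
    ≡ (if ⌊ i Fin.<? j ⌋ then sg (lookup σ i) (lookup σ j) else 1ℚ)
  go i j with i Fin.<? j
  ... | no _ = refl
  ... | yes i<j with FinP.<-cmp (lookup σ i) (lookup σ j)
  ... | tri< a _ b rewrite ⌊⌋-no (lookup σ j Fin.<? lookup σ i) b = sym (sg-< a)
  ... | tri≈ _ e _ = ⊥-elim (FinP.<-irrefl (cancel p e) i<j)
  ... | tri> a _ b rewrite ⌊⌋-yes (lookup σ j Fin.<? lookup σ i) b = sym (sg-≮ a)

sgn-sq : (σ : Map n) → sgn σ * sgn σ ≡ 1ℚ
sgn-sq σ = signOf-sq (inversions σ)

sortPair : Fin n × Fin n → Fin n × Fin n
sortPair (a , b) = if ⌊ a Fin.<? b ⌋ then (a , b) else (b , a)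

sortPair-< : {a b : Fin n} → a Fin.< b → sortPair (a , b) ≡ (a , b)
sortPair-< {a = a} {b} p rewrite ⌊⌋-yes (a Fin.<? b) p = refl

sortPair-> : {a b : Fin n} → b Fin.< a → sortPair (a , b) ≡ (b , a)
sortPair-> {a = a} {b} p rewrite ⌊⌋-no (a Fin.<? b) (FinP.<-asym p) = refl

pairs-relabel : {τ : Map n} → Inj τ → map (λ (i , j) → sortPair (lookup τ i , lookup τ j)) (pairs n) ↭ pairs n
pairs-relabel {n} {τ} p = map-↭-self (pairs-unique n) into inj
  where
  into : ∀ {x} → x ∈ pairs n → sortPair (lookup τ (proj₁ x) , lookup τ (proj₂ x)) ∈ pairs n
  into {i , j} q with FinP.<-cmp (lookup τ i) (lookup τ j)
  ... | tri< a _ _ = subst (_∈ pairs n) (sym (sortPair-< a)) (∈-pairs a)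
  ... | tri≈ _ e _ = ⊥-elim (FinP.<-irrefl (cancel p e) (pairs-< q))
  ... | tri> _ _ a = subst (_∈ pairs n) (sym (sortPair-> a)) (∈-pairs a)
  inj : ∀ {x y} → x ∈ pairs n → y ∈ pairs n →
    sortPair (lookup τ (proj₁ x) , lookup τ (proj₂ x)) ≡ sortPair (lookup τ (proj₁ y) , lookup τ (proj₂ y)) → x ≡ y
  inj {i , j} {i′ , j′} q q′ e with FinP.<-cmp (lookup τ i) (lookup τ j) | FinP.<-cmp (lookup τ i′) (lookup τ j′)
  ... | tri≈ _ e _ | _ = ⊥-elim (FinP.<-irrefl (cancel p e) (pairs-< q))
  ... | tri< _ _ _ | tri≈ _ e _ = ⊥-elim (FinP.<-irrefl (cancel p e) (pairs-< q′))
  ... | tri> _ _ _ | tri≈ _ e _ = ⊥-elim (FinP.<-irrefl (cancel p e) (pairs-< q′))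
  ... | tri< a _ _ | tri< b _ _ = let e′ = trans (sym (sortPair-< a)) (trans e (sortPair-< b)) in
    cong₂ _,_ (cancel p (cong proj₁ e′)) (cancel p (cong proj₂ e′))
  ... | tri> _ _ a | tri> _ _ b = let e′ = trans (sym (sortPair-> a)) (trans e (sortPair-> b)) in
    cong₂ _,_ (cancel p (cong proj₂ e′)) (cancel p (cong proj₁ e′))
  ... | tri< a _ _ | tri> _ _ b = let e′ = trans (sym (sortPair-< a)) (trans e (sortPair-> b)) in
    ⊥-elim (FinP.<-asym (pairs-< q) (subst₂ Fin._<_ (sym (cancel p (cong proj₂ e′))) (sym (cancel p (cong proj₁ e′))) (pairs-< q′)))
  ... | tri> _ _ a | tri< b _ _ = let e′ = trans (sym (sortPair-> a)) (trans e (sortPair-< b)) in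
    ⊥-elim (FinP.<-asym (pairs-< q) (subst₂ Fin._<_ (sym (cancel p (cong proj₁ e′))) (sym (cancel p (cong proj₂ e′))) (pairs-< q′)))

-- The ratio sg (σ a) (σ b) / sg a b is symmetric in a and b, so its product over pairs is insensitive to relabelling.
sgn-∙ : {σ τ : Map n} → Inj σ → Inj τ → sgn (σ ∙ τ) ≡ sgn σ * sgn τ
sgn-∙ {n} {σ} {τ} p q = begin
  sgn (σ ∙ τ)                                                      ≡⟨ sgn-∏ (∙-inj p q) ⟩
  ∏ (pairs n) (λ (i , j) → sg (lookup (σ ∙ τ) i) (lookup (σ ∙ τ) j)) ≡⟨ ∏.fold-≗ (pairs n) (λ (i , j) → step i j) ⟩
  ∏ (pairs n) (λ (i , j) → ratio (lookup τ i , lookup τ j) * sg (lookup τ i) (lookup τ j))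
                                                                   ≡⟨ ∏.fold-• (pairs n) _ _ ⟩
  ∏ (pairs n) (λ (i , j) → ratio (lookup τ i , lookup τ j)) * ∏ (pairs n) (λ (i , j) → sg (lookup τ i) (lookup τ j))
                                                                   ≡⟨ cong₂ _*_ relabel (sym (sgn-∏ q)) ⟩
  sgn σ * sgn τ                                                    ∎
  where
  open ≡-Reasoning
  ratio : Fin n × Fin n → ℚ
  ratio (a , b) = sg (lookup σ a) (lookup σ b) * sg a b
  step : ∀ i j → sg (lookup (σ ∙ τ) i) (lookup (σ ∙ τ) j) ≡ ratio (lookup τ i , lookup τ j) * sg (lookup τ i) (lookup τ j)
  step i j = begin
    sg (lookup (σ ∙ τ) i) (lookup (σ ∙ τ) j)   ≡⟨ cong₂ sg (lookup-∙ σ τ i) (lookup-∙ σ τ j) ⟩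
    x                                          ≡⟨ sym (ℚP.*-identityʳ x) ⟩
    x * 1ℚ                                     ≡⟨ cong (x *_) (sym (sg-sq (lookup τ i) (lookup τ j))) ⟩
    x * (y * y)                                ≡⟨ sym (ℚP.*-assoc x y y) ⟩
    x * y * y                                  ∎
    where
    x = sg (lookup σ (lookup τ i)) (lookup σ (lookup τ j))
    y = sg (lookup τ i) (lookup τ j)
  ratio-sym : ∀ {a b} → a ≢ b → ratio (b , a) ≡ ratio (a , b)
  ratio-sym {a} {b} a≢b = begin
    sg (lookup σ b) (lookup σ a) * sg b a                       ≡⟨ cong₂ _*_ (sg-flip (a≢b ∘ cancel p)) (sg-flip a≢b) ⟩
    (-1ℚ * sg (lookup σ a) (lookup σ b)) * (-1ℚ * sg a b)       ≡⟨ *-interchange -1ℚ (sg (lookup σ a) (lookup σ b)) -1ℚ (sg a b) ⟩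
    (-1ℚ * -1ℚ) * ratio (a , b)                                 ≡⟨ cong (_* ratio (a , b)) -1*-1 ⟩
    1ℚ * ratio (a , b)                                          ≡⟨ ℚP.*-identityˡ (ratio (a , b)) ⟩
    ratio (a , b)                                               ∎
  ratio-sort : ∀ {a b} → a ≢ b → ratio (a , b) ≡ ratio (sortPair (a , b))
  ratio-sort {a} {b} a≢b with FinP.<-cmp a b
  ... | tri< l _ _ = cong ratio (sym (sortPair-< l))
  ... | tri≈ _ e _ = ⊥-elim (a≢b e)
  ... | tri> _ _ l = trans (sym (ratio-sym a≢b)) (cong ratio (sym (sortPair-> l)))
  relabel : ∏ (pairs n) (λ (i , j) → ratio (lookup τ i , lookup τ j)) ≡ sgn σ
  relabel = begin
    ∏ (pairs n) (λ (i , j) → ratio (lookup τ i , lookup τ j))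
      ≡⟨ ∏.fold-cong (pairs n) (λ {(i , j)} m → ratio-sort (λ e → FinP.<-irrefl (cancel q e) (pairs-< m))) ⟩
    ∏ (pairs n) (λ (i , j) → ratio (sortPair (lookup τ i , lookup τ j)))
      ≡⟨ sym (∏.fold-map (pairs n) (λ (i , j) → sortPair (lookup τ i , lookup τ j)) ratio) ⟩
    ∏ (map (λ (i , j) → sortPair (lookup τ i , lookup τ j)) (pairs n)) ratio
      ≡⟨ ∏.fold-↭ ratio (pairs-relabel q) ⟩
    ∏ (pairs n) ratio
      ≡⟨ ∏.fold-cong (pairs n) (λ {(i , j)} m → trans (cong (sg (lookup σ i) (lookup σ j) *_) (sg-< (pairs-< m))) (ℚP.*-identityʳ _)) ⟩
    ∏ (pairs n) (λ (i , j) → sg (lookup σ i) (lookup σ j))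
      ≡⟨ sym (sgn-∏ p) ⟩
    sgn σ ∎

sq-cancelʳ : ∀ {a b c} → c * c ≡ 1ℚ → a * c ≡ b * c → a ≡ b
sq-cancelʳ {a} {b} {c} h e = begin
  a            ≡⟨ sym (ℚP.*-identityʳ a) ⟩
  a * 1ℚ       ≡⟨ cong (a *_) (sym h) ⟩
  a * (c * c)  ≡⟨ sym (ℚP.*-assoc a c c) ⟩
  a * c * c    ≡⟨ cong (_* c) e ⟩
  b * c * c    ≡⟨ ℚP.*-assoc b c c ⟩
  b * (c * c)  ≡⟨ cong (b *_) h ⟩
  b * 1ℚ       ≡⟨ ℚP.*-identityʳ b ⟩
  b            ∎
  where open ≡-Reasoning

sgn-conj : {σ : Map n} → Inj σ → (x y : Fin n) → sgn (tr (lookup σ x) (lookup σ y)) ≡ sgn (tr x y)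
sgn-conj {σ = σ} p x y = sq-cancelʳ (sgn-sq σ) (begin
  sgn (tr (lookup σ x) (lookup σ y)) * sgn σ   ≡⟨ sym (sgn-∙ (tr-inj _ _) p) ⟩
  sgn (tr (lookup σ x) (lookup σ y) ∙ σ)       ≡⟨ cong sgn (sym (tr-conj p x y)) ⟩
  sgn (σ ∙ tr x y)                             ≡⟨ sgn-∙ p (tr-inj x y) ⟩
  sgn σ * sgn (tr x y)                         ≡⟨ ℚP.*-comm (sgn σ) _ ⟩
  sgn (tr x y) * sgn σ                         ∎)
  where open ≡-Reasoning

-- Among the pairs i < j only (0, 1) is inverted, so the product has a single factor different from
-- 1.
sgn-tr01 : ∀ n → sgn (tr {suc (suc n)} Fin.zero (Fin.suc Fin.zero)) ≡ -1ℚ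
sgn-tr01 n = trans (sgn-∏ (tr-inj x y))
  (trans (∏.fold-single _ (pairs-unique _) (∈-pairs {i = x} {y} (s≤s z≤n)) (λ {(i , j)} m → other i j (pairs-< m)))
    (trans (cong₂ sg (trans (lookup-tr x y x) (trf-x x y)) (trans (lookup-tr x y y) (trf-y x y))) (sg-≮ {a = y} {x} (λ ()))))
  where
  x y : Fin (suc (suc n))
  x = Fin.zero
  y = Fin.suc Fin.zero
  other : ∀ i j → i Fin.< j → (i , j) ≢ (x , y) → sg (lookup (tr x y) i) (lookup (tr x y) j) ≡ 1ℚ
  other i j i<j ne = trans (cong₂ sg (lookup-tr x y i) (lookup-tr x y j)) (go i j i<j ne)
    where
    go : ∀ i j → i Fin.< j → (i , j) ≢ (x , y) → sg (trf x y i) (trf x y j) ≡ 1ℚ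
    go Fin.zero (Fin.suc Fin.zero) _ ne = ⊥-elim (ne refl)
    go Fin.zero (Fin.suc (Fin.suc j)) _ _ = sg-< {a = y} {Fin.suc (Fin.suc j)} (s≤s (s≤s z≤n))
    go (Fin.suc Fin.zero) (Fin.suc (Fin.suc j)) _ _ = sg-< {a = x} {Fin.suc (Fin.suc j)} (s≤s z≤n)
    go (Fin.suc Fin.zero) (Fin.suc Fin.zero) (s≤s ()) _
    go (Fin.suc (Fin.suc i)) (Fin.suc Fin.zero) (s≤s ()) _
    go (Fin.suc (Fin.suc i)) (Fin.suc (Fin.suc j)) l _ = sg-< l

sgn-tr : (x y : Fin n) → x ≢ y → sgn (tr x y) ≡ -1ℚ
sgn-tr {suc zero} Fin.zero Fin.zero ne = ⊥-elim (ne refl)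
sgn-tr {suc (suc n)} x y ne = begin
  sgn (tr x y)                           ≡⟨ cong₂ (λ a b → sgn (tr a b)) (sym σ0) (sym σ1) ⟩
  sgn (tr (lookup σ i₀) (lookup σ i₁))   ≡⟨ sgn-conj (∙-inj (tr-inj i₀ x) (tr-inj i₁ y′)) i₀ i₁ ⟩
  sgn (tr i₀ i₁)                         ≡⟨ sgn-tr01 n ⟩
  -1ℚ ∎
  where
  open ≡-Reasoning
  i₀ i₁ y′ : Fin (suc (suc n))
  i₀ = Fin.zero
  i₁ = Fin.suc Fin.zero
  y′ = trf i₀ x y
  σ : Map (suc (suc n))
  -- A permutation that takes the first two indices to `x` and `y`, so that conjugation reduces the
  -- claim to `sgn-tr01`. The point `y′` is the one that the outer transposition carries to `y`.
  σ = tr i₀ x ∙ tr i₁ y′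
  i₀≢y′ : i₀ ≢ y′
  i₀≢y′ e = ne (trans (sym (trf-x i₀ x)) (trans (cong (trf i₀ x) e) (trf-invol i₀ x y)))
  σ-at : ∀ z → lookup σ z ≡ trf i₀ x (trf i₁ y′ z)
  σ-at z = trans (lookup-∙ (tr i₀ x) (tr i₁ y′) z) (trans (lookup-tr i₀ x (lookup (tr i₁ y′) z)) (cong (trf i₀ x) (lookup-tr i₁ y′ z)))
  σ0 : lookup σ i₀ ≡ x
  σ0 = trans (σ-at i₀) (trans (cong (trf i₀ x) (trf-z {x = i₁} {y′} {i₀} (λ ()) i₀≢y′)) (trf-x i₀ x))
  σ1 : lookup σ i₁ ≡ y
  σ1 = trans (σ-at i₁) (trans (cong (trf i₀ x) (trf-x i₁ y′)) (trf-invol i₀ x y))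

-- Row symmetrizers and column antisymmetrizers share their theory. It uses a multiplicative
-- function with values ±1 and its common value `e` on the transpositions.
record Character (n : ℕ) : Set where
  field
    χ : Map n → ℚ
    e : ℚ
    χ-∙ : {σ τ : Map n} → Inj σ → Inj τ → χ (σ ∙ τ) ≡ χ σ * χ τ
    χ-sq : (σ : Map n) → χ σ * χ σ ≡ 1ℚ
    χ-tr : (x y : Fin n) → x ≢ y → χ (tr x y) ≡ e
    e-sq : e * e ≡ 1ℚ

  χ-id : χ idₘ ≡ 1ℚ
  χ-id = sq-cancelʳ (χ-sq idₘ) (trans (sym (χ-∙ id-inj id-inj)) (trans (cong χ (id-∙ idₘ)) (sym (ℚP.*-identityˡ _))))

  χ-inv : {σ : Map n} (p : Inj σ) → χ (inv p) ≡ χ σ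
  χ-inv {σ} p = sq-cancelʳ (χ-sq σ) (trans (sym (χ-∙ (inv-inj p) p))
    (trans (cong χ (inv-∙ p)) (trans χ-id (sym (χ-sq σ)))))

trivial : ∀ n → Character n
trivial n = record
  { χ = λ _ → 1ℚ ; e = 1ℚ ; χ-∙ = λ _ _ → refl ; χ-sq = λ _ → refl ; χ-tr = λ _ _ _ → refl ; e-sq = refl }

sign : ∀ n → Character n
sign n = record
  { χ = sgn ; e = -1ℚ ; χ-∙ = sgn-∙ ; χ-sq = sgn-sq ; χ-tr = sgn-tr ; e-sq = refl }

-- Functions on exponent vectors and Young symmetrizers

V : ℕ → Set
V n = Mon n → ℚ

_▷_ : Map n → V n → V n
(π ▷ f) m = f (m ∙ π)

-- A set partition is encoded by a labelling whose fibres are the blocks. Its Young subgroup is the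
-- stabilizer of the labelling, and passing to `r ∙ π` conjugates that subgroup.
stab? : (r : Vec ℕ n) (σ : Map n) → Dec (r ∙ σ ≡ r)
stab? r σ = VecP.≡-dec ℕ._≟_ (r ∙ σ) r

open Character

weight : Character n → Vec ℕ n → Map n → ℚ
weight X r σ = ⟦ stab? r σ ⟧ * χ X σ

-- For row labels r and the trivial character this is the row symmetrizer of a tableau;
-- for column labels and the sign character it is the column antisymmetrizer.
Y : Character n → Vec ℕ n → V n → V n
Y {n} X r f m = ∑ (allPerms n) (λ σ → weight X r σ * f (m ∙ σ))

module _ (X : Character n) where

  Y-cong : (r : Vec ℕ n) {f g : V n} → f ≗ g → Y X r f ≗ Y X r g
  Y-cong r h m = ∑.fold-≗ (allPerms n) (λ σ → cong (weight X r σ *_) (h (m ∙ σ)))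

  -- The sum is reindexed by σ ↦ π σ π⁻¹, which carries the stabilizer of `r ∙ π` to that of `r` and
  -- leaves the character value unchanged.
  Y-equivariant : {π : Map n} → Inj π → (r : Vec ℕ n) (f : V n) (m : Mon n) →
    Y X (r ∙ π) f (m ∙ π) ≡ Y X r (π ▷ f) m
  Y-equivariant {π} p r f m = begin
    ∑ (allPerms n) (λ σ → weight X (r ∙ π) σ * f (m ∙ π ∙ σ)) ≡⟨ ∑.fold-cong (allPerms n) (λ {σ} q → cong₂ _*_ (wt (allPerms-inj q)) (cong f (arg σ))) ⟩
    ∑ (allPerms n) (λ σ → φ (π ∙ (σ ∙ inv p)))                ≡⟨ ∑-right (inv-inj p) (λ σ → φ (π ∙ σ)) ⟩
    ∑ (allPerms n) (λ σ → φ (π ∙ σ))                          ≡⟨ ∑-left p φ ⟩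
    ∑ (allPerms n) φ                                          ∎
    where
    open ≡-Reasoning
    φ : Map n → ℚ
    φ σ = weight X r σ * f (m ∙ σ ∙ π)
    unfold : (u : Vec A n) (σ : Map n) → u ∙ (π ∙ (σ ∙ inv p)) ≡ u ∙ π ∙ σ ∙ inv p
    unfold u σ = trans (∙-assoc u π (σ ∙ inv p)) (∙-assoc (u ∙ π) σ (inv p))
    arg : ∀ σ → m ∙ π ∙ σ ≡ m ∙ (π ∙ (σ ∙ inv p)) ∙ π
    arg σ = sym (trans (cong (_∙ π) (unfold m σ)) (∙-cancel-inv (m ∙ π ∙ σ) p))
    wt : ∀ {σ} → Inj σ → weight X (r ∙ π) σ ≡ weight X r (π ∙ (σ ∙ inv p))
    wt {σ} s = cong₂ _*_
      (⟦⟧-cong (stab? (r ∙ π) σ) (stab? r (π ∙ (σ ∙ inv p)))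
        (λ e → trans (unfold r σ) (trans (cong (_∙ inv p) e) (∙-inv-cancel r p)))
        (λ e → trans (sym (∙-cancel-inv (r ∙ π ∙ σ) p)) (cong (_∙ π) (trans (sym (unfold r σ)) e))))
      (sym (begin
        χ X (π ∙ (σ ∙ inv p))           ≡⟨ trans (χ-∙ X p (∙-inj s (inv-inj p))) (cong (χ X π *_) (χ-∙ X s (inv-inj p))) ⟩
        χ X π * (χ X σ * χ X (inv p))   ≡⟨ cong (λ z → χ X π * (χ X σ * z)) (χ-inv X p) ⟩
        χ X π * (χ X σ * χ X π)         ≡⟨ cong (χ X π *_) (ℚP.*-comm (χ X σ) (χ X π)) ⟩
        χ X π * (χ X π * χ X σ)         ≡⟨ sym (ℚP.*-assoc (χ X π) (χ X π) (χ X σ)) ⟩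
        χ X π * χ X π * χ X σ           ≡⟨ cong (_* χ X σ) (χ-sq X π) ⟩
        1ℚ * χ X σ                      ≡⟨ ℚP.*-identityˡ (χ X σ) ⟩
        χ X σ                           ∎))

  Y-translate : {π : Map n} (p : Inj π) (r : Vec ℕ n) (f : V n) (m : Mon n) →
    Y X r f (m ∙ π) ≡ Y X (r ∙ inv p) (π ▷ f) m
  Y-translate {π} p r f m =
    trans (cong (λ z → Y X z f (m ∙ π)) (sym (∙-cancel-inv r p))) (Y-equivariant p (r ∙ inv p) f m)

  SemiInvariant : Vec ℕ n → V n → Set
  SemiInvariant r f = ∀ {π} → Inj π → r ∙ π ≡ r → ∀ m → f (m ∙ π) ≡ χ X π * f m

  Y-semiInvariant : (r : Vec ℕ n) (f : V n) → SemiInvariant r (Y X r f)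
  Y-semiInvariant r f {π} p e m = sym (begin
    χ X π * Y X r f m                                            ≡⟨ cong (χ X π *_) (sym (∑-left p ψ)) ⟩
    χ X π * ∑ (allPerms n) (λ σ → ψ (π ∙ σ))                     ≡⟨ ∑-*ˡ (allPerms n) (χ X π) _ ⟩
    ∑ (allPerms n) (λ σ → χ X π * ψ (π ∙ σ))                     ≡⟨ ∑.fold-cong (allPerms n) (λ q → step (allPerms-inj q)) ⟩
    ∑ (allPerms n) (λ σ → weight X r σ * f (m ∙ π ∙ σ))          ∎)
    where
    open ≡-Reasoning
    ψ : Map n → ℚ
    ψ σ = weight X r σ * f (m ∙ σ)
    step : ∀ {σ} → Inj σ → χ X π * ψ (π ∙ σ) ≡ weight X r σ * f (m ∙ π ∙ σ)
    step {σ} s = begin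
      χ X π * (⟦ stab? r (π ∙ σ) ⟧ * χ X (π ∙ σ) * f (m ∙ (π ∙ σ)))
        ≡⟨ cong₂ (λ a b → χ X π * (a * χ X (π ∙ σ) * f b))
             (⟦⟧-cong (stab? r (π ∙ σ)) (stab? r σ)
               (λ h → trans (sym (trans (∙-assoc r π σ) (cong (_∙ σ) e))) h)
               (λ h → trans (trans (∙-assoc r π σ) (cong (_∙ σ) e)) h)) (∙-assoc m π σ) ⟩
      χ X π * (⟦ stab? r σ ⟧ * χ X (π ∙ σ) * f (m ∙ π ∙ σ))
        ≡⟨ cong (λ a → χ X π * (⟦ stab? r σ ⟧ * a * f (m ∙ π ∙ σ))) (χ-∙ X p s) ⟩
      χ X π * (⟦ stab? r σ ⟧ * (χ X π * χ X σ) * f (m ∙ π ∙ σ))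
        ≡⟨ rearrange (χ X π) ⟦ stab? r σ ⟧ (χ X σ) (f (m ∙ π ∙ σ)) ⟩
      (χ X π * χ X π) * (⟦ stab? r σ ⟧ * χ X σ * f (m ∙ π ∙ σ))
        ≡⟨ cong (_* (⟦ stab? r σ ⟧ * χ X σ * f (m ∙ π ∙ σ))) (χ-sq X π) ⟩
      1ℚ * (⟦ stab? r σ ⟧ * χ X σ * f (m ∙ π ∙ σ))
        ≡⟨ ℚP.*-identityˡ _ ⟩
      weight X r σ * f (m ∙ π ∙ σ) ∎
      where
      rearrange : ∀ a b c d → a * (b * (a * c) * d) ≡ (a * a) * (b * c * d)
      rearrange = Solver.solve-∀ ℚring

  Y-absorb : {π : Map n} → Inj π → (r : Vec ℕ n) → r ∙ π ≡ r → (f : V n) (m : Mon n) →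
    Y X r (π ▷ f) m ≡ χ X π * Y X r f m
  Y-absorb {π} p r e f m = begin
    Y X r (π ▷ f) m          ≡⟨ sym (Y-equivariant p r f m) ⟩
    Y X (r ∙ π) f (m ∙ π)    ≡⟨ cong (λ z → Y X z f (m ∙ π)) e ⟩
    Y X r f (m ∙ π)          ≡⟨ Y-semiInvariant r f p e m ⟩
    χ X π * Y X r f m        ∎
    where open ≡-Reasoning

order : Vec ℕ n → ℚ
order {n} r = ∑ (allPerms n) (λ σ → ⟦ stab? r σ ⟧)

order≢0 : (r : Vec ℕ n) → order r ≢ 0ℚ
order≢0 {n} r = ∑-⟦⟧≢0 (allPerms n) (stab? r) (∈-allPerms id-inj) (∙-id r)

-- In each term the two character values cancel, leaving `f m`. Hence `Y` is idempotent up to the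
-- order of the Young subgroup.
Y-scale : (X : Character n) (r : Vec ℕ n) {f : V n} → SemiInvariant X r f → ∀ m → Y X r f m ≡ order r * f m
Y-scale {n} X r {f} h m = trans (∑.fold-cong (allPerms n) (λ q → step (allPerms-inj q))) (sym (∑-*ʳ (allPerms n) (f m) _))
  where
  rearrange : ∀ a b c → a * b * (b * c) ≡ a * ((b * b) * c)
  rearrange = Solver.solve-∀ ℚring
  step : ∀ {σ} → Inj σ → ⟦ stab? r σ ⟧ * χ X σ * f (m ∙ σ) ≡ ⟦ stab? r σ ⟧ * f m
  step {σ} s = trans (ℚP.*-assoc ⟦ stab? r σ ⟧ (χ X σ) (f (m ∙ σ)))
    (⟦⟧-guard (stab? r σ) (λ e → trans (cong (χ X σ *_) (h s e m))
      (trans (sym (ℚP.*-assoc (χ X σ) (χ X σ) (f m))) (trans (cong (_* f m) (χ-sq X σ)) (ℚP.*-identityˡ (f m))))))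

-- Linearity is mostly used in one form: what holds for all translates of `f` holds for its
-- symmetrizations. Vanishing, restricted support, orthogonality to a vector and lying on a line are
-- the instances.
record Subspace (D : V n → Set) : Set where
  field
    resp : ∀ {f g} → f ≗ g → D f → D g
    zeroᵥ : D (λ _ → 0ℚ)
    lin : ∀ {f g} c → D f → D g → D (λ m → c * f m + g m)

  ∑-closed : (xs : List A) (c : A → ℚ) (g : A → V n) → (∀ {a} → a ∈ xs → D (g a)) → D (λ m → ∑ xs (λ a → c a * g a m))
  ∑-closed [] c g h = zeroᵥ
  ∑-closed (x ∷ xs) c g h = lin (c x) (h (here refl)) (∑-closed xs c g (h ∘ there))

  Y-closed : (X : Character n) (r : Vec ℕ n) {f : V n} → (∀ {π} → Inj π → D (π ▷ f)) → D (Y X r f)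
  Y-closed X r h = ∑-closed (allPerms n) (weight X r) _ (λ q → h (allPerms-inj q))

  ▷Y-closed : (X : Character n) (r : Vec ℕ n) {f : V n} → (∀ {π} → Inj π → D (π ▷ f)) →
    ∀ {π} → Inj π → D (π ▷ Y X r f)
  ▷Y-closed X r {f} h {π} p = ∑-closed (allPerms n) (weight X r) (λ σ m → f (m ∙ π ∙ σ))
    (λ {σ} q → resp (λ m → cong f (∙-assoc m π σ)) (h (∙-inj p (allPerms-inj q))))

open Subspace

Zero : V n → Set
Zero f = ∀ m → f m ≡ 0ℚ

zeroSubspace : Subspace (Zero {n})
zeroSubspace .resp e h m = trans (sym (e m)) (h m)
zeroSubspace .zeroᵥ m = refl
zeroSubspace .lin c h k m = trans (cong₂ (λ a b → c * a + b) (h m) (k m)) (trans (ℚP.+-identityʳ _) (ℚP.*-zeroʳ c))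

Y-lin : (X : Character n) (r : Vec ℕ n) (c : ℚ) (f g : V n) (m : Mon n) →
  Y X r (λ m → c * f m + g m) m ≡ c * Y X r f m + Y X r g m
Y-lin {n} X r c f g m = begin
  ∑ (allPerms n) (λ σ → weight X r σ * (c * f (m ∙ σ) + g (m ∙ σ)))
    ≡⟨ ∑.fold-≗ (allPerms n) (λ σ → rearrange (weight X r σ) c (f (m ∙ σ)) (g (m ∙ σ))) ⟩
  ∑ (allPerms n) (λ σ → c * (weight X r σ * f (m ∙ σ)) + weight X r σ * g (m ∙ σ))
    ≡⟨ ∑.fold-• (allPerms n) _ _ ⟩
  ∑ (allPerms n) (λ σ → c * (weight X r σ * f (m ∙ σ))) + Y X r g m
    ≡⟨ cong (_+ Y X r g m) (sym (∑-*ˡ (allPerms n) c _)) ⟩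
  c * Y X r f m + Y X r g m ∎
  where
  open ≡-Reasoning
  rearrange : ∀ w c a b → w * (c * a + b) ≡ c * (w * a) + w * b
  rearrange = Solver.solve-∀ ℚring

Y-zero : (X : Character n) (r : Vec ℕ n) {f : V n} → Zero f → Zero (Y X r f)
Y-zero {n} X r h m = ∑.fold-ε (allPerms n) (λ {σ} _ → trans (cong (weight X r σ *_) (h (m ∙ σ))) (ℚP.*-zeroʳ (weight X r σ)))

Y-preimage : {D : V n → Set} (X : Character n) (r : Vec ℕ n) → Subspace D → Subspace (λ f → D (Y X r f))
Y-preimage X r S .resp e h = resp S (Y-cong X r e) h
Y-preimage X r S .zeroᵥ = resp S (λ m → sym (Y-zero X r (λ _ → refl) m)) (zeroᵥ S)
Y-preimage X r S .lin {f} {g} c h k = resp S (λ m → sym (Y-lin X r c f g m)) (lin S c h k)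

▷-preimage : {D : V n → Set} (π : Map n) → Subspace D → Subspace (λ f → D (π ▷ f))
▷-preimage π S .resp e h = resp S (λ m → e (m ∙ π)) h
▷-preimage π S .zeroᵥ = zeroᵥ S
▷-preimage π S .lin c h k = lin S c h k

▷-∙ : {D : V n → Set} → Subspace D → {f : V n} (σ τ : Map n) → D ((σ ∙ τ) ▷ f) → D (σ ▷ (τ ▷ f))
▷-∙ S {f} σ τ = resp S (λ m → cong f (∙-assoc m σ τ))

-- The transposition of `x` and `y`, inserted between the two symmetrizers, is absorbed on one side
-- with the value `e X` and on the other with `e X′`; so the two multiples of `h` agree.
Y-kill : (X X′ : Character n) → e X ≢ e X′ → (r k : Vec ℕ n) {x y : Fin n} → x ≢ y →
  lookup r x ≡ lookup r y → lookup k x ≡ lookup k y → (f : V n) → Zero (Y X r (Y X′ k f))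
Y-kill X X′ e≢ r k {x} {y} x≢y rxy kxy f m = *≡0⇒ {e X + - e X′} {h}
  (λ z → e≢ (GroupP.x∙y⁻¹≈ε⇒x≈y ℚP.+-0-group (e X) (e X′) z))
  (trans (rearrange (e X) (e X′) h) (trans (cong (_+ - (e X′ * h)) eq) (ℚP.+-inverseʳ (e X′ * h))))
  where
  open ≡-Reasoning
  g = Y X′ k f
  h = Y X r g m
  rearrange : ∀ a b c → (a + - b) * c ≡ a * c + - (b * c)
  rearrange = Solver.solve-∀ ℚring
  eq : e X * h ≡ e X′ * h
  eq = begin
    e X * h                                ≡⟨ cong (_* h) (sym (χ-tr X x y x≢y)) ⟩
    χ X (tr x y) * h                       ≡⟨ sym (Y-absorb X (tr-inj x y) r (∙-tr r x y rxy) g m) ⟩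
    Y X r (tr x y ▷ g) m                   ≡⟨ Y-cong X r {tr x y ▷ g} {λ m → e X′ * g m + 0ℚ}
       (λ m → trans (Y-semiInvariant X′ k f (tr-inj x y) (∙-tr k x y kxy) m)
         (trans (cong (_* g m) (χ-tr X′ x y x≢y)) (sym (ℚP.+-identityʳ _)))) m ⟩
    Y X r (λ m → e X′ * g m + 0ℚ) m        ≡⟨ Y-lin X r (e X′) g (λ _ → 0ℚ) m ⟩
    e X′ * h + Y X r (λ _ → 0ℚ) m          ≡⟨ cong (e X′ * h +_) (Y-zero X r (λ _ → refl) m) ⟩
    e X′ * h + 0ℚ                          ≡⟨ ℚP.+-identityʳ _ ⟩
    e X′ * h                               ∎

-- Garnir relations and the class sum of transpositions

⟦⟧-× : (d : Dec P) (e : Dec Q) → ⟦ d ×-dec e ⟧ ≡ ⟦ d ⟧ * ⟦ e ⟧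
⟦⟧-× (yes _) (yes _) = refl
⟦⟧-× (yes _) (no _) = refl
⟦⟧-× (no _) e = sym (ℚP.*-zeroˡ ⟦ e ⟧)

∑-pick : (f : Fin n → ℚ) (a : Fin n) → ∑ (allFin n) (λ x → ⟦ a FinP.≟ x ⟧ * f x) ≡ f a
∑-pick {n} f a = trans
  (∑.fold-single (λ x → ⟦ a FinP.≟ x ⟧ * f x) (Unique.allFin⁺ n) (∈P.∈-allFin a)
    (λ {x} _ ne → trans (cong (_* f x) (⟦⟧-no (a FinP.≟ x) (ne ∘ sym))) (ℚP.*-zeroˡ (f x))))
  (trans (cong (_* f a) (⟦⟧-yes (a FinP.≟ a) refl)) (ℚP.*-identityˡ (f a)))

∑-pickℕ : (f : ℕ → ℚ) {a N : ℕ} → a < N → ∑ (upTo N) (λ i → ⟦ a ℕ.≟ i ⟧ * f i) ≡ f a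
∑-pickℕ f {a} {N} a<N = trans
  (∑.fold-single (λ i → ⟦ a ℕ.≟ i ⟧ * f i) (Unique.upTo⁺ N) (∈P.∈-upTo⁺ a<N)
    (λ {i} _ ne → trans (cong (_* f i) (⟦⟧-no (a ℕ.≟ i) (ne ∘ sym))) (ℚP.*-zeroˡ (f i))))
  (trans (cong (_* f a) (⟦⟧-yes (a ℕ.≟ a) refl)) (ℚP.*-identityˡ (f a)))

∑ₙ-pickℕ : (f : ℕ → ℕ) {a N : ℕ} → a < N → ∑ₙ (upTo N) (λ i → ⟦ a ℕ.≟ i ⟧ₙ ℕ.* f i) ≡ f a
∑ₙ-pickℕ f {a} {N} a<N = trans
  (∑ₙ.fold-single (λ i → ⟦ a ℕ.≟ i ⟧ₙ ℕ.* f i) (Unique.upTo⁺ N) (∈P.∈-upTo⁺ a<N)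
    (λ {i} _ ne → cong (ℕ._* f i) (⟦⟧ₙ-no (a ℕ.≟ i) (ne ∘ sym))))
  (trans (cong (ℕ._* f a) (⟦⟧ₙ-yes (a ℕ.≟ a) refl)) (ℕP.*-identityˡ (f a)))

module OneBox (X : Character n) (r : Vec ℕ n) (y : Fin n) (i : ℕ) (i≢ : lookup r y ≢ i)
  (v : V n) (inv-v : SemiInvariant X r v) where

  r′ : Vec ℕ n
  r′ = r [ y ]≔ i

  r′y : lookup r′ y ≡ i
  r′y = VecP.lookup∘update y r i

  r′z : ∀ {z} → z ≢ y → lookup r′ z ≡ lookup r z
  r′z ne = VecP.lookup∘update′ ne r i

  φ : Mon n → Fin n → ℚ
  φ m x = χ X (tr x y) * v (m ∙ tr x y)

  -- The product `(x y) σ` fixes `y` and preserves `r′`, hence it preserves `r` as well. A term of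
  -- the symmetrizer of `r′` thus depends on σ only through the image of `y`.
  coset : ∀ {σ} → Inj σ → r′ ∙ σ ≡ r′ → ∀ m → χ X σ * v (m ∙ σ) ≡ φ m (lookup σ y)
  coset {σ} p st m = begin
    χ X σ * v (m ∙ σ)                              ≡⟨ cong (λ z → χ X σ * v z) (sym unfold) ⟩
    χ X σ * v (m ∙ t ∙ η)                          ≡⟨ cong (χ X σ *_) (inv-v (∙-inj (tr-inj x y) p) rη (m ∙ t)) ⟩
    χ X σ * (χ X η * v (m ∙ t))                    ≡⟨ cong (λ z → χ X σ * (z * v (m ∙ t))) (χ-∙ X (tr-inj x y) p) ⟩
    χ X σ * (χ X t * χ X σ * v (m ∙ t))            ≡⟨ rearrange (χ X σ) (χ X t) (v (m ∙ t)) ⟩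
    (χ X σ * χ X σ) * (χ X t * v (m ∙ t))          ≡⟨ cong (_* (χ X t * v (m ∙ t))) (χ-sq X σ) ⟩
    1ℚ * (χ X t * v (m ∙ t))                       ≡⟨ ℚP.*-identityˡ (χ X t * v (m ∙ t)) ⟩
    χ X t * v (m ∙ t)                              ∎
    where
    open ≡-Reasoning
    rearrange : ∀ a b c → a * (b * a * c) ≡ (a * a) * (b * c)
    rearrange = Solver.solve-∀ ℚring
    x = lookup σ y
    t = tr x y
    η = t ∙ σ
    unfold : m ∙ t ∙ η ≡ m ∙ σ
    unfold = trans (∙-assoc (m ∙ t) t σ) (cong (_∙ σ) (∙-tr-invol m x y))
    r′x : lookup r′ x ≡ lookup r′ y
    r′x = trans (sym (lookup-∙ r′ σ y)) (≡-lookup st y)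
    r′η : r′ ∙ η ≡ r′
    r′η = trans (∙-assoc r′ t σ) (trans (cong (_∙ σ) (∙-tr r′ x y r′x)) st)
    ηy : lookup η y ≡ y
    ηy = trans (lookup-∙ t σ y) (trans (lookup-tr x y x) (trf-x x y))
    rη : r ∙ η ≡ r
    rη = vec-ext λ z → trans (lookup-∙ r η z) (go z)
      where
      go : ∀ z → lookup r (lookup η z) ≡ lookup r z
      go z with z FinP.≟ y
      ... | yes refl = cong (lookup r) ηy
      ... | no z≢y = trans (sym (r′z (λ e → z≢y (cancel (∙-inj (tr-inj x y) p) (trans e (sym ηy))))))
               (trans (sym (lookup-∙ r′ η z)) (trans (≡-lookup r′η z) (r′z z≢y)))

  hits? : ∀ x σ → Dec (r′ ∙ σ ≡ r′ × lookup σ y ≡ x)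
  hits? x σ = stab? r′ σ ×-dec (lookup σ y FinP.≟ x)

  N : Fin n → ℚ
  N x = ∑ (allPerms n) (λ σ → ⟦ hits? x σ ⟧)

  N-y≢0 : N y ≢ 0ℚ
  N-y≢0 = ∑-⟦⟧≢0 (allPerms n) (hits? y) (∈-allPerms id-inj) (∙-id r′ , lookup-id y)

  -- Left multiplication by `tr x y` matches the σ that send `y` to `x` with those that fix `y`, as
  -- long as `x` lies in the block `i` of `r′`.
  N-x : ∀ x → N x ≡ N y * ⟦ lookup r′ x ℕ.≟ i ⟧
  N-x x with lookup r′ x ℕ.≟ i
  ... | no ne = trans (∑.fold-ε (allPerms n) (λ {σ} _ → ⟦⟧-no (hits? x σ) (λ { (st , refl) →
          ne (trans (sym (lookup-∙ r′ σ y)) (trans (≡-lookup st y) r′y)) }))) (sym (ℚP.*-zeroʳ (N y)))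
  ... | yes e = trans (∑.fold-≗ (allPerms n) (λ σ → ⟦⟧-cong (hits? x σ) (hits? y (t ∙ σ)) (to σ) (from σ)))
          (trans (∑-left (tr-inj x y) (λ σ → ⟦ hits? y σ ⟧)) (sym (ℚP.*-identityʳ (N y))))
    where
    t = tr x y
    r′t : r′ ∙ t ≡ r′
    r′t = ∙-tr r′ x y (trans e (sym r′y))
    r′tσ : ∀ σ → r′ ∙ (t ∙ σ) ≡ r′ ∙ σ
    r′tσ σ = trans (∙-assoc r′ t σ) (cong (_∙ σ) r′t)
    at : ∀ σ → lookup (t ∙ σ) y ≡ trf x y (lookup σ y)
    at σ = trans (lookup-∙ t σ y) (lookup-tr x y (lookup σ y))
    to : ∀ σ → r′ ∙ σ ≡ r′ × lookup σ y ≡ x → r′ ∙ (t ∙ σ) ≡ r′ × lookup (t ∙ σ) y ≡ y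
    to σ (a , b) = trans (r′tσ σ) a , trans (at σ) (trans (cong (trf x y) b) (trf-x x y))
    from : ∀ σ → r′ ∙ (t ∙ σ) ≡ r′ × lookup (t ∙ σ) y ≡ y → r′ ∙ σ ≡ r′ × lookup σ y ≡ x
    from σ (a , b) = trans (sym (r′tσ σ)) a ,
      trans (sym (trf-invol x y (lookup σ y))) (trans (cong (trf x y) (trans (sym (at σ)) b)) (trf-y x y))

  -- After grouping by the image `x` of `y`, the symmetrizer of `r′` is `N y` times a sum over the
  -- enlarged block. There `x = y` gives `v m`, and every other `x` gives one transposition.
  garnir : Zero (Y X r′ v) → ∀ m → v m + ∑ (allFin n) (λ x → ⟦ lookup r x ℕ.≟ i ⟧ * (e X * v (m ∙ tr x y))) ≡ 0ℚ
  garnir h m = trans (sym total) (*≡0⇒ N-y≢0 (begin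
    N y * ∑ (allFin n) (λ x → ⟦ lookup r′ x ℕ.≟ i ⟧ * φ m x)
      ≡⟨ ∑-*ˡ (allFin n) (N y) _ ⟩
    ∑ (allFin n) (λ x → N y * (⟦ lookup r′ x ℕ.≟ i ⟧ * φ m x))
      ≡⟨ ∑.fold-≗ (allFin n) (λ x → trans (sym (ℚP.*-assoc (N y) _ (φ m x))) (cong (_* φ m x) (sym (N-x x)))) ⟩
    ∑ (allFin n) (λ x → N x * φ m x)
      ≡⟨ ∑.fold-≗ (allFin n) (λ x → ∑-*ʳ (allPerms n) (φ m x) _) ⟩
    ∑ (allFin n) (λ x → ∑ (allPerms n) (λ σ → ⟦ hits? x σ ⟧ * φ m x))
      ≡⟨ ∑.fold-swap (allFin n) (allPerms n) _ ⟩
    ∑ (allPerms n) (λ σ → ∑ (allFin n) (λ x → ⟦ hits? x σ ⟧ * φ m x))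
      ≡⟨ ∑.fold-cong (allPerms n) (λ q → step (allPerms-inj q)) ⟩
    Y X r′ v m
      ≡⟨ h m ⟩
    0ℚ ∎))
    where
    open ≡-Reasoning
    step : ∀ {σ} → Inj σ → ∑ (allFin n) (λ x → ⟦ hits? x σ ⟧ * φ m x) ≡ weight X r′ σ * v (m ∙ σ)
    step {σ} p = begin
      ∑ (allFin n) (λ x → ⟦ hits? x σ ⟧ * φ m x)
        ≡⟨ ∑.fold-≗ (allFin n) (λ x → trans (cong (_* φ m x) (⟦⟧-× (stab? r′ σ) (lookup σ y FinP.≟ x))) (ℚP.*-assoc ⟦ stab? r′ σ ⟧ _ _)) ⟩
      ∑ (allFin n) (λ x → ⟦ stab? r′ σ ⟧ * (⟦ lookup σ y FinP.≟ x ⟧ * φ m x))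
        ≡⟨ sym (∑-*ˡ (allFin n) ⟦ stab? r′ σ ⟧ _) ⟩
      ⟦ stab? r′ σ ⟧ * ∑ (allFin n) (λ x → ⟦ lookup σ y FinP.≟ x ⟧ * φ m x)
        ≡⟨ cong (⟦ stab? r′ σ ⟧ *_) (∑-pick (φ m) (lookup σ y)) ⟩
      ⟦ stab? r′ σ ⟧ * φ m (lookup σ y)
        ≡⟨ ⟦⟧-guard (stab? r′ σ) (λ st → sym (coset p st m)) ⟩
      ⟦ stab? r′ σ ⟧ * (χ X σ * v (m ∙ σ))
        ≡⟨ sym (ℚP.*-assoc ⟦ stab? r′ σ ⟧ (χ X σ) (v (m ∙ σ))) ⟩
      weight X r′ σ * v (m ∙ σ) ∎
    φ-y : φ m y ≡ v m
    φ-y = trans (cong (λ t → χ X t * v (m ∙ t)) (tr-same y))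
      (trans (cong₂ (λ a b → a * v b) (χ-id X) (∙-id m)) (ℚP.*-identityˡ (v m)))
    split : ∀ x → ⟦ lookup r′ x ℕ.≟ i ⟧ * φ m x ≡ ⟦ y FinP.≟ x ⟧ * φ m x + ⟦ lookup r x ℕ.≟ i ⟧ * (e X * v (m ∙ tr x y))
    split x with y FinP.≟ x
    ... | yes refl = trans (cong (_* φ m y) (⟦⟧-yes (lookup r′ y ℕ.≟ i) r′y))
          (sym (trans (cong (λ z → 1ℚ * φ m y + z * (e X * v (m ∙ tr y y))) (⟦⟧-no (lookup r y ℕ.≟ i) i≢))
            (trans (cong (1ℚ * φ m y +_) (ℚP.*-zeroˡ (e X * v (m ∙ tr y y)))) (ℚP.+-identityʳ (1ℚ * φ m y)))))
    ... | no y≢x = trans (cong₂ (λ a b → a * (b * v (m ∙ tr x y)))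
            (⟦⟧-cong (lookup r′ x ℕ.≟ i) (lookup r x ℕ.≟ i) (trans (sym (r′z (y≢x ∘ sym)))) (trans (r′z (y≢x ∘ sym))))
            (χ-tr X x y (y≢x ∘ sym)))
          (sym (trans (cong (_+ ⟦ lookup r x ℕ.≟ i ⟧ * (e X * v (m ∙ tr x y))) (ℚP.*-zeroˡ (φ m x))) (ℚP.+-identityˡ _)))
    total : ∑ (allFin n) (λ x → ⟦ lookup r′ x ℕ.≟ i ⟧ * φ m x)
      ≡ v m + ∑ (allFin n) (λ x → ⟦ lookup r x ℕ.≟ i ⟧ * (e X * v (m ∙ tr x y)))
    total = trans (∑.fold-≗ (allFin n) split) (trans (∑.fold-• (allFin n) _ _)
      (cong (_+ ∑ (allFin n) (λ x → ⟦ lookup r x ℕ.≟ i ⟧ * (e X * v (m ∙ tr x y)))) (trans (∑-pick (φ m) y) φ-y)))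

distinct? : (x y : Fin n) → Dec (x ≢ y)
distinct? x y = ¬? (x FinP.≟ y)

-- Ordered pairs are summed, so this is twice the class sum of the transpositions.
classSum : V n → V n
classSum {n} v m = ∑ (allFin n) (λ x → ∑ (allFin n) (λ y → ⟦ distinct? x y ⟧ * v (m ∙ tr x y)))

classSum-conj : {σ : Map n} → Inj σ → (f : V n) (m : Mon n) → classSum f (m ∙ σ) ≡ classSum (σ ▷ f) m
classSum-conj {n} {σ} p f m = begin
  ∑ (allFin n) (λ x → ∑ (allFin n) (λ y → ⟦ distinct? x y ⟧ * f (m ∙ σ ∙ tr x y)))
    ≡⟨ ∑.fold-≗ (allFin n) (λ x → ∑.fold-≗ (allFin n) (λ y → cong₂ _*_
         (⟦⟧-cong (distinct? x y) (distinct? (lookup σ x) (lookup σ y)) (λ ne e → ne (cancel p e)) (λ ne e → ne (cong (lookup σ) e)))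
         (cong f (move x y)))) ⟩
  ∑ (allFin n) (λ x → ∑ (allFin n) (λ y → g (lookup σ x) (lookup σ y)))
    ≡⟨ ∑.fold-≗ (allFin n) (λ x → ∑-relabel p (g (lookup σ x))) ⟩
  ∑ (allFin n) (λ x → ∑ (allFin n) (λ y → g (lookup σ x) y))
    ≡⟨ ∑-relabel p (λ x → ∑ (allFin n) (g x)) ⟩
  ∑ (allFin n) (λ x → ∑ (allFin n) (g x)) ∎
  where
  open ≡-Reasoning
  g : Fin n → Fin n → ℚ
  g x y = ⟦ distinct? x y ⟧ * f (m ∙ tr x y ∙ σ)
  move : ∀ x y → m ∙ σ ∙ tr x y ≡ m ∙ tr (lookup σ x) (lookup σ y) ∙ σ
  move x y = trans (sym (∙-assoc m σ (tr x y))) (trans (cong (m ∙_) (tr-conj p x y)) (∙-assoc m (tr (lookup σ x) (lookup σ y)) σ))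

classSum-Y : (X : Character n) (r : Vec ℕ n) (f : V n) (m : Mon n) → classSum (Y X r f) m ≡ Y X r (classSum f) m
classSum-Y {n} X r f m = begin
  ∑ Fn (λ x → ∑ Fn (λ y → d x y * ∑ Pn (λ σ → w σ * f (m ∙ tr x y ∙ σ))))
    ≡⟨ ∑.fold-≗ Fn (λ x → ∑.fold-≗ Fn (λ y → trans (∑-*ˡ Pn (d x y) _)
         (∑.fold-≗ Pn (λ σ → left-comm (d x y) (w σ) (f (m ∙ tr x y ∙ σ)))))) ⟩
  ∑ Fn (λ x → ∑ Fn (λ y → ∑ Pn (λ σ → w σ * (d x y * f (m ∙ tr x y ∙ σ)))))
    ≡⟨ ∑.fold-≗ Fn (λ x → ∑.fold-swap Fn Pn _) ⟩
  ∑ Fn (λ x → ∑ Pn (λ σ → ∑ Fn (λ y → w σ * (d x y * f (m ∙ tr x y ∙ σ)))))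
    ≡⟨ ∑.fold-swap Fn Pn _ ⟩
  ∑ Pn (λ σ → ∑ Fn (λ x → ∑ Fn (λ y → w σ * (d x y * f (m ∙ tr x y ∙ σ)))))
    ≡⟨ ∑.fold-≗ Pn (λ σ → trans (∑.fold-≗ Fn (λ x → sym (∑-*ˡ Fn (w σ) _))) (sym (∑-*ˡ Fn (w σ) _))) ⟩
  ∑ Pn (λ σ → w σ * classSum (σ ▷ f) m)
    ≡⟨ ∑.fold-cong Pn (λ {σ} q → cong (w σ *_) (sym (classSum-conj (allPerms-inj q) f m))) ⟩
  ∑ Pn (λ σ → w σ * classSum f (m ∙ σ)) ∎
  where
  open ≡-Reasoning
  Fn = allFin n
  Pn = allPerms n
  d : Fin n → Fin n → ℚ
  d x y = ⟦ distinct? x y ⟧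
  w = weight X r
  left-comm : ∀ a b c → a * (b * c) ≡ b * (a * c)
  left-comm = Solver.solve-∀ ℚring

-- Eigenvalues of the class sum and completeness

size : Vec ℕ n → ℕ → ℕ
size {n} r i = ∑ₙ (allFin n) (λ x → ⟦ lookup r x ℕ.≟ i ⟧ₙ)

-- As many labels as points suffice for every set partition, and the bound lets sums over all labels
-- run over `upTo n`.
Bounded : Vec ℕ n → Set
Bounded {n} r = ∀ x → lookup r x < n

internal? : (r : Vec ℕ n) (i : ℕ) (x y : Fin n) → Dec (lookup r x ≡ i × lookup r y ≡ i × x ≢ y)
internal? r i x y = (lookup r x ℕ.≟ i) ×-dec (lookup r y ℕ.≟ i) ×-dec distinct? x y

internal : Vec ℕ n → ℕ → ℕ
internal {n} r i = ∑ₙ (allFin n) (λ x → ∑ₙ (allFin n) (λ y → ⟦ internal? r i x y ⟧ₙ))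

-- These sum to Σ s_i (s_i - 1) and Σ_{i≠j} min(s_i, s_j). The first is kept as a number of ordered
-- pairs, which avoids truncated subtraction and matches `meetings`.
within between : Vec ℕ n → ℕ → ℕ → ℕ
within r i j with i ℕ.≟ j
... | yes _ = internal r i
... | no _ = 0
between r i j with i ℕ.≟ j
... | yes _ = 0
... | no _ = size r i ℕ.⊓ size r j

totalWithin totalBetween : Vec ℕ n → ℕ
totalWithin {n} r = ∑ₙ (upTo n) (λ i → ∑ₙ (upTo n) (within r i))
totalBetween {n} r = ∑ₙ (upTo n) (λ i → ∑ₙ (upTo n) (between r i))

-- The number of ordered pairs in a common block; it grows when an element moves to a block that is at least as large.
spread : Vec ℕ n → ℕ
spread {n} r = ∑ₙ (allFin n) (λ x → ∑ₙ (allFin n) (λ y → ⟦ lookup r x ℕ.≟ lookup r y ⟧ₙ))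

spread-≤ : (r : Vec ℕ n) → spread r ≤ ∑ₙ (allFin n) (λ _ → ∑ₙ (allFin n) (λ _ → 1))
spread-≤ {n} r = ∑ₙ-mono (allFin n) (λ {x} _ → ∑ₙ-mono (allFin n) (λ {y} _ → ⟦⟧ₙ≤1 (lookup r x ℕ.≟ lookup r y)))

spread-∙ : {π : Map n} → Inj π → (r : Vec ℕ n) → spread (r ∙ π) ≡ spread r
spread-∙ {n} {π} p r = trans
  (∑ₙ.fold-≗ (allFin n) (λ x → trans (∑ₙ.fold-≗ (allFin n) (λ y →
    cong₂ (λ a b → ⟦ a ℕ.≟ b ⟧ₙ) (lookup-∙ r π x) (lookup-∙ r π y))) (∑ₙ-relabel p (λ y → ⟦ lookup r (lookup π x) ℕ.≟ lookup r y ⟧ₙ))))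
  (∑ₙ-relabel p (λ x → ∑ₙ (allFin n) (λ y → ⟦ lookup r x ℕ.≟ lookup r y ⟧ₙ)))

bounded-∙ : {r : Vec ℕ n} → Bounded r → (π : Map n) → Bounded (r ∙ π)
bounded-∙ {n} {r} b π x = subst (_< n) (sym (lookup-∙ r π x)) (b (lookup π x))

∑ₙ-pick : (f : Fin n → ℕ) (a : Fin n) → ∑ₙ (allFin n) (λ x → ⟦ x FinP.≟ a ⟧ₙ ℕ.* f x) ≡ f a
∑ₙ-pick {n} f a = trans
  (∑ₙ.fold-single (λ x → ⟦ x FinP.≟ a ⟧ₙ ℕ.* f x) (Unique.allFin⁺ n) (∈P.∈-allFin a)
    (λ {x} _ ne → cong (ℕ._* f x) (⟦⟧ₙ-no (x FinP.≟ a) ne)))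
  (trans (cong (ℕ._* f a) (⟦⟧ₙ-yes (a FinP.≟ a) refl)) (ℕP.*-identityˡ (f a)))

∑ₙ² : (n : ℕ) → (Fin n → Fin n → ℕ) → ℕ
∑ₙ² n f = ∑ₙ (allFin n) (λ x → ∑ₙ (allFin n) (f x))

∑ₙ²-+ : (f g : Fin n → Fin n → ℕ) → ∑ₙ² n (λ x y → f x y ℕ.+ g x y) ≡ ∑ₙ² n f ℕ.+ ∑ₙ² n g
∑ₙ²-+ {n} f g = trans (∑ₙ.fold-≗ (allFin n) (λ x → ∑ₙ.fold-• (allFin n) (f x) (g x)))
  (∑ₙ.fold-• (allFin n) (λ x → ∑ₙ (allFin n) (f x)) (λ x → ∑ₙ (allFin n) (g x)))

∑ₙ²-cross : (a : Fin n) (g : Fin n → ℕ) →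
  ∑ₙ² n (λ x z → ⟦ x FinP.≟ a ⟧ₙ ℕ.* g z ℕ.+ ⟦ z FinP.≟ a ⟧ₙ ℕ.* g x) ≡ ∑ₙ (allFin n) g ℕ.+ ∑ₙ (allFin n) g
∑ₙ²-cross {n} a g = trans (∑ₙ²-+ (λ x z → ⟦ x FinP.≟ a ⟧ₙ ℕ.* g z) (λ x z → ⟦ z FinP.≟ a ⟧ₙ ℕ.* g x))
  (cong₂ ℕ._+_
    (trans (∑ₙ.fold-≗ (allFin n) (λ x → sym (∑ₙ-*ˡ (allFin n) ⟦ x FinP.≟ a ⟧ₙ g))) (∑ₙ-pick (λ _ → ∑ₙ (allFin n) g) a))
    (∑ₙ.fold-≗ (allFin n) (λ x → ∑ₙ-pick (λ _ → g x) a)))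

-- With block sizes s, the sum of the squares grows by 2 (s_i - s_j) + 2. The last 2 comes from the
-- pair (y, y) and is carried by `both`.
spread-move : (r : Vec ℕ n) (y : Fin n) {i : ℕ} → lookup r y ≢ i → size r (lookup r y) ≤ size r i →
  spread r < spread (r [ y ]≔ i)
spread-move {n} r y {i} ne s = ℕP.+-cancelʳ-< (sj ℕ.+ sj) (spread r) (spread r′) (begin-strict
  spread r ℕ.+ (sj ℕ.+ sj)                  ≤⟨ ℕP.+-monoʳ-≤ (spread r) (ℕP.+-mono-≤ s s) ⟩
  spread r ℕ.+ (si ℕ.+ si)                  <⟨ ℕP.m<m+n _ {∑ₙ² n both} (ℕP.<-≤-trans (s≤s z≤n) both≥1) ⟩
  spread r ℕ.+ (si ℕ.+ si) ℕ.+ ∑ₙ² n both   ≡⟨ sym identity ⟩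
  spread r′ ℕ.+ (sj ℕ.+ sj)                 ∎)
  where
  open ℕP.≤-Reasoning
  r′ = r [ y ]≔ i
  j = lookup r y
  si = size r i
  sj = size r j
  both : Fin n → Fin n → ℕ
  both x z = 2 ℕ.* (⟦ x FinP.≟ y ⟧ₙ ℕ.* ⟦ z FinP.≟ y ⟧ₙ)
  in-i in-j : Fin n → ℕ
  in-i z = ⟦ lookup r z ℕ.≟ i ⟧ₙ
  in-j z = ⟦ lookup r z ℕ.≟ j ⟧ₙ
  r′y : lookup r′ y ≡ i
  r′y = VecP.lookup∘update y r i
  r′z : ∀ {z} → z ≢ y → lookup r′ z ≡ lookup r z
  r′z ne = VecP.lookup∘update′ ne r i
  both≥1 : 1 ≤ ∑ₙ² n both
  both≥1 = ℕP.≤-trans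
    (ℕP.≤-trans (ℕP.≤-trans (s≤s z≤n) (ℕP.≤-reflexive (sym (cong (λ a → 2 ℕ.* (a ℕ.* a)) (⟦⟧ₙ-yes (y FinP.≟ y) refl)))))
      (∑ₙ-term (allFin n) (both y) (∈P.∈-allFin y)))
    (∑ₙ-term (allFin n) (λ x → ∑ₙ (allFin n) (both x)) (∈P.∈-allFin y))
  pointwise : ∀ x z →
    ⟦ lookup r′ x ℕ.≟ lookup r′ z ⟧ₙ ℕ.+ (⟦ x FinP.≟ y ⟧ₙ ℕ.* in-j z ℕ.+ ⟦ z FinP.≟ y ⟧ₙ ℕ.* in-j x)
    ≡ ⟦ lookup r x ℕ.≟ lookup r z ⟧ₙ ℕ.+ (⟦ x FinP.≟ y ⟧ₙ ℕ.* in-i z ℕ.+ ⟦ z FinP.≟ y ⟧ₙ ℕ.* in-i x) ℕ.+ both x z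
  pointwise x z with x FinP.≟ y | z FinP.≟ y
  ... | yes refl | yes refl
    rewrite ⟦⟧ₙ-yes (lookup r′ y ℕ.≟ lookup r′ y) refl | ⟦⟧ₙ-yes (lookup r y ℕ.≟ lookup r y) refl
          | ⟦⟧ₙ-no (lookup r y ℕ.≟ i) ne = refl
  ... | yes refl | no z≢y
    rewrite ⟦⟧ₙ-cong (lookup r′ y ℕ.≟ lookup r′ z) (lookup r z ℕ.≟ i)
              (λ e → trans (sym (r′z z≢y)) (trans (sym e) r′y)) (λ e → trans r′y (trans (sym e) (sym (r′z z≢y))))
          | ⟦⟧ₙ-cong (lookup r y ℕ.≟ lookup r z) (lookup r z ℕ.≟ lookup r y) sym sym
    = shuffle (in-i z) (in-j z)
    where
    shuffle : ∀ a b → a ℕ.+ (1 ℕ.* b ℕ.+ 0) ≡ b ℕ.+ (1 ℕ.* a ℕ.+ 0) ℕ.+ 0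
    shuffle = ℕSolver.solve-∀
  ... | no x≢y | yes refl
    rewrite ⟦⟧ₙ-cong (lookup r′ x ℕ.≟ lookup r′ y) (lookup r x ℕ.≟ i)
              (λ e → trans (sym (r′z x≢y)) (trans e r′y)) (λ e → trans (r′z x≢y) (trans e (sym r′y)))
    = shuffle (in-i x) (in-j x)
    where
    shuffle : ∀ a b → a ℕ.+ (1 ℕ.* b) ≡ b ℕ.+ (1 ℕ.* a) ℕ.+ 0
    shuffle = ℕSolver.solve-∀
  ... | no x≢y | no z≢y rewrite r′z x≢y | r′z z≢y = sym (ℕP.+-identityʳ _)
  together : Vec ℕ n → Fin n → Fin n → ℕ
  together u x z = ⟦ lookup u x ℕ.≟ lookup u z ⟧ₙ
  cross : (Fin n → ℕ) → Fin n → Fin n → ℕ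
  cross g x z = ⟦ x FinP.≟ y ⟧ₙ ℕ.* g z ℕ.+ ⟦ z FinP.≟ y ⟧ₙ ℕ.* g x
  identity : spread r′ ℕ.+ (sj ℕ.+ sj) ≡ spread r ℕ.+ (si ℕ.+ si) ℕ.+ ∑ₙ² n both
  identity = trans (cong (spread r′ ℕ.+_) (sym (∑ₙ²-cross y in-j)))
    (trans (sym (∑ₙ²-+ (together r′) (cross in-j)))
      (trans (∑ₙ.fold-≗ (allFin n) (λ x → ∑ₙ.fold-≗ (allFin n) (pointwise x)))
        (trans (∑ₙ²-+ (λ x z → together r x z ℕ.+ cross in-i x z) both) (cong (ℕ._+ ∑ₙ² n both)
          (trans (∑ₙ²-+ (together r) (cross in-i)) (cong (spread r ℕ.+_) (∑ₙ²-cross y in-i)))))))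

-- Induction from large measure to small. The fuel bounds how far the measure can still grow.
descend : {R : A → Set} (measure : A → ℕ) (K : ℕ) → (∀ a → measure a ≤ K) →
  (∀ a → (∀ b → measure a < measure b → R b) → R a) → ∀ a → R a
descend {A} {R} measure K bound step a = go (suc K) a (ℕP.m≤n+m (suc K) (measure a))
  where
  go : ∀ fuel a → K < measure a ℕ.+ fuel → R a
  go zero a l = ⊥-elim (ℕP.<⇒≱ (subst (K <_) (ℕP.+-identityʳ _) l) (bound a))
  go (suc fuel) a l = step a (λ b a<b → go fuel b (ℕP.<-≤-trans (subst (K <_) (ℕP.+-suc (measure a) fuel) l) (ℕP.+-monoˡ-≤ fuel a<b)))

*-ι-∑ : (xs : List A) (f : A → ℕ) (a : ℚ) → ∑ xs (λ x → ι (f x) * a) ≡ ι (∑ₙ xs f) * a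
*-ι-∑ xs f a = trans (sym (∑-*ʳ xs a (ι ∘ f))) (cong (_* a) (sym (ι-∑ xs f)))

module Eigen (X : Character n) (r : Vec ℕ n) (bounded : Bounded r) (v : V n) (inv-v : SemiInvariant X r v)
  (vanish : ∀ r′ → Bounded r′ → spread r < spread r′ → Zero (Y X r′ v)) (m : Mon n) where

  open ≡-Reasoning

  Fn : List (Fin n)
  Fn = allFin n

  term : Fin n → Fin n → ℚ
  term x y = ⟦ distinct? x y ⟧ * v (m ∙ tr x y)

  block : ℕ → ℕ → ℚ
  block i j = ∑ Fn (λ x → ∑ Fn (λ y → ⟦ lookup r x ℕ.≟ i ⟧ * (⟦ lookup r y ℕ.≟ j ⟧ * term x y)))

  block-sym : ∀ i j → block i j ≡ block j i
  block-sym i j = trans (∑.fold-swap Fn Fn _) (∑.fold-≗ Fn (λ y → ∑.fold-≗ Fn (λ x →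
    trans (left-comm ⟦ lookup r x ℕ.≟ i ⟧ ⟦ lookup r y ℕ.≟ j ⟧ (term x y))
      (cong (λ z → ⟦ lookup r y ℕ.≟ j ⟧ * (⟦ lookup r x ℕ.≟ i ⟧ * z))
        (cong₂ (λ a t → a * v (m ∙ t)) (⟦⟧-cong (distinct? x y) (distinct? y x) (_∘ sym) (_∘ sym)) (tr-comm x y))))))
    where
    left-comm : ∀ a b c → a * (b * c) ≡ b * (a * c)
    left-comm = Solver.solve-∀ ℚring

  block-diagonal : ∀ i → block i i ≡ ι (internal r i) * (e X * v m)
  block-diagonal i = trans
    (∑.fold-≗ Fn (λ x → trans (∑.fold-≗ Fn (pointwise x)) (*-ι-∑ Fn (λ y → ⟦ internal? r i x y ⟧ₙ) (e X * v m))))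
    (*-ι-∑ Fn (λ x → ∑ₙ Fn (λ y → ⟦ internal? r i x y ⟧ₙ)) (e X * v m))
    where
    assoc₃ : ∀ a b c d → a * (b * (c * d)) ≡ (a * (b * c)) * d
    assoc₃ = Solver.solve-∀ ℚring
    pointwise : ∀ x y → ⟦ lookup r x ℕ.≟ i ⟧ * (⟦ lookup r y ℕ.≟ i ⟧ * term x y) ≡ ι ⟦ internal? r i x y ⟧ₙ * (e X * v m)
    pointwise x y = begin
      ⟦ lookup r x ℕ.≟ i ⟧ * (⟦ lookup r y ℕ.≟ i ⟧ * (⟦ distinct? x y ⟧ * v (m ∙ tr x y)))
        ≡⟨ assoc₃ ⟦ lookup r x ℕ.≟ i ⟧ ⟦ lookup r y ℕ.≟ i ⟧ ⟦ distinct? x y ⟧ (v (m ∙ tr x y)) ⟩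
      ⟦ lookup r x ℕ.≟ i ⟧ * (⟦ lookup r y ℕ.≟ i ⟧ * ⟦ distinct? x y ⟧) * v (m ∙ tr x y)
        ≡⟨ cong (_* v (m ∙ tr x y)) (trans (cong (⟦ lookup r x ℕ.≟ i ⟧ *_) (sym (⟦⟧-× (lookup r y ℕ.≟ i) (distinct? x y))))
             (sym (⟦⟧-× (lookup r x ℕ.≟ i) _))) ⟩
      ⟦ internal? r i x y ⟧ * v (m ∙ tr x y)
        ≡⟨ ⟦⟧-guard (internal? r i x y) (λ (a , b , c) →
             trans (inv-v (tr-inj x y) (∙-tr r x y (trans a (sym b))) m) (cong (_* v m) (χ-tr X x y c))) ⟩
      ⟦ internal? r i x y ⟧ * (e X * v m)
        ≡⟨ cong (_* (e X * v m)) (sym (ι-⟦⟧ (internal? r i x y))) ⟩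
      ι ⟦ internal? r i x y ⟧ₙ * (e X * v m) ∎

  -- Every `y` of block `j` may be moved into the block `i`, which is at least as large. The
  -- resulting one-box relation evaluates the sum over `x` in block `i`, so only the number of such
  -- `y` remains; this is where the minimum of the sizes comes from.
  block-half : ∀ {i j} → i < n → i ≢ j → size r j ≤ size r i → block i j ≡ ι (size r j) * - (e X * v m)
  block-half {i} {j} i<n i≢j le = begin
    block i j
      ≡⟨ ∑.fold-swap Fn Fn _ ⟩
    ∑ Fn (λ y → ∑ Fn (λ x → ⟦ lookup r x ℕ.≟ i ⟧ * (⟦ lookup r y ℕ.≟ j ⟧ * term x y)))
      ≡⟨ ∑.fold-≗ Fn column ⟩
    ∑ Fn (λ y → ι ⟦ lookup r y ℕ.≟ j ⟧ₙ * - (e X * v m))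
      ≡⟨ *-ι-∑ Fn (λ y → ⟦ lookup r y ℕ.≟ j ⟧ₙ) _ ⟩
    ι (size r j) * - (e X * v m) ∎
    where
    swap₃ : ∀ a b c → a * (b * c) ≡ b * (a * c)
    swap₃ = Solver.solve-∀ ℚring
    solve : ∀ E a S → E * E ≡ 1ℚ → a + E * S ≡ 0ℚ → S ≡ - (E * a)
    solve E a S sq h = begin
      S                         ≡⟨ trans (sym (ℚP.*-identityˡ S)) (cong (_* S) (sym sq)) ⟩
      E * E * S                 ≡⟨ expand E a S ⟩
      E * (a + E * S) + - (E * a)  ≡⟨ cong (λ z → E * z + - (E * a)) h ⟩
      E * 0ℚ + - (E * a)        ≡⟨ trans (cong (_+ - (E * a)) (ℚP.*-zeroʳ E)) (ℚP.+-identityˡ _) ⟩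
      - (E * a)                 ∎
      where
      expand : ∀ E a S → E * E * S ≡ E * (a + E * S) + - (E * a)
      expand = Solver.solve-∀ ℚring
    column : ∀ y → ∑ Fn (λ x → ⟦ lookup r x ℕ.≟ i ⟧ * (⟦ lookup r y ℕ.≟ j ⟧ * term x y)) ≡ ι ⟦ lookup r y ℕ.≟ j ⟧ₙ * - (e X * v m)
    column y = begin
      ∑ Fn (λ x → ⟦ lookup r x ℕ.≟ i ⟧ * (⟦ lookup r y ℕ.≟ j ⟧ * term x y))
        ≡⟨ ∑.fold-≗ Fn (λ x → swap₃ ⟦ lookup r x ℕ.≟ i ⟧ ⟦ lookup r y ℕ.≟ j ⟧ (term x y)) ⟩
      ∑ Fn (λ x → ⟦ lookup r y ℕ.≟ j ⟧ * (⟦ lookup r x ℕ.≟ i ⟧ * term x y))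
        ≡⟨ sym (∑-*ˡ Fn ⟦ lookup r y ℕ.≟ j ⟧ _) ⟩
      ⟦ lookup r y ℕ.≟ j ⟧ * ∑ Fn (λ x → ⟦ lookup r x ℕ.≟ i ⟧ * term x y)
        ≡⟨ ⟦⟧-guard (lookup r y ℕ.≟ j) (λ { refl → relation i≢j le }) ⟩
      ⟦ lookup r y ℕ.≟ j ⟧ * - (e X * v m)
        ≡⟨ cong (_* - (e X * v m)) (sym (ι-⟦⟧ (lookup r y ℕ.≟ j))) ⟩
      ι ⟦ lookup r y ℕ.≟ j ⟧ₙ * - (e X * v m) ∎
      where
      relation : i ≢ lookup r y → size r (lookup r y) ≤ size r i →
        ∑ Fn (λ x → ⟦ lookup r x ℕ.≟ i ⟧ * term x y) ≡ - (e X * v m)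
      relation ne le = solve (e X) (v m) _ (e-sq X) (trans (cong (v m +_) (begin
        e X * ∑ Fn (λ x → ⟦ lookup r x ℕ.≟ i ⟧ * term x y)
          ≡⟨ ∑-*ˡ Fn (e X) _ ⟩
        ∑ Fn (λ x → e X * (⟦ lookup r x ℕ.≟ i ⟧ * term x y))
          ≡⟨ ∑.fold-≗ Fn (λ x → trans (swap₃ (e X) ⟦ lookup r x ℕ.≟ i ⟧ (term x y))
               (⟦⟧-guard (lookup r x ℕ.≟ i) (λ rx → cong (e X *_)
                 (trans (cong (_* v (m ∙ tr x y)) (⟦⟧-yes (distinct? x y) (λ { refl → ne (sym rx) }))) (ℚP.*-identityˡ _))))) ⟩
        ∑ Fn (λ x → ⟦ lookup r x ℕ.≟ i ⟧ * (e X * v (m ∙ tr x y))) ∎))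
        (OneBox.garnir X r y i (ne ∘ sym) v inv-v (vanish (r [ y ]≔ i) bounded′ (spread-move r y (ne ∘ sym) le)) m))
        where
        bounded′ : Bounded (r [ y ]≔ i)
        bounded′ x with x FinP.≟ y
        ... | yes refl = subst (_< n) (sym (VecP.lookup∘update y r i)) i<n
        ... | no x≢y = subst (_< n) (sym (VecP.lookup∘update′ x≢y r i)) (bounded x)

  a : ℚ
  a = e X * v m

  block-value : ∀ {i j} → i < n → j < n → block i j ≡ ι (within r i j) * a + ι (between r i j) * - a
  block-value {i} {j} i<n j<n with i ℕ.≟ j
  ... | yes refl = trans (block-diagonal i) (sym (trans (cong (ι (internal r i) * a +_) (ℚP.*-zeroˡ (- a))) (ℚP.+-identityʳ _)))
  ... | no i≢j = trans half (sym (trans (cong (_+ ι (size r i ℕ.⊓ size r j) * - a) (ℚP.*-zeroˡ a)) (ℚP.+-identityˡ _)))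
    where
    half : block i j ≡ ι (size r i ℕ.⊓ size r j) * - a
    half with ℕP.≤-total (size r j) (size r i)
    ... | inj₁ le = trans (block-half i<n i≢j le) (cong (λ z → ι z * - a) (sym (ℕP.m≥n⇒m⊓n≡n le)))
    ... | inj₂ le = trans (block-sym i j) (trans (block-half j<n (i≢j ∘ sym) le) (cong (λ z → ι z * - a) (sym (ℕP.m≤n⇒m⊓n≡m le))))

  -- The pairs are sorted by the labels of their two points; boundedness makes every pair occur in
  -- exactly one block (i, j).
  eigen : classSum v m ≡ ι (totalWithin r) * a + ι (totalBetween r) * - a
  eigen = begin
    ∑ Fn (λ x → ∑ Fn (λ y → term x y))
      ≡⟨ ∑.fold-≗ Fn (λ x → ∑.fold-≗ Fn (λ y → sym (trans
           (∑-pickℕ (λ i → ∑ U (λ j → ⟦ lookup r y ℕ.≟ j ⟧ * term x y)) (bounded x)) (∑-pickℕ (λ _ → term x y) (bounded y))))) ⟩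
    ∑ Fn (λ x → ∑ Fn (λ y → ∑ U (λ i → ⟦ lookup r x ℕ.≟ i ⟧ * ∑ U (λ j → ⟦ lookup r y ℕ.≟ j ⟧ * term x y))))
      ≡⟨ ∑.fold-≗ Fn (λ x → ∑.fold-≗ Fn (λ y → ∑.fold-≗ U (λ i → ∑-*ˡ U ⟦ lookup r x ℕ.≟ i ⟧ _))) ⟩
    ∑ Fn (λ x → ∑ Fn (λ y → ∑ U (λ i → ∑ U (λ j → g i j x y))))
      ≡⟨ ∑.fold-≗ Fn (λ x → ∑.fold-swap Fn U _) ⟩
    ∑ Fn (λ x → ∑ U (λ i → ∑ Fn (λ y → ∑ U (λ j → g i j x y))))
      ≡⟨ ∑.fold-swap Fn U _ ⟩
    ∑ U (λ i → ∑ Fn (λ x → ∑ Fn (λ y → ∑ U (λ j → g i j x y))))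
      ≡⟨ ∑.fold-≗ U (λ i → ∑.fold-≗ Fn (λ x → ∑.fold-swap Fn U _)) ⟩
    ∑ U (λ i → ∑ Fn (λ x → ∑ U (λ j → ∑ Fn (λ y → g i j x y))))
      ≡⟨ ∑.fold-≗ U (λ i → ∑.fold-swap Fn U _) ⟩
    ∑ U (λ i → ∑ U (λ j → block i j))
      ≡⟨ ∑.fold-cong U (λ p → ∑.fold-cong U (λ q → block-value (∈P.∈-upTo⁻ p) (∈P.∈-upTo⁻ q))) ⟩
    ∑ U (λ i → ∑ U (λ j → ι (within r i j) * a + ι (between r i j) * - a))
      ≡⟨ ∑.fold-≗ U (λ i → trans (∑.fold-• U _ _) (cong₂ _+_ (*-ι-∑ U (within r i) a) (*-ι-∑ U (between r i) (- a)))) ⟩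
    ∑ U (λ i → ι (∑ₙ U (within r i)) * a + ι (∑ₙ U (between r i)) * - a)
      ≡⟨ trans (∑.fold-• U _ _) (cong₂ _+_ (*-ι-∑ U (λ i → ∑ₙ U (within r i)) a) (*-ι-∑ U (λ i → ∑ₙ U (between r i)) (- a))) ⟩
    ι (totalWithin r) * a + ι (totalBetween r) * - a ∎
    where
    U = upTo n
    g : ℕ → ℕ → Fin n → Fin n → ℚ
    g i j x y = ⟦ lookup r x ℕ.≟ i ⟧ * (⟦ lookup r y ℕ.≟ j ⟧ * term x y)

-- Counting the meetings of two set partitions

Separated : Vec ℕ n → Vec ℕ n → Set
Separated r k = ∀ {x y} → lookup r x ≡ lookup r y → lookup k x ≡ lookup k y → x ≡ y

-- A block of `k` that meets a block of `r` also meets every block of `r` at least as large. Once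
-- the blocks are sorted by size, this is the shape condition of a Ferrers diagram.
Nested : Vec ℕ n → Vec ℕ n → Set
Nested r k = ∀ y z → size r (lookup r y) ≤ size r (lookup r z) → ∃ λ x → lookup r x ≡ lookup r z × lookup k x ≡ lookup k y

∑ₙ-exists : (xs : List A) {R : A → Set} (R? : ∀ x → Dec (R x)) → 1 ≤ ∑ₙ xs (λ x → ⟦ R? x ⟧ₙ) → ∃ λ x → x ∈ xs × R x
∑ₙ-exists (x ∷ xs) R? l with R? x
... | yes r = x , here refl , r
... | no _ with ∑ₙ-exists xs R? l
... | y , p , r = y , there p , r

∑ₙ²-split : (r : Vec ℕ n) → Bounded r → (D : Fin n → Fin n → ℕ) →
  ∑ₙ² n D ≡ ∑ₙ (upTo n) (λ i → ∑ₙ (upTo n) (λ j → ∑ₙ² n (λ x y → ⟦ lookup r x ℕ.≟ i ⟧ₙ ℕ.* (⟦ lookup r y ℕ.≟ j ⟧ₙ ℕ.* D x y))))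
∑ₙ²-split {n} r bounded D = begin
  ∑ₙ Fn (λ x → ∑ₙ Fn (λ y → D x y))
    ≡⟨ ∑ₙ.fold-≗ Fn (λ x → ∑ₙ.fold-≗ Fn (λ y → sym (trans
         (∑ₙ-pickℕ (λ i → ∑ₙ U (λ j → ⟦ lookup r y ℕ.≟ j ⟧ₙ ℕ.* D x y)) (bounded x)) (∑ₙ-pickℕ (λ _ → D x y) (bounded y))))) ⟩
  ∑ₙ Fn (λ x → ∑ₙ Fn (λ y → ∑ₙ U (λ i → ⟦ lookup r x ℕ.≟ i ⟧ₙ ℕ.* ∑ₙ U (λ j → ⟦ lookup r y ℕ.≟ j ⟧ₙ ℕ.* D x y))))
    ≡⟨ ∑ₙ.fold-≗ Fn (λ x → ∑ₙ.fold-≗ Fn (λ y → ∑ₙ.fold-≗ U (λ i → ∑ₙ-*ˡ U ⟦ lookup r x ℕ.≟ i ⟧ₙ _))) ⟩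
  ∑ₙ Fn (λ x → ∑ₙ Fn (λ y → ∑ₙ U (λ i → ∑ₙ U (λ j → g i j x y))))
    ≡⟨ ∑ₙ.fold-≗ Fn (λ x → ∑ₙ.fold-swap Fn U _) ⟩
  ∑ₙ Fn (λ x → ∑ₙ U (λ i → ∑ₙ Fn (λ y → ∑ₙ U (λ j → g i j x y))))
    ≡⟨ ∑ₙ.fold-swap Fn U _ ⟩
  ∑ₙ U (λ i → ∑ₙ Fn (λ x → ∑ₙ Fn (λ y → ∑ₙ U (λ j → g i j x y))))
    ≡⟨ ∑ₙ.fold-≗ U (λ i → ∑ₙ.fold-≗ Fn (λ x → ∑ₙ.fold-swap Fn U _)) ⟩
  ∑ₙ U (λ i → ∑ₙ Fn (λ x → ∑ₙ U (λ j → ∑ₙ Fn (λ y → g i j x y))))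
    ≡⟨ ∑ₙ.fold-≗ U (λ i → ∑ₙ.fold-swap Fn U _) ⟩
  ∑ₙ U (λ i → ∑ₙ U (λ j → ∑ₙ² n (g i j))) ∎
  where
  open ≡-Reasoning
  Fn = allFin n
  U = upTo n
  g : ℕ → ℕ → Fin n → Fin n → ℕ
  g i j x y = ⟦ lookup r x ℕ.≟ i ⟧ₙ ℕ.* (⟦ lookup r y ℕ.≟ j ⟧ₙ ℕ.* D x y)

∑ₙ²-zero : (f : Fin n → Fin n → ℕ) → (∀ x y → f x y ≡ 0) → ∑ₙ² n f ≡ 0
∑ₙ²-zero {n} f h = ∑ₙ.fold-ε (allFin n) (λ {x} _ → ∑ₙ.fold-ε (allFin n) (λ {y} _ → h x y))

meet? : (k : Vec ℕ n) (x y : Fin n) → Dec (lookup k x ≡ lookup k y × x ≢ y)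
meet? k x y = (lookup k x ℕ.≟ lookup k y) ×-dec distinct? x y

meetings : Vec ℕ n → ℕ
meetings {n} k = ∑ₙ² n (λ x y → ⟦ meet? k x y ⟧ₙ)

meetings-within : (k : Vec ℕ n) → Bounded k → meetings k ≡ totalWithin k
meetings-within {n} k bounded = trans (∑ₙ²-split k bounded (λ x y → ⟦ meet? k x y ⟧ₙ))
  (∑ₙ.fold-≗ (upTo n) (λ i → ∑ₙ.fold-≗ (upTo n) (λ j → value i j)))
  where
  value : ∀ i j → ∑ₙ² n (λ x y → ⟦ lookup k x ℕ.≟ i ⟧ₙ ℕ.* (⟦ lookup k y ℕ.≟ j ⟧ₙ ℕ.* ⟦ meet? k x y ⟧ₙ)) ≡ within k i j
  value i j with i ℕ.≟ j
  ... | yes refl = ∑ₙ.fold-≗ (allFin n) (λ x → ∑ₙ.fold-≗ (allFin n) (λ y → trans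
          (cong (⟦ lookup k x ℕ.≟ i ⟧ₙ ℕ.*_) (sym (⟦⟧ₙ-×ˡ (lookup k y ℕ.≟ i) (meet? k x y))))
          (trans (sym (⟦⟧ₙ-×ˡ (lookup k x ℕ.≟ i) _))
            (⟦⟧ₙ-cong ((lookup k x ℕ.≟ i) ×-dec (lookup k y ℕ.≟ i) ×-dec meet? k x y) (internal? k i x y)
              (λ (a , b , _ , c) → a , b , c) (λ (a , b , c) → a , b , trans a (sym b) , c)))))
  ... | no i≢j = ∑ₙ²-zero _ (λ x y → trans
          (cong (⟦ lookup k x ℕ.≟ i ⟧ₙ ℕ.*_) (sym (⟦⟧ₙ-×ˡ (lookup k y ℕ.≟ j) (meet? k x y))))
          (trans (sym (⟦⟧ₙ-×ˡ (lookup k x ℕ.≟ i) _))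
            (⟦⟧ₙ-no ((lookup k x ℕ.≟ i) ×-dec (lookup k y ℕ.≟ j) ×-dec meet? k x y) (λ (a , b , c , _) → i≢j (trans (sym a) (trans c b))))))

module Meetings (r k : Vec ℕ n) (bounded : Bounded r) (separated : Separated r k) where

  Fn : List (Fin n)
  Fn = allFin n

  cell : ℕ → ℕ → Fin n → Fin n → ℕ
  cell i j x y = ⟦ lookup r x ℕ.≟ i ⟧ₙ ℕ.* (⟦ lookup r y ℕ.≟ j ⟧ₙ ℕ.* ⟦ meet? k x y ⟧ₙ)

  partner? : ∀ i y x → Dec (lookup r x ≡ i × lookup k x ≡ lookup k y × x ≢ y)
  partner? i y x = (lookup r x ℕ.≟ i) ×-dec meet? k x y

  partners : ℕ → Fin n → ℕ
  partners i y = ∑ₙ Fn (λ x → ⟦ partner? i y x ⟧ₙ)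

  partners≤1 : ∀ i y → partners i y ≤ 1
  partners≤1 i y = ∑ₙ-atMostOne (partner? i y) (Unique.allFin⁺ n)
    (λ (a , b , _) (a′ , b′ , _) → separated (trans a (sym a′)) (trans b (sym b′)))

  by-column : ∀ i j → ∑ₙ² n (cell i j) ≡ ∑ₙ Fn (λ y → ⟦ lookup r y ℕ.≟ j ⟧ₙ ℕ.* partners i y)
  by-column i j = trans (∑ₙ.fold-swap Fn Fn (cell i j)) (∑ₙ.fold-≗ Fn (λ y → trans
    (∑ₙ.fold-≗ Fn (λ x → trans (swap₃ ⟦ lookup r x ℕ.≟ i ⟧ₙ ⟦ lookup r y ℕ.≟ j ⟧ₙ ⟦ meet? k x y ⟧ₙ)
      (cong (⟦ lookup r y ℕ.≟ j ⟧ₙ ℕ.*_) (sym (⟦⟧ₙ-×ˡ (lookup r x ℕ.≟ i) (meet? k x y))))))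
    (sym (∑ₙ-*ˡ Fn ⟦ lookup r y ℕ.≟ j ⟧ₙ _))))
    where
    swap₃ : ∀ a b c → a ℕ.* (b ℕ.* c) ≡ b ℕ.* (a ℕ.* c)
    swap₃ = ℕSolver.solve-∀

  cell-sym : ∀ i j → ∑ₙ² n (cell i j) ≡ ∑ₙ² n (cell j i)
  cell-sym i j = trans (∑ₙ.fold-swap Fn Fn (cell i j)) (∑ₙ.fold-≗ Fn (λ y → ∑ₙ.fold-≗ Fn (λ x →
    trans (cong (λ z → ⟦ lookup r x ℕ.≟ i ⟧ₙ ℕ.* (⟦ lookup r y ℕ.≟ j ⟧ₙ ℕ.* z))
            (⟦⟧ₙ-cong (meet? k x y) (meet? k y x) (λ (a , b) → sym a , b ∘ sym) (λ (a , b) → sym a , b ∘ sym)))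
      (swap₃ ⟦ lookup r x ℕ.≟ i ⟧ₙ ⟦ lookup r y ℕ.≟ j ⟧ₙ ⟦ meet? k y x ⟧ₙ))))
    where
    swap₃ : ∀ a b c → a ℕ.* (b ℕ.* c) ≡ b ℕ.* (a ℕ.* c)
    swap₃ = ℕSolver.solve-∀

  cell≤size : ∀ i j → ∑ₙ² n (cell i j) ≤ size r j
  cell≤size i j = ℕP.≤-trans (ℕP.≤-reflexive (by-column i j))
    (∑ₙ-mono Fn (λ {y} _ → ℕP.≤-trans (ℕP.*-monoʳ-≤ ⟦ lookup r y ℕ.≟ j ⟧ₙ (partners≤1 i y)) (ℕP.≤-reflexive (ℕP.*-identityʳ _))))

  -- By separation a point has at most one partner in each block, so the meetings between two blocks
  -- exceed neither size, and inside one block there are none.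
  cell≤between : ∀ i j → ∑ₙ² n (cell i j) ≤ between r i j
  cell≤between i j with i ℕ.≟ j
  ... | yes refl = ℕP.≤-reflexive (∑ₙ²-zero (cell i i) (λ x y → trans
          (cong (⟦ lookup r x ℕ.≟ i ⟧ₙ ℕ.*_) (sym (⟦⟧ₙ-×ˡ (lookup r y ℕ.≟ i) (meet? k x y))))
          (trans (sym (⟦⟧ₙ-×ˡ (lookup r x ℕ.≟ i) _))
            (⟦⟧ₙ-no ((lookup r x ℕ.≟ i) ×-dec (lookup r y ℕ.≟ i) ×-dec meet? k x y)
              (λ (a , b , c , d) → d (separated (trans a (sym b)) c))))))
  ... | no _ = ℕP.⊓-glb (ℕP.≤-trans (ℕP.≤-reflexive (cell-sym i j)) (cell≤size j i)) (cell≤size i j)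

  meetings≤between : meetings k ≤ totalBetween r
  meetings≤between = ℕP.≤-trans (ℕP.≤-reflexive (∑ₙ²-split r bounded (λ x y → ⟦ meet? k x y ⟧ₙ)))
    (∑ₙ-mono (upTo n) (λ {i} _ → ∑ₙ-mono (upTo n) (λ {j} _ → cell≤between i j)))

  -- Equal totals force equality for each pair of blocks, and then for each point: every point of
  -- the smaller block has its one possible partner in the larger block.
  nested : meetings k ≡ totalBetween r → Nested r k
  nested e y z le with lookup r z ℕ.≟ lookup r y
  ... | yes eq = y , sym eq , refl
  ... | no ne = x , proj₁ h , proj₁ (proj₂ h)
    where
    i = lookup r z
    j = lookup r y
    cell≡between : ∑ₙ² n (cell i j) ≡ between r i j
    cell≡between = ∑ₙ-tight (upTo n) (λ {j} _ → cell≤between i j)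
      (∑ₙ-tight (upTo n) {f = λ i → ∑ₙ (upTo n) (λ j → ∑ₙ² n (cell i j))}
        (λ {i} _ → ∑ₙ-mono (upTo n) (λ {j} _ → cell≤between i j))
        (trans (sym (∑ₙ²-split r bounded (λ x y → ⟦ meet? k x y ⟧ₙ))) e) (∈P.∈-upTo⁺ (bounded z))) (∈P.∈-upTo⁺ (bounded y))
    between≡ : between r i j ≡ size r j
    between≡ with i ℕ.≟ j
    ... | yes eq = ⊥-elim (ne eq)
    ... | no _ = ℕP.m≥n⇒m⊓n≡n le
    one : ⟦ lookup r y ℕ.≟ j ⟧ₙ ℕ.* partners i y ≡ ⟦ lookup r y ℕ.≟ j ⟧ₙ
    one = ∑ₙ-tight Fn
      (λ {y} _ → ℕP.≤-trans (ℕP.*-monoʳ-≤ ⟦ lookup r y ℕ.≟ j ⟧ₙ (partners≤1 i y)) (ℕP.≤-reflexive (ℕP.*-identityʳ _)))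
      (trans (sym (by-column i j)) (trans cell≡between between≡)) (∈P.∈-allFin y)
    partners≡1 : partners i y ≡ 1
    partners≡1 = trans (sym (trans (cong (ℕ._* partners i y) (⟦⟧ₙ-yes (lookup r y ℕ.≟ j) refl)) (ℕP.*-identityˡ _)))
      (trans one (⟦⟧ₙ-yes (lookup r y ℕ.≟ j) refl))
    found = ∑ₙ-exists Fn (partner? i y) (ℕP.≤-reflexive (sym partners≡1))
    x = proj₁ found
    h = proj₂ (proj₂ found)

Separated-sym : {r k : Vec ℕ n} → Separated r k → Separated k r
Separated-sym s a b = s b a

-- Completeness by induction over set partitions

labels : Vec ℕ n
labels = tabulate toℕ

labels-bounded : Bounded (labels {n})
labels-bounded x = subst (_< _) (sym (VecP.lookup∘tabulate toℕ x)) (FinP.toℕ<n x)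

-- These labels describe the partition into singletons, whose stabilizer is trivial; this ends both
-- inductions.
Y-labels : (X : Character n) (f : V n) → Zero (Y X labels f) → Zero f
Y-labels {n} X f h m = *≡0⇒ (order≢0 (labels {n})) (trans (sym (Y-scale X labels semi m)) (h m))
  where
  semi : SemiInvariant X labels f
  semi {π} p e m = trans (cong (λ t → f (m ∙ t)) π≡id)
    (trans (cong f (∙-id m)) (sym (trans (cong (λ t → χ X t * f m) π≡id) (trans (cong (_* f m) (χ-id X)) (ℚP.*-identityˡ (f m))))))
    where
    π≡id : π ≡ idₘ
    π≡id = vec-ext λ i → trans (FinP.toℕ-injective (trans (sym (VecP.lookup∘tabulate toℕ (lookup π i)))
      (trans (sym (lookup-∙ labels π i)) (trans (≡-lookup e i) (VecP.lookup∘tabulate toℕ i))))) (sym (lookup-id i))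

-- Expanding the inner symmetrizer gives translates of `u`, and a translation only replaces `r′` by
-- `r′ ∙ π`, which has the same spread.
vanish-Y : (X X′ : Character n) (r s : Vec ℕ n) (u : V n) →
  (∀ r′ → Bounded r′ → spread r < spread r′ → Zero (Y X r′ u)) →
  ∀ r′ → Bounded r′ → spread r < spread r′ → Zero (Y X r′ (Y X′ s u))
vanish-Y X X′ r s u h r′ b l = Y-closed (Y-preimage X r′ zeroSubspace) X′ s
  {f = u} (λ {π} p m → trans (sym (Y-equivariant X p r′ u m))
    (h (r′ ∙ π) (bounded-∙ {r = r′} b π) (subst (spread r <_) (sym (spread-∙ p r′)) l) (m ∙ π)))

Clash : Vec ℕ n → Vec ℕ n → Set
Clash r k = ∃₂ λ x y → x ≢ y × lookup r x ≡ lookup r y × lookup k x ≡ lookup k y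

clash? : (r k : Vec ℕ n) → Dec (Clash r k)
clash? r k = FinP.any? λ x → FinP.any? λ y →
  distinct? x y ×-dec (lookup r x ℕ.≟ lookup r y) ×-dec (lookup k x ℕ.≟ lookup k y)

¬clash⇒separated : {r k : Vec ℕ n} → ¬ Clash r k → Separated r k
¬clash⇒separated ¬clash {x} {y} a b with x FinP.≟ y
... | yes e = e
... | no ne = ⊥-elim (¬clash (x , y , ne , a , b))

module Completeness (u : V n)
  (H : ∀ r k → Bounded r → Bounded k → Separated r k → Nested r k → Nested k r → Zero (Y (trivial n) r (Y (sign n) k u))) where

  K : ℕ
  K = ∑ₙ (allFin n) (λ _ → ∑ₙ (allFin n) (λ _ → 1))

  inner : ∀ k → Bounded k → (∀ k′ → spread k < spread k′ → Bounded k′ → Zero (Y (sign n) k′ u)) →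
    ∀ r → Bounded r → Zero (Y (trivial n) r (Y (sign n) k u))
  inner k bk ihk = descend spread K spread-≤ step
    where
    v : V n
    v = Y (sign n) k u
    eigen-k : ∀ m → classSum v m ≡ ι (totalWithin k) * (-1ℚ * v m) + ι (totalBetween k) * - (-1ℚ * v m)
    eigen-k = Eigen.eigen (sign n) k bk v (Y-semiInvariant (sign n) k u)
      (vanish-Y (sign n) (sign n) k k u (λ k′ b l → ihk k′ l b))
    step : ∀ r → (∀ r′ → spread r < spread r′ → Bounded r′ → Zero (Y (trivial n) r′ v)) → Bounded r → Zero (Y (trivial n) r v)
    step r ih br m with clash? r k
    ... | yes (x , y , x≢y , rxy , kxy) = Y-kill (trivial n) (sign n) (λ ()) r k x≢y rxy kxy u m
    ... | no ¬clash with totalWithin r ℕ.+ totalWithin k ℕ.≟ totalBetween r ℕ.+ totalBetween k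
    ... | yes eq = H r k br bk sep
            (Meetings.nested r k br sep (proj₁ tight))
            (Meetings.nested k r bk (Separated-sym {r = r} {k} sep) (proj₂ tight)) m
      where
      sep : Separated r k
      sep = ¬clash⇒separated {r = r} {k} ¬clash
      -- Both estimates of meetings hold separately and their sums agree, so each of them is an
      -- equality.
      tight : meetings k ≡ totalBetween r × meetings r ≡ totalBetween k
      tight = +-≤-tight (Meetings.meetings≤between r k br sep) (Meetings.meetings≤between k r bk (Separated-sym {r = r} {k} sep))
        (trans (cong₂ ℕ._+_ (meetings-within k bk) (meetings-within r br))
          (trans (ℕP.+-comm (totalWithin k) (totalWithin r)) eq))
    -- `w` is an eigenvector of the class sum in two ways: with `wr - br′` from its own rows, and
    -- with `bk′ - wk` inherited from `v`. The factor is the difference of these eigenvalues.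
    ... | no neq = *≡0⇒ {ι (wr ℕ.+ wk) + - ι (br′ ℕ.+ bk′)} {w m}
            (λ z → neq (ι-injective _ _ (GroupP.x∙y⁻¹≈ε⇒x≈y ℚP.+-0-group _ _ z)))
            (trans (cong (_* w m) (cong₂ (λ a b → a + - b) (ι-+ wr wk) (ι-+ br′ bk′)))
              (trans (rearrange (ι wr) (ι wk) (ι br′) (ι bk′) (w m)) (trans (cong₂ (λ a b → a + - b) (sym eigen-r) (sym eigen-k′))
                (ℚP.+-inverseʳ (classSum w m)))))
      where
      wr = totalWithin r
      wk = totalWithin k
      br′ = totalBetween r
      bk′ = totalBetween k
      w : V n
      w = Y (trivial n) r v
      eigen-r : classSum w m ≡ ι wr * (1ℚ * w m) + ι br′ * - (1ℚ * w m)
      eigen-r = Eigen.eigen (trivial n) r br w (Y-semiInvariant (trivial n) r v)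
        (vanish-Y (trivial n) (trivial n) r r v (λ r′ b l → ih r′ l b)) m
      c : ℚ
      c = ι bk′ + - ι wk
      eigen-k′ : classSum w m ≡ (ι bk′ + - ι wk) * w m
      eigen-k′ = begin
        classSum w m                                       ≡⟨ classSum-Y (trivial n) r v m ⟩
        Y (trivial n) r (classSum v) m                     ≡⟨ Y-cong (trivial n) r (λ m → trans (eigen-k m) (collect (ι wk) (ι bk′) (v m))) m ⟩
        Y (trivial n) r (λ m → c * v m + 0ℚ) m             ≡⟨ Y-lin (trivial n) r c v (λ _ → 0ℚ) m ⟩
        c * w m + Y (trivial n) r (λ _ → 0ℚ) m             ≡⟨ cong (c * w m +_) (Y-zero (trivial n) r (λ _ → refl) m) ⟩
        c * w m + 0ℚ                                       ≡⟨ ℚP.+-identityʳ _ ⟩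
        c * w m                                            ∎
        where
        open ≡-Reasoning
        collect : ∀ a b x → a * (-1ℚ * x) + b * - (-1ℚ * x) ≡ (b + - a) * x + 0ℚ
        collect = Solver.solve-∀ ℚring
      rearrange : ∀ a b c d x → (a + b + - (c + d)) * x ≡ a * (1ℚ * x) + c * - (1ℚ * x) + - ((d + - b) * x)
      rearrange = Solver.solve-∀ ℚring

  outer : ∀ k → Bounded k → Zero (Y (sign n) k u)
  outer = descend spread K spread-≤ λ k ih bk →
    Y-labels (trivial n) (Y (sign n) k u) (inner k bk ih labels labels-bounded)

  complete : Zero u
  complete = Y-labels (sign n) u (outer labels labels-bounded)

-- Tableaux given by row and column coordinates

-- Different points occupy different cells, and the occupied cells form an order ideal of ℕ × ℕ,
-- that is, a Ferrers diagram. Coordinates let permutations act on tableaux by `∙`.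
record Tableau (r c : Vec ℕ n) : Set where
  field
    separated : Separated r c
    left : ∀ {x j} → lookup c x ≡ suc j → ∃ λ y → lookup r y ≡ lookup r x × lookup c y ≡ j
    up : ∀ {x i} → lookup r x ≡ suc i → ∃ λ y → lookup c y ≡ lookup c x × lookup r y ≡ i

Y-kernel : (X : Character n) {r s : Vec ℕ n} →
  (∀ {x y} → lookup r x ≡ lookup r y → lookup s x ≡ lookup s y) →
  (∀ {x y} → lookup s x ≡ lookup s y → lookup r x ≡ lookup r y) → (f : V n) → Y X r f ≗ Y X s f
Y-kernel {n} X {r} {s} to from f m = ∑.fold-≗ (allPerms n) (λ σ → cong (λ z → z * χ X σ * f (m ∙ σ))
  (⟦⟧-cong (stab? r σ) (stab? s σ) (transfer r s σ (λ _ _ → to)) (transfer s r σ (λ _ _ → from))))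
  where
  transfer : ∀ (r s : Vec ℕ n) σ → (∀ x y → lookup r x ≡ lookup r y → lookup s x ≡ lookup s y) → r ∙ σ ≡ r → s ∙ σ ≡ s
  transfer r s σ h e = vec-ext λ i → trans (lookup-∙ s σ i) (h (lookup σ i) i (trans (sym (lookup-∙ r σ i)) (≡-lookup e i)))

∑ₙ-mono-< : (xs : List A) {f g : A → ℕ} → (∀ {x} → x ∈ xs → f x ≤ g x) → {a : A} → a ∈ xs → f a < g a → ∑ₙ xs f < ∑ₙ xs g
∑ₙ-mono-< (x ∷ xs) h (here refl) l = ℕP.+-mono-<-≤ l (∑ₙ-mono xs (h ∘ there))
∑ₙ-mono-< (x ∷ xs) h (there p) l = ℕP.+-mono-≤-< (h (here refl)) (∑ₙ-mono-< xs (h ∘ there) p l)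

∑ₙ-ones : (xs : List A) → ∑ₙ xs (λ _ → 1) ≡ length xs
∑ₙ-ones [] = refl
∑ₙ-ones (x ∷ xs) = cong suc (∑ₙ-ones xs)

-- Ranking the blocks by decreasing size turns a nested pair of labellings into a tableau.
module Rank (r : Vec ℕ n) (bounded : Bounded r) where

  Beats : ℕ → ℕ → Set
  Beats i j = size r j < size r i ⊎ (size r j ≡ size r i × i < j)

  beats? : ∀ i j → Dec (Beats i j)
  beats? i j = (size r j ℕ.<? size r i) ⊎-dec ((size r j ℕ.≟ size r i) ×-dec (i ℕ.<? j))

  beats-irrefl : ∀ {i} → ¬ Beats i i
  beats-irrefl (inj₁ l) = ℕP.<-irrefl refl l
  beats-irrefl (inj₂ (_ , l)) = ℕP.<-irrefl refl l

  beats-trans : ∀ {i j k} → Beats i j → Beats j k → Beats i k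
  beats-trans (inj₁ a) (inj₁ b) = inj₁ (ℕP.<-trans b a)
  beats-trans (inj₁ a) (inj₂ (e , _)) = inj₁ (subst (_< _) (sym e) a)
  beats-trans (inj₂ (e , _)) (inj₁ b) = inj₁ (subst (_ <_) e b)
  beats-trans (inj₂ (e , a)) (inj₂ (e′ , b)) = inj₂ (trans e′ e , ℕP.<-trans a b)

  beats-total : ∀ i j → i ≢ j → Beats i j ⊎ Beats j i
  beats-total i j i≢j with ℕP.<-cmp (size r i) (size r j)
  ... | tri< a _ _ = inj₂ (inj₁ a)
  ... | tri> _ _ a = inj₁ (inj₁ a)
  ... | tri≈ _ e _ with ℕP.<-cmp i j
  ... | tri< a _ _ = inj₁ (inj₂ (sym e , a))
  ... | tri≈ _ e′ _ = ⊥-elim (i≢j e′)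
  ... | tri> _ _ a = inj₂ (inj₂ (e , a))

  rank : ℕ → ℕ
  rank j = ∑ₙ (upTo n) (λ i → ⟦ beats? i j ⟧ₙ)

  rank-< : ∀ {i j} → i < n → Beats i j → rank i < rank j
  rank-< {i} {j} i<n b = ∑ₙ-mono-< (upTo n) (λ {k} _ → ⟦⟧ₙ-mono (beats? k i) (beats? k j) (λ a → beats-trans a b)) (∈P.∈-upTo⁺ i<n)
    (subst₂ _<_ (sym (⟦⟧ₙ-no (beats? i i) beats-irrefl)) (sym (⟦⟧ₙ-yes (beats? i j) b)) (s≤s z≤n))

  rank<n : ∀ {j} → j < n → rank j < n
  rank<n {j} j<n = ℕP.<-≤-trans
    (∑ₙ-mono-< (upTo n) (λ {k} _ → ⟦⟧ₙ≤1 (beats? k j)) (∈P.∈-upTo⁺ j<n)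
      (subst (_< 1) (sym (⟦⟧ₙ-no (beats? j j) beats-irrefl)) (s≤s z≤n)))
    (ℕP.≤-reflexive (trans (∑ₙ-ones (upTo n)) (ListP.length-upTo n)))

  rank-injective : ∀ {i j} → i < n → j < n → rank i ≡ rank j → i ≡ j
  rank-injective {i} {j} i<n j<n e with i ℕ.≟ j
  ... | yes p = p
  ... | no ne with beats-total i j ne
  ... | inj₁ b = ⊥-elim (ℕP.<-irrefl e (rank-< i<n b))
  ... | inj₂ b = ⊥-elim (ℕP.<-irrefl (sym e) (rank-< j<n b))

  rank-permutes : map rank (upTo n) ↭ upTo n
  rank-permutes = map-↭-self {f = rank} (Unique.upTo⁺ n)
    (λ q → ∈P.∈-upTo⁺ (rank<n (∈P.∈-upTo⁻ q)))
    (λ {i} {j} a b e → rank-injective {i} {j} (∈P.∈-upTo⁻ a) (∈P.∈-upTo⁻ b) e)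

  rank-surjective : ∀ {p} → p < n → ∃ λ j → j < n × rank j ≡ p
  rank-surjective {p} p<n = proj₁ found , ∈P.∈-upTo⁻ (proj₁ (proj₂ found)) , sym (proj₂ (proj₂ found))
    where
    found : ∃ λ j → j ∈ upTo n × p ≡ rank j
    found = ∈P.∈-map⁻ rank (↭P.∈-resp-↭ (↭-sym rank-permutes) (∈P.∈-upTo⁺ p<n))

  ranked : Vec ℕ n
  ranked = Vec.map rank r

  lookup-ranked : ∀ x → lookup ranked x ≡ rank (lookup r x)
  lookup-ranked x = VecP.lookup-map x rank r

  ranked-reflects : ∀ {x y} → lookup ranked x ≡ lookup ranked y → lookup r x ≡ lookup r y
  ranked-reflects {x} {y} e = rank-injective (bounded x) (bounded y)
    (trans (sym (lookup-ranked x)) (trans e (lookup-ranked y)))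

  ranked-cong : ∀ {x y} → lookup r x ≡ lookup r y → lookup ranked x ≡ lookup ranked y
  ranked-cong {x} {y} e = trans (lookup-ranked x) (trans (cong rank e) (sym (lookup-ranked y)))

  above : ∀ {a i} → a < n → rank a ≡ suc i → ∃ λ j → rank j ≡ i × size r a ≤ size r j
  above {a} {i} a<n e = j , rank-j , size≤ (beats-total j a (λ j≡a → ℕP.1+n≢n (trans (sym e) (trans (cong rank (sym j≡a)) rank-j))))
    where
    i<n : i < n
    i<n = ℕP.<-trans (ℕP.n<1+n i) (subst (_< n) e (rank<n a<n))
    j : ℕ
    j = proj₁ (rank-surjective i<n)
    rank-j : rank j ≡ i
    rank-j = proj₂ (proj₂ (rank-surjective i<n))
    size≤ : Beats j a ⊎ Beats a j → size r a ≤ size r j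
    size≤ (inj₁ (inj₁ l)) = ℕP.<⇒≤ l
    size≤ (inj₁ (inj₂ (e′ , _))) = ℕP.≤-reflexive e′
    size≤ (inj₂ b) = ⊥-elim (ℕP.<-asym (ℕP.n<1+n i) (subst₂ _<_ {x = rank a} {y = suc i} {u = rank j} {v = i} e rank-j (rank-< a<n b)))

  -- Labels without points are ranked too. Comparing sizes shows that they leave no gap above an
  -- occupied block.
  occupied : ∀ {x j} → size r (lookup r x) ≤ size r j → ∃ λ z → lookup r z ≡ j
  occupied {x} {j} le = proj₁ found , proj₂ (proj₂ found)
    where
    size≥1 : 1 ≤ size r (lookup r x)
    size≥1 = ℕP.≤-trans (ℕP.≤-reflexive (sym (⟦⟧ₙ-yes (lookup r x ℕ.≟ lookup r x) refl)))
      (∑ₙ-term (allFin n) (λ y → ⟦ lookup r y ℕ.≟ lookup r x ⟧ₙ) (∈P.∈-allFin x))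
    found : ∃ λ z → z ∈ allFin n × lookup r z ≡ j
    found = ∑ₙ-exists (allFin n) (λ y → lookup r y ℕ.≟ j) (ℕP.≤-trans size≥1 le)

  ranked-up : {k : Vec ℕ n} → Nested r k → ∀ {x i} → lookup ranked x ≡ suc i →
    ∃ λ y → lookup k y ≡ lookup k x × lookup ranked y ≡ i
  ranked-up {k} nest {x} {i} e = step (above (bounded x) (trans (sym (lookup-ranked x)) e))
    where
    step : (∃ λ j → rank j ≡ i × size r (lookup r x) ≤ size r j) → ∃ λ y → lookup k y ≡ lookup k x × lookup ranked y ≡ i
    step (j , rank-j , le) = step′ (occupied {x} {j} le)
      where
      step′ : (∃ λ z → lookup r z ≡ j) → ∃ λ y → lookup k y ≡ lookup k x × lookup ranked y ≡ i
      step′ (z , rz) = finish (nest x z (subst (λ t → size r (lookup r x) ≤ size r t) (sym rz) le))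
        where
        finish : (∃ λ w → lookup r w ≡ lookup r z × lookup k w ≡ lookup k x) → ∃ λ y → lookup k y ≡ lookup k x × lookup ranked y ≡ i
        finish (w , rw , kw) = w , kw , trans (lookup-ranked w) (trans (cong rank (trans rw rz)) rank-j)

ranked-tableau : (r k : Vec ℕ n) (br : Bounded r) (bk : Bounded k) → Separated r k → Nested r k → Nested k r →
  Tableau (Rank.ranked r br) (Rank.ranked k bk)
ranked-tableau r k br bk sep nrk nkr = record
  { separated = λ a b → sep (R.ranked-reflects a) (K.ranked-reflects b)
  ; left = λ e → let (y , a , b) = K.ranked-up {r} nkr e in y , R.ranked-cong a , b
  ; up = λ e → let (y , a , b) = R.ranked-up {k} nrk e in y , K.ranked-cong a , b
  }
  where
  module R = Rank r br
  module K = Rank k bk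

tableaux-complete : (u : V n) → (∀ r c → Tableau r c → Zero (Y (trivial n) r (Y (sign n) c u))) → Zero u
tableaux-complete {n} u H = Completeness.complete u λ r k br bk sep nrk nkr m →
  let module R = Rank r br
      module K = Rank k bk
  in trans (Y-kernel (trivial n) {r} {R.ranked} R.ranked-cong R.ranked-reflects (Y (sign n) k u) m)
    (trans (Y-cong (trivial n) R.ranked (Y-kernel (sign n) {k} {K.ranked} K.ranked-cong K.ranked-reflects u) m)
      (H R.ranked K.ranked (ranked-tableau r k br bk sep nrk nkr) m))

-- Tableaux as lists of rows

data At₁ {A : Set} : List A → ℕ → A → Set where
  here : ∀ {x xs} → At₁ (x ∷ xs) 0 x
  there : ∀ {x y xs i} → At₁ xs i y → At₁ (x ∷ xs) (suc i) y

At : Tab A → ℕ → ℕ → A → Set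
At T i j x = ∃ λ ρ → At₁ T i ρ × At₁ ρ j x

At₁-functional : {xs : List A} {i : ℕ} {x y : A} → At₁ xs i x → At₁ xs i y → x ≡ y
At₁-functional here here = refl
At₁-functional (there p) (there q) = At₁-functional p q

At-functional : {T : Tab A} {i j : ℕ} {x y : A} → At T i j x → At T i j y → x ≡ y
At-functional (ρ , p , q) (ρ′ , p′ , q′) with refl ← At₁-functional p p′ = At₁-functional q q′

At₁⇒∈ : {xs : List A} {i : ℕ} {x : A} → At₁ xs i x → x ∈ xs
At₁⇒∈ here = here refl
At₁⇒∈ (there p) = there (At₁⇒∈ p)

∈⇒At₁ : {xs : List A} {x : A} → x ∈ xs → ∃ λ i → At₁ xs i x
∈⇒At₁ (here refl) = 0 , here
∈⇒At₁ (there p) = let (i , q) = ∈⇒At₁ p in suc i , there q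

At₁-< : {xs : List A} {i : ℕ} {x : A} → At₁ xs i x → i < length xs
At₁-< here = s≤s z≤n
At₁-< (there p) = s≤s (At₁-< p)

At₁-exists : (xs : List A) {i : ℕ} → i < length xs → ∃ (At₁ xs i)
At₁-exists (x ∷ xs) {zero} l = x , here
At₁-exists (x ∷ xs) {suc i} (s≤s l) = let (y , p) = At₁-exists xs l in y , there p

At₁-pred : {xs : List A} {i : ℕ} {x : A} → At₁ xs (suc i) x → ∃ (At₁ xs i)
At₁-pred {xs = xs} p = At₁-exists xs (ℕP.<-trans (ℕP.n<1+n _) (At₁-< p))

length-≤ : (xs : List A) (ys : List B) → (∀ {i x} → At₁ xs i x → ∃ (At₁ ys i)) → length xs ≤ length ys
length-≤ xs ys h with length xs ℕ.≤? length ys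
... | yes p = p
... | no ¬p = ⊥-elim (ℕP.<-irrefl refl (At₁-< (proj₂ (h (proj₂ (At₁-exists xs (ℕP.≰⇒> ¬p)))))))

All-At₁ : {R : A → Set} (xs : List A) → (∀ {i x} → At₁ xs i x → R x) → All R xs
All-At₁ [] h = []
All-At₁ (x ∷ xs) h = h here ∷ All-At₁ xs (h ∘ there)

Linked-At₁ : {R : A → A → Set} (xs : List A) → (∀ {i x y} → At₁ xs i x → At₁ xs (suc i) y → R x y) → Linked R xs
Linked-At₁ [] h = []
Linked-At₁ (x ∷ []) h = [-]
Linked-At₁ (x ∷ y ∷ xs) h = h here (there here) ∷ Linked-At₁ (y ∷ xs) (λ p q → h (there p) (there q))

At₁-Linked : {R : A → A → Set} {xs : List A} → Linked R xs → ∀ {i x y} → At₁ xs i x → At₁ xs (suc i) y → R x y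
At₁-Linked (h ∷ l) here (there here) = h
At₁-Linked (h ∷ l) (there p) (there q) = At₁-Linked l p q

At₁-map : {xs : List A} {i : ℕ} {x : A} (f : A → B) → At₁ xs i x → At₁ (map f xs) i (f x)
At₁-map f here = here
At₁-map f (there p) = there (At₁-map f p)

At₁-unmap : {xs : List A} {i : ℕ} {y : B} (f : A → B) → At₁ (map f xs) i y → ∃ λ x → At₁ xs i x × f x ≡ y
At₁-unmap {xs = x ∷ xs} f here = x , here , refl
At₁-unmap {xs = x ∷ xs} f (there p) = let (z , q , e) = At₁-unmap f p in z , there q , e

At⇒∈concat : {T : Tab A} {i j : ℕ} {x : A} → At T i j x → x ∈ concat T
At⇒∈concat (ρ , p , q) = ∈P.∈-concat⁺′ (At₁⇒∈ q) (At₁⇒∈ p)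

∈concat⇒At : {T : Tab A} {x : A} → x ∈ concat T → ∃₂ λ i j → At T i j x
∈concat⇒At {T = T} p with ρ , q , ρ∈ ← ∈P.∈-concat⁻′ T p = let (i , a) = ∈⇒At₁ ρ∈ ; (j , b) = ∈⇒At₁ q in i , j , ρ , a , b

At₁-unique : {xs : List A} → Unique xs → ∀ {i j x} → At₁ xs i x → At₁ xs j x → i ≡ j
At₁-unique u here here = refl
At₁-unique (x∉ ∷ u) here (there q) = ⊥-elim (All.lookup x∉ (At₁⇒∈ q) refl)
At₁-unique (x∉ ∷ u) (there p) here = ⊥-elim (All.lookup x∉ (At₁⇒∈ p) refl)
At₁-unique (x∉ ∷ u) (there p) (there q) = cong suc (At₁-unique u p q)

unique-++⁻ : (xs : List A) {ys : List A} → Unique (xs ++ ys) → Unique xs × Unique ys × (∀ {x} → x ∈ xs → x ∉ ys)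
unique-++⁻ [] u = [] , u , λ ()
unique-++⁻ (x ∷ xs) (x∉ ∷ u) with a , b , c ← unique-++⁻ xs u =
  AllP.++⁻ˡ xs x∉ ∷ a , b , λ { (here refl) q → All.lookup x∉ (∈P.∈-++⁺ʳ xs q) refl ; (there p) → c p }

At-unique : {T : Tab A} → Unique (concat T) → ∀ {i j i′ j′ x} → At T i j x → At T i′ j′ x → i ≡ i′ × j ≡ j′
At-unique {T = ρ ∷ T} u (_ , here , p) (_ , here , q) = refl , At₁-unique (proj₁ (unique-++⁻ ρ u)) p q
At-unique {T = ρ ∷ T} u (_ , here , p) (_ , there q , q′) = ⊥-elim (proj₂ (proj₂ (unique-++⁻ ρ u)) (At₁⇒∈ p) (At⇒∈concat (_ , q , q′)))
At-unique {T = ρ ∷ T} u (_ , there p , p′) (_ , here , q) = ⊥-elim (proj₂ (proj₂ (unique-++⁻ ρ u)) (At₁⇒∈ q) (At⇒∈concat (_ , p , p′)))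
At-unique {T = ρ ∷ T} u (_ , there p , p′) (_ , there q , q′)
  with a , b ← At-unique (proj₁ (proj₂ (unique-++⁻ ρ u))) (_ , p , p′) (_ , q , q′) = cong suc a , b

At₁-unique⁻ : (xs : List A) → (∀ {i j x} → At₁ xs i x → At₁ xs j x → i ≡ j) → Unique xs
At₁-unique⁻ [] h = []
At₁-unique⁻ (x ∷ xs) h = All.tabulate (λ { p refl → 0≢suc (h here (there (proj₂ (∈⇒At₁ p)))) })
  ∷ At₁-unique⁻ xs (λ p q → ℕP.suc-injective (h (there p) (there q)))
  where
  0≢suc : ∀ {k} → 0 ≢ suc k
  0≢suc ()

At-unique⁻ : (T : Tab A) → (∀ {i j i′ j′ x} → At T i j x → At T i′ j′ x → i ≡ i′ × j ≡ j′) → Unique (concat T)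
At-unique⁻ [] h = []
At-unique⁻ (ρ ∷ T) h = Unique.++⁺
  (At₁-unique⁻ ρ (λ p q → proj₂ (h (ρ , here , p) (ρ , here , q))))
  (At-unique⁻ T (λ (_ , p , p′) (_ , q , q′) → let (a , b) = h (_ , there p , p′) (_ , there q , q′) in ℕP.suc-injective a , b))
  (λ (p , q) → let (_ , _ , _ , a , b) = ∈concat⇒At q in 0≢suc (proj₁ (h (ρ , here , proj₂ (∈⇒At₁ p)) (_ , there a , b))))
  where
  0≢suc : ∀ {k} → 0 ≢ suc k
  0≢suc ()

-- The dictionary between the two encodings: the lists occur in `F` and in the shapes, the
-- labellings carry the group action.
record Coords (T : Tab (Fin n)) (r c : Vec ℕ n) : Set where
  field
    sound : ∀ {i j x} → At T i j x → lookup r x ≡ i × lookup c x ≡ j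
    complete : ∀ x → At T (lookup r x) (lookup c x) x

  concat-unique : Unique (concat T)
  concat-unique = At-unique⁻ T (λ p q →
    trans (sym (proj₁ (sound p))) (proj₁ (sound q)) , trans (sym (proj₂ (sound p))) (proj₂ (sound q)))

  concat-↭ : concat T ↭ allFin n
  concat-↭ = unique-set-↭ concat-unique (Unique.allFin⁺ n) (λ _ → ∈P.∈-allFin _) (λ {x} _ → At⇒∈concat (complete x))

unique-↭ : {xs ys : List A} → Unique ys → xs ↭ ys → Unique xs
unique-↭ u ↭.refl = u
unique-↭ (y∉ ∷ u) (prep y p) = All.tabulate (λ q → All.lookup y∉ (↭P.∈-resp-↭ p q)) ∷ unique-↭ u p
unique-↭ ((y≢x ∷ y∉) ∷ x∉ ∷ u) (swap x y p) =
  ((y≢x ∘ sym) ∷ All.tabulate (λ q → All.lookup x∉ (↭P.∈-resp-↭ p q))) ∷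
  All.tabulate (λ q → All.lookup y∉ (↭P.∈-resp-↭ p q)) ∷ unique-↭ u p
unique-↭ u (↭.trans p q) = unique-↭ (unique-↭ u q) p

filling-coords : (T : Tab (Fin n)) → concat T ↭ allFin n → ∃₂ (Coords T)
filling-coords {n} T p = tabulate (proj₁ ∘ pos) , tabulate (proj₁ ∘ proj₂ ∘ pos) , record
  { sound = λ {i} {j} {x} q → let (a , b) = At-unique u (at x) q in a , b
  ; complete = at
  }
  where
  u : Unique (concat T)
  u = unique-↭ (Unique.allFin⁺ n) p
  pos : ∀ x → ∃₂ λ i j → At T i j x
  pos x = ∈concat⇒At (↭P.∈-resp-↭ (↭-sym p) (∈P.∈-allFin x))
  at : ∀ x → At T (lookup (tabulate (proj₁ ∘ pos)) x) (lookup (tabulate (proj₁ ∘ proj₂ ∘ pos)) x) x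
  at x = subst₂ (λ i j → At T i j x) (sym (VecP.lookup∘tabulate (proj₁ ∘ pos) x))
    (sym (VecP.lookup∘tabulate (proj₁ ∘ proj₂ ∘ pos) x)) (proj₂ (proj₂ (pos x)))

At-left : {T : Tab A} {i j : ℕ} {x : A} → At T i (suc j) x → ∃ (At T i j)
At-left (ρ , p , q) = let (y , q′) = At₁-pred q in y , ρ , p , q′

At-up : {T : Tab A} → Linked ℕ._≥_ (shape T) → ∀ {i j x} → At T (suc i) j x → ∃ (At T i j)
At-up {T = T} l (ρ , p , q) with ρ′ , p′ ← At₁-pred p =
  let (y , q′) = At₁-exists ρ′ (ℕP.<-≤-trans (At₁-< q) (At₁-Linked l (At₁-map length p′) (At₁-map length p)))
  in y , ρ′ , p′ , q′

coords-tableau : {T : Tab (Fin n)} {r c : Vec ℕ n} → Coords T r c → Linked ℕ._≥_ (shape T) → Tableau r c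
coords-tableau {T = T} {r} {c} co l = record
  { separated = λ {x} {y} a b → At-functional (complete x) (subst₂ (λ i j → At T i j y) (sym a) (sym b) (complete y))
  ; left = λ {x} e → let (y , p) = At-left (subst (λ j → At T (lookup r x) j x) e (complete x)) in y , sound p
  ; up = λ {x} e → let (y , p) = At-up l (subst (λ i → At T i (lookup c x) x) e (complete x)) in y , proj₂ (sound p) , proj₁ (sound p)
  }
  where open Coords co

sum-lengths : (T : Tab A) → sum (shape T) ≡ length (concat T)
sum-lengths [] = refl
sum-lengths (ρ ∷ T) = trans (cong (length ρ ℕ.+_) (sum-lengths T)) (sym (ListP.length-++ ρ))

module ToList (r c : Vec ℕ n) (tab : Tableau r c) where
  open Tableau tab

  cell? : ∀ i j → Dec (∃ λ x → lookup r x ≡ i × lookup c x ≡ j)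
  cell? i j = FinP.any? λ x → (lookup r x ℕ.≟ i) ×-dec (lookup c x ℕ.≟ j)

  left* : ∀ {i} j p x → lookup r x ≡ i → lookup c x ≡ j ℕ.+ p → ∃ λ y → lookup r y ≡ i × lookup c y ≡ j
  left* j zero x a b = x , a , trans b (ℕP.+-identityʳ j)
  left* j (suc p) x a b with y , ry , cy ← left (trans b (ℕP.+-suc j p)) = left* j p y (trans ry a) cy

  up* : ∀ {j} i p x → lookup c x ≡ j → lookup r x ≡ i ℕ.+ p → ∃ λ y → lookup c y ≡ j × lookup r y ≡ i
  up* i zero x a b = x , a , trans b (ℕP.+-identityʳ i)
  up* i (suc p) x a b with y , cy , ry ← up (trans b (ℕP.+-suc i p)) = up* i p y (trans cy a) ry

  -- The first argument is fuel exceeding the number of cells to be read.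
  rowFrom : ℕ → ℕ → ℕ → List (Fin n)
  rowFrom zero i j = []
  rowFrom (suc f) i j with cell? i j
  ... | yes (x , _) = x ∷ rowFrom f i (suc j)
  ... | no _ = []

  rowFrom-sound : ∀ f i j {p x} → At₁ (rowFrom f i j) p x → lookup r x ≡ i × lookup c x ≡ j ℕ.+ p
  rowFrom-sound (suc f) i j q with cell? i j
  rowFrom-sound (suc f) i j here | yes (x , a , b) = a , trans b (sym (ℕP.+-identityʳ j))
  rowFrom-sound (suc f) i j (there q) | yes _ with a , b ← rowFrom-sound f i (suc j) q = a , trans b (sym (ℕP.+-suc j _))

  rowFrom-complete : ∀ f i j p {x} → p < f → lookup r x ≡ i → lookup c x ≡ j ℕ.+ p → At₁ (rowFrom f i j) p x
  rowFrom-complete (suc f) i j p {x} l a b with cell? i j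
  ... | no ¬e = ⊥-elim (¬e (left* j p x a b))
  rowFrom-complete (suc f) i j zero {x} l a b | yes (y , a′ , b′)
    with refl ← separated {x} {y} (trans a (sym a′)) (trans b (trans (ℕP.+-identityʳ j) (sym b′))) = here
  rowFrom-complete (suc f) i j (suc p) {x} (s≤s l) a b | yes _ =
    there (rowFrom-complete f i (suc j) p l a (trans b (ℕP.+-suc j p)))

  -- One more than the sum of all coordinates, hence larger than each of them.
  width height : ℕ
  width = suc (∑ₙ (allFin n) (lookup c))
  height = suc (∑ₙ (allFin n) (lookup r))

  row : ℕ → List (Fin n)
  row i = rowFrom width i 0

  tabFrom : ℕ → ℕ → Tab (Fin n)
  tabFrom zero i = []
  tabFrom (suc f) i with cell? i 0
  ... | yes _ = row i ∷ tabFrom f (suc i)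
  ... | no _ = []

  tabFrom-sound : ∀ f i {p ρ} → At₁ (tabFrom f i) p ρ → ρ ≡ row (i ℕ.+ p) × ∃ λ x → lookup r x ≡ i ℕ.+ p × lookup c x ≡ 0
  tabFrom-sound (suc f) i q with cell? i 0
  tabFrom-sound (suc f) i here | yes e = cong row (sym (ℕP.+-identityʳ i)) , subst (λ k → ∃ λ x → lookup r x ≡ k × lookup c x ≡ 0) (sym (ℕP.+-identityʳ i)) e
  tabFrom-sound (suc f) i {suc p} {ρ} (there q) | yes _ = subst (λ k → ρ ≡ row k × ∃ λ x → lookup r x ≡ k × lookup c x ≡ 0) (sym (ℕP.+-suc i p)) (tabFrom-sound f (suc i) q)

  tabFrom-complete : ∀ f i p {x} → p < f → lookup r x ≡ i ℕ.+ p → At₁ (tabFrom f i) p (row (i ℕ.+ p))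
  tabFrom-complete (suc f) i p {x} l a with cell? i 0
  ... | no ¬e with y , ry , cy ← left* 0 (lookup c x) x a refl with z , cz , rz ← up* i p y cy ry = ⊥-elim (¬e (z , rz , cz))
  tabFrom-complete (suc f) i zero l a | yes _ = subst (λ k → At₁ (row i ∷ tabFrom f (suc i)) 0 (row k)) (sym (ℕP.+-identityʳ i)) here
  tabFrom-complete (suc f) i (suc p) {x} (s≤s l) a | yes _ =
    subst (λ k → At₁ (row i ∷ tabFrom f (suc i)) (suc p) (row k)) (sym (ℕP.+-suc i p))
      (there (tabFrom-complete f (suc i) p {x} l (trans a (ℕP.+-suc i p))))

  tab-list : Tab (Fin n)
  tab-list = tabFrom height 0

  coords : Coords tab-list r c
  coords = record
    { sound = λ { (ρ , p , q) → snd p q }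
    ; complete = λ x → row (lookup r x) ,
        tabFrom-complete height 0 (lookup r x) {x} (s≤s (∑ₙ-term (allFin n) (lookup r) (∈P.∈-allFin x))) refl ,
        rowFrom-complete width (lookup r x) 0 (lookup c x) (s≤s (∑ₙ-term (allFin n) (lookup c) (∈P.∈-allFin x))) refl refl
    }
    where
    snd : ∀ {i j x ρ} → At₁ tab-list i ρ → At₁ ρ j x → lookup r x ≡ i × lookup c x ≡ j
    snd {i} p q with refl , _ ← tabFrom-sound height 0 p = rowFrom-sound width i 0 q

  partition : IsPartition n (shape tab-list)
  partition =
    AllP.map⁺ (All-At₁ tab-list (λ p → let (e , x , rx , cx) = tabFrom-sound height 0 p in
      ℕP.≤-trans (s≤s z≤n) (At₁-< (subst (λ ρ → At₁ ρ 0 x) (sym e) (rowFrom-complete width _ 0 0 (s≤s z≤n) rx cx))))) ,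
    LinkedP.map⁺ (Linked-At₁ tab-list (λ {i} {ρ} {ρ′} p q → length-≤ ρ′ ρ (λ {j} {x} s →
      let (rx , cx) = Coords.sound coords (ρ′ , q , s)
          (y , cy , ry) = up rx
          (ρ″ , p″ , s″) = Coords.complete coords y
      in y , subst₂ (λ ρ j → At₁ ρ j y) (At₁-functional (subst (λ i → At₁ tab-list i ρ″) ry p″) p) (trans cy cx) s″))) ,
    trans (sum-lengths tab-list) (trans (↭P.↭-length (Coords.concat-↭ coords)) (ListP.length-tabulate id))

-- Straightening

-- This is (a - b)(p - q) ≥ 0, rearranged so that no subtraction occurs.
rectangle : ∀ {a b p q} → b ≤ a → q ≤ p → b ℕ.* p ℕ.+ a ℕ.* q ≤ a ℕ.* p ℕ.+ b ℕ.* q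
rectangle {a} {b} {p} {q} b≤a q≤p = subst₂ (λ a p → b ℕ.* p ℕ.+ a ℕ.* q ≤ a ℕ.* p ℕ.+ b ℕ.* q)
  (ℕP.m+[n∸m]≡n b≤a) (ℕP.m+[n∸m]≡n q≤p)
  (ℕP.≤-trans (ℕP.m≤m+n _ ((a ∸ b) ℕ.* (p ∸ q))) (ℕP.≤-reflexive (expand b (a ∸ b) q (p ∸ q))))
  where
  expand : ∀ b s q t → b ℕ.* (q ℕ.+ t) ℕ.+ (b ℕ.+ s) ℕ.* q ℕ.+ s ℕ.* t ≡ (b ℕ.+ s) ℕ.* (q ℕ.+ t) ℕ.+ b ℕ.* q
  expand = ℕSolver.solve-∀

rectangle-< : ∀ {a b p q} → b < a → q < p → b ℕ.* p ℕ.+ a ℕ.* q < a ℕ.* p ℕ.+ b ℕ.* q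
rectangle-< {suc a} {b} {suc p} {q} (s≤s b≤a) (s≤s q≤p) = subst₂ (λ a p → b ℕ.* suc p ℕ.+ suc a ℕ.* q < suc a ℕ.* suc p ℕ.+ b ℕ.* q)
  (ℕP.m+[n∸m]≡n b≤a) (ℕP.m+[n∸m]≡n q≤p)
  (ℕP.≤-trans (ℕP.m≤m+n _ ((a ∸ b) ℕ.* (p ∸ q) ℕ.+ (a ∸ b) ℕ.+ (p ∸ q))) (ℕP.≤-reflexive (expand b (a ∸ b) q (p ∸ q))))
  where
  expand : ∀ b s q t → suc (b ℕ.* suc (q ℕ.+ t) ℕ.+ suc (b ℕ.+ s) ℕ.* q) ℕ.+ (s ℕ.* t ℕ.+ s ℕ.+ t)
    ≡ suc (b ℕ.+ s) ℕ.* suc (q ℕ.+ t) ℕ.+ b ℕ.* q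
  expand = ℕSolver.solve-∀

-- With row numbers it measures how low the large entries lie, with column numbers how far to the
-- right.
moment : Vec ℕ n → Vec ℕ n → ℕ
moment {n} c h = ∑ₙ (allFin n) (λ x → lookup c x ℕ.* lookup h x)

moment-∙ : {τ : Map n} → Inj τ → (c h : Vec ℕ n) → moment (c ∙ τ) (h ∙ τ) ≡ moment c h
moment-∙ {n} {τ} p c h = trans (∑ₙ.fold-≗ (allFin n) (λ z → cong₂ ℕ._*_ (lookup-∙ c τ z) (lookup-∙ h τ z)))
  (∑ₙ-relabel p (λ z → lookup c z ℕ.* lookup h z))

total : Vec ℕ n → ℕ
total {n} h = ∑ₙ (allFin n) (lookup h)

total-∙ : {τ : Map n} → Inj τ → (h : Vec ℕ n) → total (h ∙ τ) ≡ total h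
total-∙ {n} {τ} p h = trans (∑ₙ.fold-≗ (allFin n) (lookup-∙ h τ)) (∑ₙ-relabel p (lookup h))

moment-≤ : (c h : Vec ℕ n) → moment c h ≤ ∑ₙ (allFin n) (λ x → lookup c x ℕ.* total h)
moment-≤ {n} c h = ∑ₙ-mono (allFin n) (λ {x} _ → ℕP.*-monoʳ-≤ (lookup c x) (∑ₙ-term (allFin n) (lookup h) (∈P.∈-allFin x)))

-- The gain in moment is Σ (c z - c (τ z)) (h (τ z) - β), since the part with β cancels over a
-- permutation. The hypothesis `side` gives the two factors compatible signs.
module Exchange (c h : Vec ℕ n) {τ : Map n} (p : Inj τ) (β : ℕ)
  (side : ∀ z → (lookup c (lookup τ z) ≤ lookup c z × β ≤ lookup h (lookup τ z)) ⊎
                (lookup c z ≤ lookup c (lookup τ z) × lookup h (lookup τ z) ≤ β)) where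

  Fn = allFin n

  lhs rhs : Fin n → ℕ
  lhs z = lookup c (lookup τ z) ℕ.* lookup h (lookup τ z) ℕ.+ lookup c z ℕ.* β
  rhs z = lookup c z ℕ.* lookup h (lookup τ z) ℕ.+ lookup c (lookup τ z) ℕ.* β

  pointwise : ∀ z → lhs z ≤ rhs z
  pointwise z with side z
  ... | inj₁ (a , b) = rectangle a b
  ... | inj₂ (a , b) = ℕP.≤-trans (ℕP.≤-reflexive (ℕP.+-comm (lookup c (lookup τ z) ℕ.* lookup h (lookup τ z)) _))
          (ℕP.≤-trans (rectangle a b) (ℕP.≤-reflexive (ℕP.+-comm (lookup c (lookup τ z) ℕ.* β) _)))

  strict : ∀ z → lookup c z ≢ lookup c (lookup τ z) → lookup h (lookup τ z) ≢ β → lhs z < rhs z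
  strict z ne ne′ with side z
  ... | inj₁ (a , b) = rectangle-< (ℕP.≤∧≢⇒< a (ne ∘ sym)) (ℕP.≤∧≢⇒< b (ne′ ∘ sym))
  ... | inj₂ (a , b) = ℕP.≤-<-trans (ℕP.≤-reflexive (ℕP.+-comm (lookup c (lookup τ z) ℕ.* lookup h (lookup τ z)) _))
          (ℕP.<-≤-trans (rectangle-< (ℕP.≤∧≢⇒< a ne) (ℕP.≤∧≢⇒< b ne′)) (ℕP.≤-reflexive (ℕP.+-comm (lookup c (lookup τ z) ℕ.* β) _)))

  base : ℕ
  base = ∑ₙ Fn (λ z → lookup c z ℕ.* β)

  ∑lhs : ∑ₙ Fn lhs ≡ moment c h ℕ.+ base
  ∑lhs = trans (∑ₙ.fold-• Fn _ _) (cong (ℕ._+ base) (∑ₙ-relabel p (λ z → lookup c z ℕ.* lookup h z)))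

  ∑rhs : ∑ₙ Fn rhs ≡ moment c (h ∙ τ) ℕ.+ base
  ∑rhs = trans (∑ₙ.fold-• Fn _ _) (cong₂ ℕ._+_
    (∑ₙ.fold-≗ Fn (λ z → cong (lookup c z ℕ.*_) (sym (lookup-∙ h τ z))))
    (∑ₙ-relabel p (λ z → lookup c z ℕ.* β)))

  moment-mono : moment c h ≤ moment c (h ∙ τ)
  moment-mono = ℕP.+-cancelʳ-≤ base _ _ (subst₂ _≤_ ∑lhs ∑rhs (∑ₙ-mono Fn (λ {z} _ → pointwise z)))

  moment-strict : ∀ z → lookup c z ≢ lookup c (lookup τ z) → lookup h (lookup τ z) ≢ β → moment c h < moment c (h ∙ τ)
  moment-strict z a b = ℕP.+-cancelʳ-< base _ _ (subst₂ _<_ ∑lhs ∑rhs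
    (∑ₙ-mono-< Fn (λ {z} _ → pointwise z) (∈P.∈-allFin z) (strict z a b)))

  moment-tight : moment c (h ∙ τ) ≡ moment c h → ∀ z → lookup c z ≡ lookup c (lookup τ z) ⊎ lookup h (lookup τ z) ≡ β
  moment-tight e z with lookup c z ℕ.≟ lookup c (lookup τ z) | lookup h (lookup τ z) ℕ.≟ β
  ... | yes a | _ = inj₁ a
  ... | no _ | yes b = inj₂ b
  ... | no a | no b = ⊥-elim (ℕP.<-irrefl (sym e) (moment-strict z a b))

-- If every entry that τ moves between rows has the same value β, then h ∙ τ is a rearrangement of h within rows.
module RowEquivalence (r h : Vec ℕ n) (β : ℕ) where

  moved? : (τ : Map n) (z : Fin n) → Dec (lookup r (lookup τ z) ≢ lookup r z)
  moved? τ z = ¬? (lookup r (lookup τ z) ℕ.≟ lookup r z)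

  moves : Map n → ℕ
  moves τ = ∑ₙ (allFin n) (λ z → ⟦ moved? τ z ⟧ₙ)

  Goal : Map n → Set
  Goal τ = ∃ λ ρ → Inj ρ × r ∙ ρ ≡ r × h ∙ τ ≡ h ∙ ρ

  Fixes : Map n → Set
  Fixes τ = ∀ z → lookup r (lookup τ z) ≡ lookup r z ⊎ lookup h (lookup τ z) ≡ β

  value : {τ : Map n} → Fixes τ → ∀ {z} → lookup r (lookup τ z) ≢ lookup r z → lookup h (lookup τ z) ≡ β
  value fix {z} ne with fix z
  ... | inj₁ e = ⊥-elim (ne e)
  ... | inj₂ e = e

  -- As many `z` satisfy `r (τ z) = r x` as there are points in the row of `x`. Since `x` is not
  -- among them, some such `z` lies outside that row.
  incoming : {τ : Map n} → Inj τ → ∀ {x} → lookup r (lookup τ x) ≢ lookup r x →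
    ∃ λ y → lookup r (lookup τ y) ≡ lookup r x × lookup r y ≢ lookup r x
  incoming {τ} p {x} ne with FinP.any? (λ y → (lookup r (lookup τ y) ℕ.≟ lookup r x) ×-dec ¬? (lookup r y ℕ.≟ lookup r x))
  ... | yes found = found
  ... | no none = ⊥-elim (0≢1 (trans (sym (⟦⟧ₙ-no (lookup r (lookup τ x) ℕ.≟ lookup r x) ne))
          (trans (tight (∈P.∈-allFin x)) (⟦⟧ₙ-yes (lookup r x ℕ.≟ lookup r x) refl))))
    where
    0≢1 : 0 ≢ 1
    0≢1 ()
    back : ∀ y → lookup r (lookup τ y) ≡ lookup r x → lookup r y ≡ lookup r x
    back y e with lookup r y ℕ.≟ lookup r x
    ... | yes e′ = e′
    ... | no ne′ = ⊥-elim (none (y , e , ne′))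
    tight : ∀ {z} → z ∈ allFin n → ⟦ lookup r (lookup τ z) ℕ.≟ lookup r x ⟧ₙ ≡ ⟦ lookup r z ℕ.≟ lookup r x ⟧ₙ
    tight = ∑ₙ-tight (allFin n)
      (λ {z} _ → ⟦⟧ₙ-mono (lookup r (lookup τ z) ℕ.≟ lookup r x) (lookup r z ℕ.≟ lookup r x) (back z))
      (∑ₙ-relabel p (λ z → ⟦ lookup r z ℕ.≟ lookup r x ⟧ₙ))

  go : ∀ fuel (τ : Map n) → moves τ < fuel → Inj τ → Fixes τ → Goal τ
  go (suc fuel) τ l p fix with FinP.any? (moved? τ)
  ... | no none = τ , p , vec-ext (λ z → trans (lookup-∙ r τ z) (stay z)) , refl
    where
    stay : ∀ z → lookup r (lookup τ z) ≡ lookup r z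
    stay z with lookup r (lookup τ z) ℕ.≟ lookup r z
    ... | yes e = e
    ... | no ne = ⊥-elim (none (z , ne))
  ... | yes (x , ne) = swapIn (incoming p ne)
    where
    swapIn : (∃ λ y → lookup r (lookup τ y) ≡ lookup r x × lookup r y ≢ lookup r x) → Goal τ
    swapIn (y , ry , ney) = finish (go fuel τ′ (ℕP.<-≤-trans decrease (ℕ.s≤s⁻¹ l)) (∙-inj (tr-inj a b) p) fix′)
      where
      a = lookup τ x
      b = lookup τ y
      -- Both `a` and `b` carry the entry β, so exchanging them leaves `h ∙ τ` unchanged, while
      -- position `x` now receives an entry from its own row.
      τ′ = tr a b ∙ τ
      at : ∀ z → lookup τ′ z ≡ trf a b (lookup τ z)
      at z = trans (lookup-∙ (tr a b) τ z) (lookup-tr a b (lookup τ z))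
      hτ′ : h ∙ τ′ ≡ h ∙ τ
      hτ′ = trans (∙-assoc h (tr a b) τ) (cong (_∙ τ) (∙-tr h a b
        (trans (value {τ} fix ne) (sym (value {τ} fix (λ e → ney (trans (sym e) ry)))))))
      finish : Goal τ′ → Goal τ
      finish (ρ , q , e , e′) = ρ , q , e , trans (sym hτ′) e′
      R′ : Fin n → Fin n → Set
      R′ z w = lookup r w ≡ lookup r z ⊎ lookup h w ≡ β
      fix′ : Fixes τ′
      fix′ z = subst (R′ z) (sym (at z)) (trf-elim a b (lookup τ z) (R′ z)
        (λ e → inj₁ (trans ry (cong (lookup r) (sym (cancel p e)))))
        (λ _ → inj₂ (value {τ} fix ne))
        (λ _ _ → fix z))
      moved-mono : ∀ z → lookup r (lookup τ′ z) ≢ lookup r z → lookup r (lookup τ z) ≢ lookup r z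
      moved-mono z = subst (λ w → lookup r w ≢ lookup r z → lookup r (lookup τ z) ≢ lookup r z) (sym (at z))
        (trf-elim a b (lookup τ z) (λ w → lookup r w ≢ lookup r z → lookup r (lookup τ z) ≢ lookup r z)
          (λ e h′ → ⊥-elim (h′ (trans ry (cong (lookup r) (sym (cancel p e))))))
          (λ e _ e′ → ney (trans (cong (lookup r) (sym (cancel p e))) (trans (sym e′) (trans (cong (lookup r) e) ry))))
          (λ _ _ h′ → h′))
      x-settled : lookup r (lookup τ′ x) ≡ lookup r x
      x-settled = trans (cong (lookup r) (trans (at x) (trf-x a b))) ry
      decrease : moves τ′ < moves τ
      decrease = ∑ₙ-mono-< (allFin n) (λ {z} _ → ⟦⟧ₙ-mono (moved? τ′ z) (moved? τ z) (moved-mono z)) (∈P.∈-allFin x)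
        (subst₂ _<_ (sym (⟦⟧ₙ-no (moved? τ′ x) (λ h′ → h′ x-settled))) (sym (⟦⟧ₙ-yes (moved? τ x) ne)) (s≤s z≤n))

  rowEquivalent : {τ : Map n} → Inj τ → Fixes τ → Goal τ
  rowEquivalent {τ} = go (suc (moves τ)) τ ℕP.≤-refl

-- Outside the stabilizer the weight is zero, so those translates can be replaced by the zero
-- function.
Y-closed-stab : {D : V n → Set} → Subspace D → (X : Character n) (r : Vec ℕ n) {f : V n} →
  (∀ {π} → Inj π → r ∙ π ≡ r → D (π ▷ f)) → D (Y X r f)
Y-closed-stab {n} {D} S X r {f} h = resp S (λ m → ∑.fold-≗ (allPerms n) (λ σ → same σ m)) (∑-closed S (allPerms n) (weight X r) g closed)
  where
  g : Map n → V n
  g σ with stab? r σ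
  ... | yes _ = σ ▷ f
  ... | no _ = λ _ → 0ℚ
  same : ∀ σ m → weight X r σ * g σ m ≡ weight X r σ * f (m ∙ σ)
  same σ m with stab? r σ
  ... | yes _ = refl
  ... | no _ = trans (ℚP.*-zeroʳ (0ℚ * χ X σ)) (sym (trans (cong (_* f (m ∙ σ)) (ℚP.*-zeroˡ (χ X σ))) (ℚP.*-zeroˡ (f (m ∙ σ)))))
  closed : ∀ {σ} → σ ∈ allPerms n → D (g σ)
  closed {σ} q with stab? r σ
  ... | yes e = h (allPerms-inj q) e
  ... | no _ = zeroᵥ S

RowWeak ColStrict : (r c h : Vec ℕ n) → Set
RowWeak r c h = ∀ x y → lookup r x ≡ lookup r y → lookup c x < lookup c y → lookup h x ≤ lookup h y
ColStrict r c h = ∀ x y → lookup c x ≡ lookup c y → suc (lookup r x) ≡ lookup r y → lookup h x < lookup h y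

stab-inv : {r : Vec ℕ n} {π : Map n} (p : Inj π) → r ∙ π ≡ r → r ∙ inv p ≡ r
stab-inv {r = r} p e = trans (cong (_∙ inv p) (sym e)) (∙-inv-cancel r p)

module Straighten (r c : Vec ℕ n) (tab : Tableau r c) (u : V n) where
  open Tableau tab

  g : V n
  g = Y (trivial n) r (Y (sign n) c u)

  g-row : {π : Map n} → Inj π → r ∙ π ≡ r → ∀ m → g (m ∙ π) ≡ g m
  g-row p e m = trans (Y-semiInvariant (trivial n) r (Y (sign n) c u) p e m) (ℚP.*-identityˡ (g m))

  -- The Garnir set attached to vertically adjacent cells x, x′.
  module Garnir (x x′ : Fin n) (cx : lookup c x ≡ lookup c x′) (rx : suc (lookup r x) ≡ lookup r x′) where

    i j : ℕ
    i = lookup r x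
    j = lookup c x

    i≢1+i : i ≢ lookup r x′
    i≢1+i e = ℕP.1+n≢n (trans rx (sym e))

    upper? : ∀ z → Dec (lookup r z ≡ i × j ≤ lookup c z)
    upper? z = (lookup r z ℕ.≟ i) ×-dec (j ℕ.≤? lookup c z)
    lower? : ∀ z → Dec (lookup r z ≡ lookup r x′ × lookup c z ≤ j)
    lower? z = (lookup r z ℕ.≟ lookup r x′) ×-dec (lookup c z ℕ.≤? j)

    InY : Fin n → Set
    InY z = (lookup r z ≡ i × j ≤ lookup c z) ⊎ (lookup r z ≡ lookup r x′ × lookup c z ≤ j)

    inY? : ∀ z → Dec (InY z)
    inY? z = upper? z ⊎-dec lower? z

    label : ∀ z → Dec (InY z) → ℕ
    label z (yes _) = n
    label z (no _) = toℕ z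

    -- One block for the Garnir set and singletons elsewhere. The label `n` is free because every
    -- index is smaller.
    q : Vec ℕ n
    q = tabulate (λ z → label z (inY? z))

    q-in : ∀ {z} → InY z → lookup q z ≡ n
    q-in {z} h = trans (VecP.lookup∘tabulate _ z) (go (inY? z))
      where
      go : (d : Dec (InY z)) → label z d ≡ n
      go (yes _) = refl
      go (no ¬h) = ⊥-elim (¬h h)

    q-out : ∀ {z} → ¬ InY z → lookup q z ≡ toℕ z
    q-out {z} ¬h = trans (VecP.lookup∘tabulate _ z) (go (inY? z))
      where
      go : (d : Dec (InY z)) → label z d ≡ toℕ z
      go (yes h) = ⊥-elim (¬h h)
      go (no _) = refl

    Fn = allFin n

    left? : ∀ (a : ℕ) z → Dec (lookup r z ≡ a × lookup c z < j)
    left? a z = (lookup r z ℕ.≟ a) ×-dec (lookup c z ℕ.<? j)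

    # : {R : Fin n → Set} → (∀ z → Dec (R z)) → ℕ
    # R? = ∑ₙ Fn (λ z → ⟦ R? z ⟧ₙ)

    row-split : # (λ z → lookup r z ℕ.≟ i) ≡ # (left? i) ℕ.+ # upper?
    row-split = trans (∑ₙ.fold-≗ Fn pt) (∑ₙ.fold-• Fn _ _)
      where
      pt : ∀ z → ⟦ lookup r z ℕ.≟ i ⟧ₙ ≡ ⟦ left? i z ⟧ₙ ℕ.+ ⟦ upper? z ⟧ₙ
      pt z with lookup r z ℕ.≟ i
      ... | no ne = sym (cong₂ ℕ._+_ (⟦⟧ₙ-no (no ne ×-dec (lookup c z ℕ.<? j)) (ne ∘ proj₁))
              (⟦⟧ₙ-no (no ne ×-dec (j ℕ.≤? lookup c z)) (ne ∘ proj₁)))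
      ... | yes e with lookup c z ℕ.<? j | j ℕ.≤? lookup c z
      ... | yes _ | no _ = refl
      ... | no _ | yes _ = refl
      ... | yes a | yes b = ⊥-elim (ℕP.<⇒≱ a b)
      ... | no a | no b = ⊥-elim (a (ℕP.≰⇒> b))

    Y-split : # inY? ≡ # upper? ℕ.+ # lower?
    Y-split = trans (∑ₙ.fold-≗ Fn pt) (∑ₙ.fold-• Fn _ _)
      where
      pt : ∀ z → ⟦ inY? z ⟧ₙ ≡ ⟦ upper? z ⟧ₙ ℕ.+ ⟦ lower? z ⟧ₙ
      pt z with upper? z | lower? z
      ... | yes (a , _) | yes (b , _) = ⊥-elim (i≢1+i (trans (sym a) b))
      ... | yes _ | no _ = refl
      ... | no _ | yes _ = refl
      ... | no _ | no _ = refl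

    left-≤ : # (left? i) ≤ # (left? (lookup r x′))
    left-≤ = count-≤ ℕ._≟_ (left? i) (left? (lookup r x′)) (lookup c) (lookup c) (Unique.allFin⁺ n)
      (λ (a , _) (b , _) e → separated (trans a (sym b)) e)
      (λ {z} (_ , l) → let (y , ry , cy) = ToList.left* r c tab (lookup c z) (j ∸ lookup c z) x′ refl
                             (trans (sym cx) (sym (ℕP.m+[n∸m]≡n (ℕP.<⇒≤ l))))
                       in y , ∈P.∈-allFin y , (ry , subst (_< j) (sym cy) l) , sym cy)

    lower-> : # (left? (lookup r x′)) < # lower?
    lower-> = ∑ₙ-mono-< Fn (λ {z} _ → ⟦⟧ₙ-mono (left? (lookup r x′) z) (lower? z) (λ (a , b) → a , ℕP.<⇒≤ b)) (∈P.∈-allFin x′)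
      (subst₂ _<_ (sym (⟦⟧ₙ-no (left? (lookup r x′) x′) (λ (_ , l) → ℕP.<-irrefl (sym cx) l)))
        (sym (⟦⟧ₙ-yes (lower? x′) (refl , ℕP.≤-reflexive (sym cx)))) (s≤s z≤n))

    -- The lower row reaches column `j`, so left of that column it has at least as many cells as the
    -- upper row; `x′` is the one cell too many.
    crowded : # (λ z → lookup r z ℕ.≟ i) < # inY?
    crowded = subst₂ _<_ (sym row-split) (trans (ℕP.+-comm (# lower?) (# upper?)) (sym Y-split))
      (ℕP.+-monoˡ-< (# upper?) (ℕP.≤-<-trans left-≤ lower->))

    collision? : (k : Vec ℕ n) → Dec (∃₂ λ y z → y ≢ z × InY y × InY z × lookup k y ≡ lookup k z)
    collision? k = FinP.any? λ y → FinP.any? λ z →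
      distinct? y z ×-dec inY? y ×-dec inY? z ×-dec (lookup k y ℕ.≟ lookup k z)

    -- A row permutation keeps the Garnir set within two adjacent rows, hence within the columns
    -- that meet the upper one. There are fewer such columns than points in the set.
    collision : {ρ : Map n} → Inj ρ → r ∙ ρ ≡ r →
      ∃₂ λ y z → y ≢ z × InY y × InY z × lookup (c ∙ ρ) y ≡ lookup (c ∙ ρ) z
    collision {ρ} p e with collision? (c ∙ ρ)
    ... | yes found = found
    ... | no none = ⊥-elim (ℕP.<⇒≱ crowded (count-≤ ℕ._≟_ inY? (λ z → lookup r z ℕ.≟ i) (lookup (c ∙ ρ)) (lookup c)
            (Unique.allFin⁺ n) inj partner))
      where
      inj : ∀ {y z} → InY y → InY z → lookup (c ∙ ρ) y ≡ lookup (c ∙ ρ) z → y ≡ z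
      inj {y} {z} a b eq with y FinP.≟ z
      ... | yes y≡z = y≡z
      ... | no ne = ⊥-elim (none (y , z , ne , a , b , eq))
      rρ : ∀ y → lookup r (lookup ρ y) ≡ lookup r y
      rρ y = trans (sym (lookup-∙ r ρ y)) (≡-lookup e y)
      partner : ∀ {y} → InY y → ∃ λ z → z ∈ Fn × lookup r z ≡ i × lookup (c ∙ ρ) y ≡ lookup c z
      partner {y} (inj₁ (a , _)) = lookup ρ y , ∈P.∈-allFin _ , trans (rρ y) a , lookup-∙ c ρ y
      partner {y} (inj₂ (a , _)) = let (z , cz , rz) = up (trans (rρ y) (trans a (sym rx))) in
        z , ∈P.∈-allFin z , rz , trans (lookup-∙ c ρ y) (sym cz)

    -- The row symmetrizer is expanded into translates. In each of them some antisymmetrized column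
    -- contains two points of the Garnir set, so `Y-kill` applies.
    relation : Zero (Y (trivial n) q g)
    relation = Y-closed-stab (Y-preimage (trivial n) q zeroSubspace) (trivial n) r {Y (sign n) c u} λ {π} p e →
      kill p (collision (inv-inj p) (stab-inv p e))
      where
      kill : {π : Map n} (p : Inj π) → (∃₂ λ y z → y ≢ z × InY y × InY z × lookup (c ∙ inv p) y ≡ lookup (c ∙ inv p) z) →
        Zero (Y (trivial n) q (π ▷ Y (sign n) c u))
      kill {π} p (y , z , ne , a , b , eq) m = trans
        (Y-cong (trivial n) q (Y-translate (sign n) p c u) m)
        (Y-kill (trivial n) (sign n) (λ ()) q (c ∙ inv p) ne (trans (q-in a) (sym (q-in b))) eq (π ▷ u) m)

    module _ (h : Vec ℕ n) (weak : RowWeak r c h) (bad : lookup h x′ ≤ lookup h x)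
      (ih : ∀ {σ} → Inj σ → moment r h < moment r (h ∙ σ) → g (h ∙ σ) ≡ 0ℚ) where

      β : ℕ
      β = lookup h x

      upper-≥ : ∀ {z} → lookup r z ≡ i → j ≤ lookup c z → β ≤ lookup h z
      upper-≥ {z} a b with ℕP.m≤n⇒m<n∨m≡n b
      ... | inj₁ l = weak x z (sym a) l
      ... | inj₂ e = ℕP.≤-reflexive (cong (lookup h) (separated (sym a) e))

      lower-≤ : ∀ {z} → lookup r z ≡ lookup r x′ → lookup c z ≤ j → lookup h z ≤ β
      lower-≤ {z} a b with ℕP.m≤n⇒m<n∨m≡n b
      ... | inj₁ l = ℕP.≤-trans (weak z x′ a (subst (lookup c z <_) cx l)) bad
      ... | inj₂ e = ℕP.≤-trans (ℕP.≤-reflexive (cong (lookup h) (separated a (trans e cx)))) bad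

      Side : Map n → Fin n → Set
      Side σ z = (lookup r (lookup σ z) ≤ lookup r z × β ≤ lookup h (lookup σ z)) ⊎
                 (lookup r z ≤ lookup r (lookup σ z) × lookup h (lookup σ z) ≤ β)

      same-row : ∀ σ z → lookup r (lookup σ z) ≡ lookup r z → Side σ z
      same-row σ z e with ℕP.≤-total β (lookup h (lookup σ z))
      ... | inj₁ l = inj₁ (ℕP.≤-reflexive e , l)
      ... | inj₂ l = inj₂ (ℕP.≤-reflexive (sym e) , l)

      i≤1+i : i ≤ lookup r x′
      i≤1+i = subst (i ≤_) rx (ℕP.n≤1+n i)

      side : ∀ σ → q ∙ σ ≡ q → ∀ z → Side σ z
      side σ e z = go (inY? z) (inY? (lookup σ z))
        where
        qσ : lookup q (lookup σ z) ≡ lookup q z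
        qσ = trans (sym (lookup-∙ q σ z)) (≡-lookup e z)
        go : Dec (InY z) → Dec (InY (lookup σ z)) → Side σ z
        go (yes (inj₁ (a , _))) (yes (inj₁ (b , _))) = same-row σ z (trans b (sym a))
        go (yes (inj₂ (a , _))) (yes (inj₂ (b , _))) = same-row σ z (trans b (sym a))
        go (yes (inj₁ (a , _))) (yes (inj₂ (b , l))) = inj₂ (subst₂ _≤_ (sym a) (sym b) i≤1+i , lower-≤ b l)
        go (yes (inj₂ (a , _))) (yes (inj₁ (b , l))) = inj₁ (subst₂ _≤_ (sym b) (sym a) i≤1+i , upper-≥ b l)
        go (yes a) (no b) = ⊥-elim (ℕP.<-irrefl (trans (sym (q-out b)) (trans qσ (q-in a))) (FinP.toℕ<n (lookup σ z)))
        go (no a) (yes b) = ⊥-elim (ℕP.<-irrefl (trans (sym (q-out a)) (trans (sym qσ) (q-in b))) (FinP.toℕ<n z))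
        go (no a) (no b) = same-row σ z (cong (lookup r) (FinP.toℕ-injective (trans (sym (q-out b)) (trans qσ (q-out a)))))

      level? : ∀ σ → Dec (q ∙ σ ≡ q × moment r (h ∙ σ) ≡ moment r h)
      level? σ = stab? q σ ×-dec (moment r (h ∙ σ) ℕ.≟ moment r h)

      -- Entries of the upper part are at least β, those of the lower part at most β, so σ cannot
      -- lower the row moment. If it raises it, the induction hypothesis gives 0; otherwise only
      -- entries β change rows, and `h ∙ σ` is a row rearrangement of `h`.
      value : ∀ {σ} → Inj σ → weight (trivial n) q σ * g (h ∙ σ) ≡ ⟦ level? σ ⟧ * g h
      value {σ} p with stab? q σ | moment r (h ∙ σ) ℕ.≟ moment r h
      ... | no _ | _ = trans (cong (_* g (h ∙ σ)) (ℚP.*-zeroˡ 1ℚ)) (trans (ℚP.*-zeroˡ (g (h ∙ σ))) (sym (ℚP.*-zeroˡ (g h))))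
      ... | yes e | no ne = trans (cong (λ t → 1ℚ * 1ℚ * t) (ih p (ℕP.≤∧≢⇒< (Exchange.moment-mono r h p β (side σ e)) (ne ∘ sym))))
              (trans (ℚP.*-zeroʳ (1ℚ * 1ℚ)) (sym (ℚP.*-zeroˡ (g h))))
      ... | yes e | yes eq = cong₂ _*_ (ℚP.*-identityˡ 1ℚ) (finish (RowEquivalence.rowEquivalent r h β p fixes))
        where
        fixes : RowEquivalence.Fixes r h β σ
        fixes z with Exchange.moment-tight r h p β (side σ e) eq z
        ... | inj₁ a = inj₁ (sym a)
        ... | inj₂ b = inj₂ b
        finish : RowEquivalence.Goal r h β σ → g (h ∙ σ) ≡ g h
        finish (ρ , pρ , rρ , hρ) = trans (cong g hρ) (g-row pρ rρ h)

      -- At `h` the Garnir relation collapses to a multiple of `g h`. Symmetrization brings no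
      -- signs, so the factor is a genuine count and contains the identity.
      vanishes : g h ≡ 0ℚ
      vanishes = *≡0⇒ (∑-⟦⟧≢0 (allPerms n) level? (∈-allPerms id-inj) (∙-id q , cong (moment r) (∙-id h)))
        (trans (∑-*ʳ (allPerms n) (g h) _) (trans (sym (∑.fold-cong (allPerms n) (λ p → value (allPerms-inj p)))) (relation h)))

  rowViolation? : ∀ h → Dec (∃₂ λ x y → lookup r x ≡ lookup r y × lookup c x < lookup c y × lookup h y < lookup h x)
  rowViolation? h = FinP.any? λ x → FinP.any? λ y →
    (lookup r x ℕ.≟ lookup r y) ×-dec (lookup c x ℕ.<? lookup c y) ×-dec (lookup h y ℕ.<? lookup h x)

  colViolation? : ∀ h → Dec (∃₂ λ x y → lookup c x ≡ lookup c y × suc (lookup r x) ≡ lookup r y × lookup h y ≤ lookup h x)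
  colViolation? h = FinP.any? λ x → FinP.any? λ y →
    (lookup c x ℕ.≟ lookup c y) ×-dec (suc (lookup r x) ℕ.≟ lookup r y) ×-dec (lookup h y ℕ.≤? lookup h x)

  module _ (semistandard : ∀ h → RowWeak r c h → ColStrict r c h → g h ≡ 0ℚ) where

    module _ (t : ℕ) where

      -- A fixed entry sum bounds both moments, so that the induction upwards terminates.
      Filled : Set
      Filled = Σ (Vec ℕ n) (λ h → total h ≡ t)

      K₁ K₂ : ℕ
      K₁ = ∑ₙ (allFin n) (λ x → lookup r x ℕ.* t)
      K₂ = ∑ₙ (allFin n) (λ x → lookup c x ℕ.* t)

      bound : (k : Vec ℕ n) (a : Filled) → moment k (proj₁ a) ≤ ∑ₙ (allFin n) (λ x → lookup k x ℕ.* t)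
      bound k (h , e) = subst (λ t → moment k h ≤ ∑ₙ (allFin n) (λ x → lookup k x ℕ.* t)) e (moment-≤ k h)

      -- Encodes the lexicographic order on (moment r, moment c).
      measure : Filled → ℕ
      measure (h , _) = moment r h ℕ.* suc K₂ ℕ.+ moment c h

      measure-≤ : ∀ a → measure a ≤ K₁ ℕ.* suc K₂ ℕ.+ K₂
      measure-≤ a = ℕP.+-mono-≤ (ℕP.*-monoˡ-≤ (suc K₂) (bound r a)) (bound c a)

      measure-< : ∀ (a b : Filled) → moment r (proj₁ a) < moment r (proj₁ b) → measure a < measure b
      measure-< a@(h , _) b@(h′ , _) l = ℕP.<-≤-trans
        (ℕP.+-monoʳ-< (moment r h ℕ.* suc K₂) (s≤s (bound c a)))
        (ℕP.≤-trans (ℕP.≤-reflexive (ℕP.+-comm (moment r h ℕ.* suc K₂) (suc K₂)))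
          (ℕP.≤-trans (ℕP.*-monoˡ-≤ (suc K₂) l) (ℕP.m≤m+n (moment r h′ ℕ.* suc K₂) (moment c h′))))

      step : ∀ a → (∀ b → measure a < measure b → g (proj₁ b) ≡ 0ℚ) → g (proj₁ a) ≡ 0ℚ
      step (h , e) ih with rowViolation? h
      -- Exchanging the two entries preserves `g` and the row moment but raises the column moment;
      -- `Exchange` is used with the smaller entry `h y` as threshold.
      ... | yes (x , y , rxy , cxy , hyx) = trans (sym (g-row (tr-inj x y) (∙-tr r x y rxy) h))
              (ih (h ∙ tr x y , trans (total-∙ (tr-inj x y) h) e)
                (ℕP.+-mono-≤-< (ℕP.*-monoˡ-≤ (suc K₂) (ℕP.≤-reflexive
                    (trans (sym (moment-∙ (tr-inj x y) r h)) (cong (λ k → moment k (h ∙ tr x y)) (∙-tr r x y rxy)))))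
                  (Exchange.moment-strict c h (tr-inj x y) (lookup h y) side y
                    (λ eq → ℕP.<-irrefl (sym (trans eq (cong (lookup c) ty))) cxy)
                    (λ eq → ℕP.<-irrefl (sym (trans (cong (lookup h) (sym ty)) eq)) hyx))))
        where
        ty : lookup (tr x y) y ≡ x
        ty = trans (lookup-tr x y y) (trf-y x y)
        side : ∀ z → (lookup c (lookup (tr x y) z) ≤ lookup c z × lookup h y ≤ lookup h (lookup (tr x y) z)) ⊎
                     (lookup c z ≤ lookup c (lookup (tr x y) z) × lookup h (lookup (tr x y) z) ≤ lookup h y)
        side z = subst (λ w → (lookup c w ≤ lookup c z × lookup h y ≤ lookup h w) ⊎ (lookup c z ≤ lookup c w × lookup h w ≤ lookup h y))
          (sym (lookup-tr x y z)) (trf-elim x y z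
            (λ w → (lookup c w ≤ lookup c z × lookup h y ≤ lookup h w) ⊎ (lookup c z ≤ lookup c w × lookup h w ≤ lookup h y))
            (λ z≡x → inj₂ (ℕP.≤-trans (ℕP.≤-reflexive (cong (lookup c) z≡x)) (ℕP.<⇒≤ cxy) , ℕP.≤-refl))
            (λ z≡y → inj₁ (ℕP.≤-trans (ℕP.<⇒≤ cxy) (ℕP.≤-reflexive (cong (lookup c) (sym z≡y))) , ℕP.<⇒≤ hyx))
            (λ _ _ → rest z))
          where
          rest : ∀ z → (lookup c z ≤ lookup c z × lookup h y ≤ lookup h z) ⊎ (lookup c z ≤ lookup c z × lookup h z ≤ lookup h y)
          rest z with ℕP.≤-total (lookup h y) (lookup h z)
          ... | inj₁ l = inj₁ (ℕP.≤-refl , l)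
          ... | inj₂ l = inj₂ (ℕP.≤-refl , l)
      ... | no noRow with colViolation? h
      ... | yes (x , x′ , cx , rx , bad) = Garnir.vanishes x x′ cx rx h weak bad
              (λ {σ} p l → ih (h ∙ σ , trans (total-∙ p h) e) (measure-< (h , e) (h ∙ σ , trans (total-∙ p h) e) l))
        where
        weak : RowWeak r c h
        weak x y a b = ℕP.≮⇒≥ (λ l → noRow (x , y , a , b , l))
      ... | no noCol = semistandard h (λ x y a b → ℕP.≮⇒≥ (λ l → noRow (x , y , a , b , l)))
              (λ x y a b → ℕP.≰⇒> (λ l → noCol (x , y , a , b , l)))

      vanish-total : ∀ a → g (proj₁ a) ≡ 0ℚ
      vanish-total = descend measure (K₁ ℕ.* suc K₂ ℕ.+ K₂) measure-≤ step

    straighten : Zero g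
    straighten h = vanish-total (total h) (h , refl)

-- Inner product on exponent vectors with entries at most d

preimage : (j : Fin n) {R : Fin n → Set} → Dec (∃ R) → Fin n
preimage j (yes (i , _)) = i
preimage j (no _) = j

preimage-correct : (j : Fin n) {R : Fin n → Set} (d : Dec (∃ R)) → ∃ R → R (preimage j d)
preimage-correct j (yes (_ , h)) _ = h
preimage-correct j (no none) h = ⊥-elim (none h)

-- A total inverse, so that sums over allPerms can be reindexed by it.
inverse : Map n → Map n
inverse σ = tabulate (λ j → preimage j (FinP.any? (λ i → lookup σ i FinP.≟ j)))

inverse-correct : {σ : Map n} (p : Inj σ) → inverse σ ≡ inv p
inverse-correct {n} {σ} p = ∙-cancelˡ p (trans (vec-ext λ j → trans (lookup-∙ σ (inverse σ) j)
  (trans (cong (lookup σ) (VecP.lookup∘tabulate _ j))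
    (trans (preimage-correct j (FinP.any? (λ i → lookup σ i FinP.≟ j)) (inj-surjective p j)) (sym (lookup-id j))))) (sym (∙-inv p)))

∑-inverse : (φ : Map n → ℚ) → ∑ (allPerms n) (φ ∘ inverse) ≡ ∑ (allPerms n) φ
∑-inverse {n} φ = trans (sym (∑.fold-map (allPerms n) inverse φ))
  (∑.fold-↭ φ (map-↭-self (allPerms-unique n) into inj))
  where
  into : ∀ {σ} → σ ∈ allPerms n → inverse σ ∈ allPerms n
  into q = let p = allPerms-inj q in subst (_∈ allPerms n) (sym (inverse-correct p)) (∈-allPerms (inv-inj p))
  inj : ∀ {σ τ} → σ ∈ allPerms n → τ ∈ allPerms n → inverse σ ≡ inverse τ → σ ≡ τ
  inj {σ} {τ} a b e = ∙-cancelʳ (inv-inj p) (trans (∙-inv p) (trans (sym (∙-inv q)) (cong (τ ∙_) (sym e′))))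
    where
    p = allPerms-inj a
    q = allPerms-inj b
    e′ : inv p ≡ inv q
    e′ = trans (sym (inverse-correct p)) (trans e (inverse-correct q))

-- This box is finite, stable under permutations, and contains every monomial of degree `d`.
monomials : ∀ n → ℕ → List (Mon n)
monomials n d = map (Vec.map toℕ) (allVecs {suc d} n)

∈-monomials : (d : ℕ) (m : Mon n) → (∀ i → lookup m i ≤ d) → m ∈ monomials n d
∈-monomials {n} d m h = subst (_∈ monomials n d) w≡m (∈P.∈-map⁺ (Vec.map toℕ) (allVecs-complete w))
  where
  w : Vec (Fin (suc d)) n
  w = tabulate (λ i → Fin.fromℕ< (s≤s (h i)))
  w≡m : Vec.map toℕ w ≡ m
  w≡m = vec-ext λ i → trans (VecP.lookup-map i toℕ w)
    (trans (cong toℕ (VecP.lookup∘tabulate (λ i → Fin.fromℕ< (s≤s (h i))) i)) (FinP.toℕ-fromℕ< (s≤s (h i))))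

monomials-≤ : (d : ℕ) {m : Mon n} → m ∈ monomials n d → ∀ i → lookup m i ≤ d
monomials-≤ d p i with w , _ , refl ← ∈P.∈-map⁻ (Vec.map toℕ) p =
  subst (_≤ d) (sym (VecP.lookup-map i toℕ w)) (ℕ.s≤s⁻¹ (FinP.toℕ<n (lookup w i)))

monomials-unique : ∀ n d → Unique (monomials n d)
monomials-unique n d = Unique.map⁺ (λ {v} {w} e → vec-ext λ i → FinP.toℕ-injective
  (trans (sym (VecP.lookup-map i toℕ v)) (trans (≡-lookup e i) (VecP.lookup-map i toℕ w)))) (allVecs-unique n)

∑-monomials : (d : ℕ) {π : Map n} → Inj π → (φ : Mon n → ℚ) → ∑ (monomials n d) (λ m → φ (m ∙ π)) ≡ ∑ (monomials n d) φ
∑-monomials {n} d {π} p φ = trans (sym (∑.fold-map (monomials n d) (_∙ π) φ))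
  (∑.fold-↭ φ (map-↭-self (monomials-unique n d)
    (λ {m} q → ∈-monomials d (m ∙ π) (λ i → subst (_≤ d) (sym (lookup-∙ m π i)) (monomials-≤ d q (lookup π i))))
    (λ _ _ → ∙-cancelʳ p)))

module Inner (n d : ℕ) where

  S : List (Mon n)
  S = monomials n d

  ⟨_,_⟩ : V n → V n → ℚ
  ⟨ f , g ⟩ = ∑ S (λ m → f m * g m)

  inner-sym : ∀ f g → ⟨ f , g ⟩ ≡ ⟨ g , f ⟩
  inner-sym f g = ∑.fold-≗ S (λ m → ℚP.*-comm (f m) (g m))

  inner-cong : ∀ {f f′ g g′} → f ≗ f′ → g ≗ g′ → ⟨ f , g ⟩ ≡ ⟨ f′ , g′ ⟩
  inner-cong a b = ∑.fold-≗ S (λ m → cong₂ _*_ (a m) (b m))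

  inner-zeroʳ : ∀ f {g} → Zero g → ⟨ f , g ⟩ ≡ 0ℚ
  inner-zeroʳ f h = ∑.fold-ε S (λ {m} _ → trans (cong (f m *_) (h m)) (ℚP.*-zeroʳ (f m)))

  inner-lin : ∀ c f f′ g → ⟨ (λ m → c * f m + f′ m) , g ⟩ ≡ c * ⟨ f , g ⟩ + ⟨ f′ , g ⟩
  inner-lin c f f′ g = trans (∑.fold-≗ S (λ m → expand c (f m) (f′ m) (g m)))
    (trans (∑.fold-• S _ _) (cong (_+ ⟨ f′ , g ⟩) (sym (∑-*ˡ S c _))))
    where
    expand : ∀ c a b x → (c * a + b) * x ≡ c * (a * x) + b * x
    expand = Solver.solve-∀ ℚring

  orthogonal : (g : V n) → Subspace (λ f → ⟨ f , g ⟩ ≡ 0ℚ)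
  orthogonal g .resp e h = trans (sym (inner-cong e (λ _ → refl))) h
  orthogonal g .zeroᵥ = ∑.fold-ε S (λ {m} _ → ℚP.*-zeroˡ (g m))
  orthogonal g .lin {f} {f′} c h k = trans (inner-lin c f f′ g)
    (trans (cong₂ (λ a b → c * a + b) h k) (trans (ℚP.+-identityʳ (c * 0ℚ)) (ℚP.*-zeroʳ c)))

  inner-▷ : {π : Map n} (p : Inj π) (f g : V n) → ⟨ π ▷ f , g ⟩ ≡ ⟨ f , inv p ▷ g ⟩
  inner-▷ {π} p f g = trans (∑.fold-≗ S (λ m → cong (λ z → f (m ∙ π) * g z) (sym (∙-inv-cancel m p))))
    (∑-monomials d p (λ m → f m * g (m ∙ inv p)))

  -- Permutations act by isometries, so the adjoint of σ is its inverse, which lies in the same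
  -- stabilizer and has the same character value.
  Y-adjoint : (X : Character n) (r : Vec ℕ n) (f g : V n) → ⟨ Y X r f , g ⟩ ≡ ⟨ f , Y X r g ⟩
  Y-adjoint X r f g = begin
    ∑ S (λ m → ∑ Pn (λ σ → w σ * f (m ∙ σ)) * g m)
      ≡⟨ ∑.fold-≗ S (λ m → trans (∑-*ʳ Pn (g m) _) (∑.fold-≗ Pn (λ σ → ℚP.*-assoc (w σ) (f (m ∙ σ)) (g m)))) ⟩
    ∑ S (λ m → ∑ Pn (λ σ → w σ * (f (m ∙ σ) * g m)))
      ≡⟨ ∑.fold-swap S Pn _ ⟩
    ∑ Pn (λ σ → ∑ S (λ m → w σ * (f (m ∙ σ) * g m)))
      ≡⟨ ∑.fold-≗ Pn (λ σ → sym (∑-*ˡ S (w σ) _)) ⟩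
    ∑ Pn (λ σ → w σ * ⟨ σ ▷ f , g ⟩)
      ≡⟨ ∑.fold-cong Pn (λ q → flip (allPerms-inj q)) ⟩
    ∑ Pn (λ σ → w (inverse σ) * ⟨ f , inverse σ ▷ g ⟩)
      ≡⟨ ∑-inverse (λ σ → w σ * ⟨ f , σ ▷ g ⟩) ⟩
    ∑ Pn (λ σ → w σ * ⟨ f , σ ▷ g ⟩)
      ≡⟨ ∑.fold-≗ Pn (λ σ → ∑-*ˡ S (w σ) _) ⟩
    ∑ Pn (λ σ → ∑ S (λ m → w σ * (f m * g (m ∙ σ))))
      ≡⟨ ∑.fold-swap Pn S _ ⟩
    ∑ S (λ m → ∑ Pn (λ σ → w σ * (f m * g (m ∙ σ))))
      ≡⟨ ∑.fold-≗ S (λ m → trans (∑.fold-≗ Pn (λ σ → left-comm (w σ) (f m) (g (m ∙ σ)))) (sym (∑-*ˡ Pn (f m) _))) ⟩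
    ⟨ f , Y X r g ⟩ ∎
    where
    open ≡-Reasoning
    Pn = allPerms n
    w = weight X r
    left-comm : ∀ a b c → a * (b * c) ≡ b * (a * c)
    left-comm = Solver.solve-∀ ℚring
    flip : ∀ {σ} → Inj σ → w σ * ⟨ σ ▷ f , g ⟩ ≡ w (inverse σ) * ⟨ f , inverse σ ▷ g ⟩
    flip {σ} p = trans
      (cong₂ _*_ (cong₂ _*_ (⟦⟧-cong (stab? r σ) (stab? r (inv p)) (stab-inv p)
          (λ e → trans (cong (_∙ σ) (sym e)) (∙-cancel-inv r p))) (sym (χ-inv X p))) (inner-▷ p f g))
      (cong (λ t → w t * ⟨ f , t ▷ g ⟩) (sym (inverse-correct p)))

  -- As a disjunction at each exponent, the support condition passes to linear combinations by a
  -- case distinction.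
  On : (Mon n → Set) → V n → Set
  On R f = ∀ m → f m ≡ 0ℚ ⊎ R m

  Supported : V n → Set
  Supported = On (_∈ S)

  definite : ∀ {f} → Supported f → ⟨ f , f ⟩ ≡ 0ℚ → Zero f
  definite {f} sup e m with sup m
  ... | inj₁ z = z
  ... | inj₂ m∈ = ∑-square≡0 S f e m∈

  on-subspace : (R : Mon n → Set) → Subspace (On R)
  on-subspace R .resp e h m with h m
  ... | inj₁ z = inj₁ (trans (sym (e m)) z)
  ... | inj₂ q = inj₂ q
  on-subspace R .zeroᵥ m = inj₁ refl
  on-subspace R .lin c h k m with h m | k m
  ... | inj₂ q | _ = inj₂ q
  ... | inj₁ _ | inj₂ q = inj₂ q
  ... | inj₁ a | inj₁ b = inj₁ (trans (cong₂ (λ a b → c * a + b) a b) (trans (ℚP.+-identityʳ (c * 0ℚ)) (ℚP.*-zeroʳ c)))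

  supported-▷ : ∀ {f} → Supported f → ∀ {π} → Inj π → Supported (π ▷ f)
  supported-▷ sup {π} p m with sup (m ∙ π)
  ... | inj₁ z = inj₁ z
  ... | inj₂ q = inj₂ (∈-monomials d m (λ i → let (j , e) = inj-surjective p i in
          subst (_≤ d) (trans (lookup-∙ m π j) (cong (lookup m) e)) (monomials-≤ d q j)))

  -- ‖a b v‖² = |R| ⟨v , b a b v⟩ for the symmetrizers a, b.
  flip-zero : (X X′ : Character n) (r k : Vec ℕ n) {v : V n} → Supported v →
    (∀ {π} → Inj π → Zero (Y X′ k (Y X r (π ▷ v)))) → Zero (Y X r (Y X′ k v))
  flip-zero X X′ r k {v} sup h = definite {Y X r (Y X′ k v)} sup-w (begin
    ⟨ Y X r b , Y X r b ⟩              ≡⟨ Y-adjoint X r b (Y X r b) ⟩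
    ⟨ b , Y X r (Y X r b) ⟩            ≡⟨ inner-cong {f = b} {f′ = b} {g = Y X r (Y X r b)} {g′ = λ m → order r * Y X r b m} (λ _ → refl)
                                            (Y-scale X r (Y-semiInvariant X r b)) ⟩
    ⟨ b , (λ m → order r * Y X r b m) ⟩  ≡⟨ inner-sym b _ ⟩
    ⟨ (λ m → order r * Y X r b m) , b ⟩  ≡⟨ inner-cong {g = b} {g′ = b} (λ m → sym (ℚP.+-identityʳ (order r * Y X r b m))) (λ _ → refl) ⟩
    ⟨ (λ m → order r * Y X r b m + 0ℚ) , b ⟩  ≡⟨ lin (orthogonal b) {Y X r b} {λ _ → 0ℚ} (order r) inner-zero (zeroᵥ (orthogonal b)) ⟩
    0ℚ ∎)
    where
    open ≡-Reasoning
    b : V n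
    b = Y X′ k v
    -- Moving one antisymmetrizer across gives b a b v paired with `v`, and expanding the inner b
    -- turns b a b v into a combination of the b a (π v), which vanish by hypothesis.
    inner-zero : ⟨ Y X r b , b ⟩ ≡ 0ℚ
    inner-zero = trans (sym (Y-adjoint X′ k (Y X r b) v)) (trans (inner-sym (Y X′ k (Y X r b)) v)
      (inner-zeroʳ v (Y-closed (Y-preimage X r (Y-preimage X′ k zeroSubspace)) X′ k {v} h)))
    sup-w : Supported (Y X r b)
    sup-w = Y-closed (on-subspace (_∈ S)) X r {b} (▷Y-closed (on-subspace (_∈ S)) X′ k {v} (supported-▷ {v} sup))

  module _ {A : Set} (vec : A → V n) where

    combination : List (ℚ × A) → V n
    combination cs m = ∑ cs (λ ca → proj₁ ca * vec (proj₂ ca) m)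

    residual : V n → List (ℚ × A) → V n
    residual p cs m = -1ℚ * combination cs m + p m

    ⊥-combination : ∀ {x L} → (∀ {a} → a ∈ L → ⟨ vec a , x ⟩ ≡ 0ℚ) →
      ∀ {cs} → All (λ ca → proj₂ ca ∈ L) cs → ⟨ combination cs , x ⟩ ≡ 0ℚ
    ⊥-combination {x} h {cs} all = ∑-closed (orthogonal x) cs proj₁ (vec ∘ proj₂) (λ q → h (All.lookup all q))

    scale : ℚ → List (ℚ × A) → List (ℚ × A)
    scale t = map (λ ca → t * proj₁ ca , proj₂ ca)

    combination-scale : ∀ t cs m → combination (scale t cs) m ≡ t * combination cs m
    combination-scale t cs m = trans (∑.fold-map cs _ _)
      (trans (∑.fold-≗ cs (λ ca → ℚP.*-assoc t (proj₁ ca) (vec (proj₂ ca) m))) (sym (∑-*ˡ cs t _)))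

    -- If `w` has norm zero it vanishes on the box and 0 serves as quotient; so Gram-Schmidt may run
    -- over linearly dependent vectors.
    quotient : (p w : V n) → ∃ λ t → ⟨ w , p ⟩ ≡ t * ⟨ w , w ⟩
    quotient p w with ⟨ w , w ⟩ ℚ.≟ 0ℚ
    ... | yes z = 0ℚ , trans (∑.fold-ε S (λ {m} q → trans (cong (_* p m) (∑-square≡0 S w z q)) (ℚP.*-zeroˡ (p m))))
                        (sym (ℚP.*-zeroˡ ⟨ w , w ⟩))
    ... | no nz = ⟨ w , p ⟩ * ℚ.1/ ⟨ w , w ⟩ , sym (trans (ℚP.*-assoc ⟨ w , p ⟩ _ _)
            (trans (cong (⟨ w , p ⟩ *_) (ℚP.*-inverseˡ ⟨ w , w ⟩)) (ℚP.*-identityʳ ⟨ w , p ⟩)))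
      where instance _ = ℚ.≢-nonZero nz

    Projection : List A → V n → Set
    Projection L p = Σ (List (ℚ × A)) λ cs → All (λ ca → proj₂ ca ∈ L) cs × (∀ {a} → a ∈ L → ⟨ vec a , residual p cs ⟩ ≡ 0ℚ)

    -- Gram–Schmidt
    project : (L : List A) (p : V n) → Projection L p
    project [] p = [] , [] , λ ()
    project (a ∷ L) p = extend (project L (vec a)) (project L p)
      where
      extend : Projection L (vec a) → Projection L p → Projection (a ∷ L) p
      extend (cs₀ , in₀ , ⊥₀) (cs₁ , in₁ , ⊥₁) =
        cs , (here refl ∷ AllP.++⁺ (AllP.map⁺ (All.map there in₀)) (All.map there in₁)) , ortho
        where
        w p₀ p′ : V n
        w = residual (vec a) cs₀
        p₀ = residual p cs₁
        t : ℚ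
        t = proj₁ (quotient p₀ w)
        cs : List (ℚ × A)
        -- Since `w` is `vec a` minus the combination `cs₀`, adding `t` times `w` to the
        -- approximation `cs₁` costs the coefficient `t` at `a` and `- t` throughout `cs₀`.
        cs = (t , a) ∷ scale (- t) cs₀ ++ cs₁
        p′ = residual p cs
        p′-eq : p′ ≗ (λ m → (- t) * w m + p₀ m)
        p′-eq m = trans (cong (λ z → -1ℚ * (t * vec a m + z) + p m)
            (trans (∑.fold-++ (scale (- t) cs₀) cs₁ _) (cong (_+ combination cs₁ m) (combination-scale (- t) cs₀ m))))
          (regroup t (vec a m) (combination cs₀ m) (combination cs₁ m) (p m))
          where
          regroup : ∀ t v x y p → -1ℚ * (t * v + ((- t) * x + y)) + p ≡ (- t) * (-1ℚ * x + v) + (-1ℚ * y + p)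
          regroup = Solver.solve-∀ ℚring
        inner-p′ : ∀ g → ⟨ g , p′ ⟩ ≡ (- t) * ⟨ g , w ⟩ + ⟨ g , p₀ ⟩
        inner-p′ g = trans (inner-sym g p′) (trans (inner-cong {g = g} {g′ = g} p′-eq (λ _ → refl))
          (trans (inner-lin (- t) w p₀ g) (cong₂ (λ a b → (- t) * a + b) (inner-sym w g) (inner-sym p₀ g))))
        ortho-L : ∀ {b} → b ∈ L → ⟨ vec b , p′ ⟩ ≡ 0ℚ
        ortho-L {b} q = trans (inner-p′ (vec b)) (trans (cong₂ (λ x y → (- t) * x + y) (⊥₀ q) (⊥₁ q))
          (trans (ℚP.+-identityʳ ((- t) * 0ℚ)) (ℚP.*-zeroʳ (- t))))
        ortho-w : ⟨ w , p′ ⟩ ≡ 0ℚ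
        ortho-w = trans (inner-p′ w) (trans (cong ((- t) * ⟨ w , w ⟩ +_) (proj₂ (quotient p₀ w))) (cancel-out t ⟨ w , w ⟩))
          where
          cancel-out : ∀ t x → (- t) * x + t * x ≡ 0ℚ
          cancel-out = Solver.solve-∀ ℚring
        ortho : ∀ {b} → b ∈ a ∷ L → ⟨ vec b , p′ ⟩ ≡ 0ℚ
        ortho (there q) = ortho-L q
        ortho (here refl) = trans (inner-cong {f = vec a} {f′ = λ m → 1ℚ * combination cs₀ m + w m} {g = p′} {g′ = p′} (λ m → split (combination cs₀ m) (vec a m)) (λ _ → refl))
          (lin (orthogonal p′) {combination cs₀} {w} 1ℚ (⊥-combination ortho-L in₀) ortho-w)
          where
          split : ∀ x v → v ≡ 1ℚ * x + (-1ℚ * x + v)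
          split = Solver.solve-∀ ℚring

-- Comparison of two tableaux

below? : (c k : Vec ℕ n) (y x : Fin n) → Dec (lookup c x ≡ lookup c y × lookup k x < lookup k y)
below? c k y x = (lookup c x ℕ.≟ lookup c y) ×-dec (lookup k x ℕ.<? lookup k y)

-- The row that `y` would occupy if its column were sorted by `k`.
depth : (c k : Vec ℕ n) → Fin n → ℕ
depth {n} c k y = ∑ₙ (allFin n) (λ x → ⟦ below? c k y x ⟧ₙ)

∑ₙ-upTo : ∀ a → ∑ₙ (upTo a) (λ _ → ⟦ yes tt ⟧ₙ) ≡ a
∑ₙ-upTo a = trans (∑ₙ-ones (upTo a)) (ListP.length-upTo a)

depth-≤ : (c k : Vec ℕ n) → Separated k c → ∀ y → depth c k y ≤ lookup k y
depth-≤ {n} c k sep y = ℕP.≤-trans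
  (count-≤ {ys = upTo (lookup k y)} ℕ._≟_ (below? c k y) {S = λ _ → ⊤} (λ _ → yes tt) (lookup k) id (Unique.allFin⁺ n)
    (λ (a , _) (b , _) e → sep e (trans a (sym b)))
    (λ {x} (_ , l) → lookup k x , ∈P.∈-upTo⁺ l , tt , refl))
  (ℕP.≤-reflexive (∑ₙ-upTo (lookup k y)))

module _ {r c : Vec ℕ n} (tab : Tableau r c) where
  open Tableau tab

  transpose : Tableau c r
  transpose = record { separated = λ a b → separated b a ; left = up ; up = left }

  climb : ∀ {x i} → i ≤ lookup r x → ∃ λ y → lookup c y ≡ lookup c x × lookup r y ≡ i
  climb {x} {i} l = ToList.up* r c tab i (lookup r x ∸ i) x refl (sym (ℕP.m+[n∸m]≡n l))

  depth-row : ∀ y → depth c r y ≡ lookup r y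
  depth-row y = ℕP.≤-antisym (depth-≤ c r separated y) (ℕP.≤-trans (ℕP.≤-reflexive (sym (∑ₙ-upTo (lookup r y))))
    (ℕP.≤-trans (∑ₙ-mono (upTo (lookup r y)) (λ {i} p → ℕP.≤-reflexive (sym (⟦⟧ₙ-yes (i ℕ.<? lookup r y) (∈P.∈-upTo⁻ p)))))
      (count-≤ {xs = upTo (lookup r y)} {ys = allFin n} ℕ._≟_ {R = λ i → i < lookup r y} (λ i → i ℕ.<? lookup r y) (below? c r y) id (lookup r)
        (Unique.upTo⁺ (lookup r y)) (λ _ _ e → e)
        (λ {i} l → let (x , cx , rx) = climb (ℕP.<⇒≤ l) in x , ∈P.∈-allFin x , (cx , subst (_< lookup r y) (sym rx) l) , sym rx))))

  Tableau-∙ : {π : Map n} → Inj π → Tableau (r ∙ π) (c ∙ π)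
  Tableau-∙ {π} p = record
    { separated = λ {x} {y} a b → cancel p (separated
        (trans (sym (lookup-∙ r π x)) (trans a (lookup-∙ r π y))) (trans (sym (lookup-∙ c π x)) (trans b (lookup-∙ c π y))))
    ; left = λ {x} e → let (y , ry , cy) = left (trans (sym (lookup-∙ c π x)) e)
                           (z , πz) = inj-surjective p y
                       in z , trans (lookup-∙ r π z) (trans (cong (lookup r) πz) (trans ry (sym (lookup-∙ r π x)))) ,
                          trans (lookup-∙ c π z) (trans (cong (lookup c) πz) cy)
    ; up = λ {x} e → let (y , cy , ry) = up (trans (sym (lookup-∙ r π x)) e)
                         (z , πz) = inj-surjective p y
                     in z , trans (lookup-∙ c π z) (trans (cong (lookup c) πz) (trans cy (sym (lookup-∙ c π x)))) ,
                        trans (lookup-∙ r π z) (trans (cong (lookup r) πz) ry)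
    }

-- Of two distinct points in a column exactly one precedes the other in the order of `k`. Hence the
-- total depth does not depend on `k`.
depth-meetings : (c k : Vec ℕ n) → Separated k c → ∑ₙ (allFin n) (depth c k) ℕ.+ ∑ₙ (allFin n) (depth c k) ≡ meetings c
depth-meetings {n} c k sep = trans (cong (∑ₙ² n (λ y x → ⟦ below? c k y x ⟧ₙ) ℕ.+_) (∑ₙ.fold-swap (allFin n) (allFin n) _))
  (trans (sym (∑ₙ²-+ (λ y x → ⟦ below? c k y x ⟧ₙ) (λ y x → ⟦ below? c k x y ⟧ₙ)))
    (∑ₙ.fold-≗ (allFin n) (λ y → ∑ₙ.fold-≗ (allFin n) (λ x → pointwise y x))))
  where
  pointwise : ∀ y x → ⟦ below? c k y x ⟧ₙ ℕ.+ ⟦ below? c k x y ⟧ₙ ≡ ⟦ meet? c y x ⟧ₙ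
  pointwise y x with lookup c y ℕ.≟ lookup c x
  ... | no ne = trans (cong₂ ℕ._+_ (⟦⟧ₙ-no (below? c k y x) (ne ∘ sym ∘ proj₁)) (⟦⟧ₙ-no (no ne ×-dec (lookup k y ℕ.<? lookup k x)) (ne ∘ proj₁)))
          (sym (⟦⟧ₙ-no (no ne ×-dec distinct? y x) (ne ∘ proj₁)))
  ... | yes e with ℕP.<-cmp (lookup k y) (lookup k x)
  ... | tri< a _ b = trans (cong₂ ℕ._+_ (⟦⟧ₙ-no (below? c k y x) (b ∘ proj₂)) (⟦⟧ₙ-yes (yes e ×-dec (lookup k y ℕ.<? lookup k x)) (e , a)))
          (sym (⟦⟧ₙ-yes (yes e ×-dec distinct? y x) (e , λ { refl → ℕP.<-irrefl refl a })))
  ... | tri> b _ a = trans (cong₂ ℕ._+_ (⟦⟧ₙ-yes (below? c k y x) (sym e , a)) (⟦⟧ₙ-no (yes e ×-dec (lookup k y ℕ.<? lookup k x)) (b ∘ proj₂)))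
          (sym (⟦⟧ₙ-yes (yes e ×-dec distinct? y x) (e , λ { refl → ℕP.<-irrefl refl a })))
  ... | tri≈ a eq b = trans (cong₂ ℕ._+_ (⟦⟧ₙ-no (below? c k y x) (b ∘ proj₂)) (⟦⟧ₙ-no (yes e ×-dec (lookup k y ℕ.<? lookup k x)) (a ∘ proj₂)))
          (sym (⟦⟧ₙ-no (yes e ×-dec distinct? y x) (λ (_ , ne) → ne (sep eq e))))

double-injective : ∀ {a b} → a ℕ.+ a ≡ b ℕ.+ b → a ≡ b
double-injective {a} {b} e with ℕP.<-cmp a b
... | tri< l _ _ = ⊥-elim (ℕP.<-irrefl e (ℕP.+-mono-< l l))
... | tri≈ _ e′ _ = e′
... | tri> _ _ l = ⊥-elim (ℕP.<-irrefl (sym e) (ℕP.+-mono-< l l))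

-- If no row of the labelling r meets a column of the tableau (r′ , c′) twice, then sorting the columns by r shows
-- Σ r′ ≤ Σ r, and equality means that (r′ , c′) becomes r after a column permutation.
module Compare (r : Vec ℕ n) {r′ c′ : Vec ℕ n} (tab′ : Tableau r′ c′) (sep : Separated r c′) where
  open Tableau tab′

  total-depth : total r′ ≡ ∑ₙ (allFin n) (depth c′ r)
  total-depth = trans (sym (∑ₙ.fold-≗ (allFin n) (depth-row tab′)))
    (double-injective (trans (depth-meetings c′ r′ separated) (sym (depth-meetings c′ r sep))))

  total-≤ : total r′ ≤ total r
  total-≤ = ℕP.≤-trans (ℕP.≤-reflexive total-depth) (∑ₙ-mono (allFin n) (λ {y} _ → depth-≤ c′ r sep y))

  module _ (eq : total r ≡ total r′) where

    depth≡ : ∀ y → depth c′ r y ≡ lookup r y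
    depth≡ y = ∑ₙ-tight (allFin n) (λ {y} _ → depth-≤ c′ r sep y) (trans (sym total-depth) (sym eq)) (∈P.∈-allFin y)

    image? : ∀ y → Dec (∃ λ z → lookup c′ z ≡ lookup c′ y × lookup r′ z ≡ lookup r y)
    image? y = FinP.any? λ z → (lookup c′ z ℕ.≟ lookup c′ y) ×-dec (lookup r′ z ℕ.≟ lookup r y)

    column? : ∀ y x → Dec (lookup c′ x ≡ lookup c′ y)
    column? y x = lookup c′ x ℕ.≟ lookup c′ y

    column : Fin n → ℕ
    column y = ∑ₙ (allFin n) (λ x → ⟦ column? y x ⟧ₙ)

    -- Without a cell in row `r y`, the column of `y` would have at most `r y` points. But `y`
    -- together with the `r y` points that precede it makes one more.
    image : ∀ y → ∃ λ z → lookup c′ z ≡ lookup c′ y × lookup r′ z ≡ lookup r y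
    image y with image? y
    ... | yes found = found
    ... | no none = ⊥-elim (ℕP.<⇒≱ deep shallow)
      where
      short : ∀ {x} → lookup c′ x ≡ lookup c′ y → lookup r′ x < lookup r y
      short {x} cx = ℕP.≰⇒> (λ l → let (z , cz , rz) = climb tab′ l in none (z , trans cz cx , rz))
      shallow : column y ≤ lookup r y
      shallow = ℕP.≤-trans
        (count-≤ {ys = upTo (lookup r y)} ℕ._≟_ (column? y) {S = λ _ → ⊤} (λ _ → yes tt) (lookup r′) id (Unique.allFin⁺ n)
          (λ a b e → separated e (trans a (sym b)))
          (λ {x} cx → lookup r′ x , ∈P.∈-upTo⁺ (short cx) , tt , refl))
        (ℕP.≤-reflexive (∑ₙ-upTo (lookup r y)))
      deep : lookup r y < column y
      deep = subst (_< column y) (depth≡ y) (∑ₙ-mono-< (allFin n) (λ {x} _ → ⟦⟧ₙ-mono (below? c′ r y x) (column? y x) proj₁) (∈P.∈-allFin y)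
        (subst₂ _<_ (sym (⟦⟧ₙ-no (below? c′ r y y) (λ (_ , l) → ℕP.<-irrefl refl l))) (sym (⟦⟧ₙ-yes (column? y y) refl)) (s≤s z≤n)))

    σ : Map n
    σ = tabulate (proj₁ ∘ image)

    σ-at : ∀ y → lookup σ y ≡ proj₁ (image y)
    σ-at = VecP.lookup∘tabulate (proj₁ ∘ image)

    c′σ : c′ ∙ σ ≡ c′
    c′σ = vec-ext λ y → trans (lookup-∙ c′ σ y) (trans (cong (lookup c′) (σ-at y)) (proj₁ (proj₂ (image y))))

    r′σ : r′ ∙ σ ≡ r
    r′σ = vec-ext λ y → trans (lookup-∙ r′ σ y) (trans (cong (lookup r′) (σ-at y)) (proj₂ (proj₂ (image y))))

    σ-inj : Inj σ
    σ-inj .cancel {x} {y} e = sep (trans (sym (≡-lookup r′σ x)) (trans (lookup-∙ r′ σ x) (trans (cong (lookup r′) e) (trans (sym (lookup-∙ r′ σ y)) (≡-lookup r′σ y)))))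
      (trans (sym (≡-lookup c′σ x)) (trans (lookup-∙ c′ σ x) (trans (cong (lookup c′) e) (trans (sym (lookup-∙ c′ σ y)) (≡-lookup c′σ y)))))

-- The contrapositive of `Compare`: a comparison of two sums of row numbers yields a common pair,
-- where one would usually invoke the dominance order.
clash-of : (r : Vec ℕ n) {r′ c′ : Vec ℕ n} → Tableau r′ c′ → total r ≤ total r′ →
  (total r ≡ total r′ → ∀ {σ} → Inj σ → c′ ∙ σ ≡ c′ → r′ ∙ σ ≢ r) → Clash r c′
clash-of r {r′} {c′} tab′ le ne with clash? r c′
... | yes cl = cl
... | no ¬cl = ⊥-elim (ne eq (C.σ-inj eq) (C.c′σ eq) (C.r′σ eq))
  where
  module C = Compare r tab′ (¬clash⇒separated {r = r} {c′} ¬cl)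
  eq : total r ≡ total r′
  eq = ℕP.≤-antisym le C.total-≤

row-col-zero : (r c : Vec ℕ n) → Clash r c → (f : V n) → Zero (Y (trivial n) r (Y (sign n) c f))
row-col-zero {n} r c (x , y , ne , a , b) f = Y-kill (trivial n) (sign n) (λ ()) r c ne a b f

col-row-zero : (r c : Vec ℕ n) → Clash r c → (f : V n) → Zero (Y (sign n) c (Y (trivial n) r f))
col-row-zero {n} r c (x , y , ne , a , b) f = Y-kill (sign n) (trivial n) (λ ()) c r ne b a f

symmetrize : (r c : Vec ℕ n) → V n → V n
symmetrize {n} r c f = Y (sign n) c (Y (trivial n) r f)

symmetrize-translate : {π : Map n} (p : Inj π) (r c : Vec ℕ n) (f : V n) →
  π ▷ symmetrize r c f ≗ symmetrize (r ∙ inv p) (c ∙ inv p) (π ▷ f)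
symmetrize-translate {n} p r c f m = trans (Y-translate (sign n) p c (Y (trivial n) r f) m)
  (Y-cong (sign n) (c ∙ inv p) (Y-translate (trivial n) p r f) m)

symmetrize-zero : (r c : Vec ℕ n) → Subspace (λ f → Zero (symmetrize r c f))
symmetrize-zero {n} r c = Y-preimage (trivial n) r (Y-preimage (sign n) c zeroSubspace)

-- The comparison of totals decides which factors clash. Either the rows `r` clash with the
-- translated columns `c′`, or, after expanding the symmetrizers in between, the columns `c` clash
-- with every translate of the rows `r′`.
cross-zero : {r c r′ c′ : Vec ℕ n} → Tableau r c → Tableau r′ c′ → (∀ {π} → Inj π → r′ ∙ π ≢ r) →
  (f : V n) → ∀ {π} → Inj π → Zero (symmetrize r c (π ▷ symmetrize r′ c′ f))
cross-zero {n} {r} {c} {r′} {c′} tab tab′ ne f {π} p with ℕP.≤-total (total r) (total r′)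
... | inj₁ le = resp (symmetrize-zero r c) (λ m → sym (symmetrize-translate p r′ c′ f m))
      (Y-zero (sign n) c (row-col-zero r (c′ ∙ inv p)
        (clash-of r (Tableau-∙ tab′ (inv-inj p)) (ℕP.≤-trans le (ℕP.≤-reflexive (sym (total-∙ (inv-inj p) r′))))
          (λ _ {σ} s _ e → ne (∙-inj (inv-inj p) s) (trans (∙-assoc r′ (inv p) σ) e)))
        (Y (trivial n) (r′ ∙ inv p) (π ▷ f))))
... | inj₂ le = Y-closed S (trivial n) r {π ▷ symmetrize r′ c′ f} (λ {ρ} q →
        ▷-∙ S {symmetrize r′ c′ f} ρ π (▷Y-closed S (sign n) c′ {Y (trivial n) r′ f} inner (∙-inj q p)))
      where
      S : Subspace (λ h → Zero (Y (sign n) c h))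
      S = Y-preimage (sign n) c zeroSubspace
      inner : ∀ {ρ} → Inj ρ → Zero (Y (sign n) c (ρ ▷ Y (trivial n) r′ f))
      inner {ρ} q = resp S (λ m → sym (Y-translate (trivial n) q r′ f m))
        (col-row-zero (r′ ∙ inv q) c (clash-of (r′ ∙ inv q) tab
          (ℕP.≤-trans (ℕP.≤-reflexive (total-∙ (inv-inj q) r′)) le)
          (λ _ {σ} s _ e → ne (∙-inj (inv-inj q) (inv-inj s))
            (trans (∙-assoc r′ (inv q) (inv s)) (trans (cong (_∙ inv s) (sym e)) (∙-inv-cancel r s)))))
          (ρ ▷ f))

-- b h a = κ b a for the symmetrizers a, b of a tableau and any permutation h.
Multiple : V n → V n → Set
Multiple B h = ∃ λ κ → ∀ m → h m ≡ κ * B m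

multiple-subspace : (B : V n) → Subspace (Multiple B)
multiple-subspace B .resp e (κ , h) = κ , λ m → trans (sym (e m)) (h m)
multiple-subspace B .zeroᵥ = 0ℚ , λ m → sym (ℚP.*-zeroˡ (B m))
multiple-subspace B .lin c (κ , h) (κ′ , h′) = c * κ + κ′ , λ m →
  trans (cong₂ (λ a b → c * a + b) (h m) (h′ m)) (collect c κ κ′ (B m))
  where
  collect : ∀ c a b x → c * (a * x) + b * x ≡ (c * a + b) * x
  collect = Solver.solve-∀ ℚring

module _ {r c : Vec ℕ n} (tab : Tableau r c) (f : V n) where
  open Tableau tab

  private
    φ : V n
    φ = Y (trivial n) r f
    D : V n → Set
    D h = Multiple (symmetrize r c f) (Y (sign n) c h)
    D-subspace : Subspace D
    D-subspace = Y-preimage (sign n) c (multiple-subspace (symmetrize r c f))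

  -- If no translated row meets a column twice, `Compare` factors π into the column permutation
  -- `inv s` and the row permutation `s ∙ π`. The former is absorbed as a sign, the latter acts
  -- trivially. Otherwise the product is zero.
  translate-multiple : ∀ {π} → Inj π → D (π ▷ φ)
  translate-multiple {π} p with clash? (r ∙ inv p) c
  ... | yes cl = 0ℚ , λ m → trans (Y-cong (sign n) c (Y-translate (trivial n) p r f) m)
          (trans (col-row-zero (r ∙ inv p) c cl (π ▷ f) m) (sym (ℚP.*-zeroˡ (symmetrize r c f m))))
  ... | no ¬cl = χ (sign n) (inv (σ-inj eq)) , λ m → trans (Y-cong (sign n) c same m)
          (Y-absorb (sign n) (inv-inj (σ-inj eq)) c (stab-inv (σ-inj eq) (c′σ eq)) φ m)
    where
    open Compare (r ∙ inv p) tab (¬clash⇒separated {r = r ∙ inv p} {c} ¬cl) using (σ; σ-inj; c′σ; r′σ)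
    eq : total (r ∙ inv p) ≡ total r
    eq = total-∙ (inv-inj p) r
    s = σ eq
    σ-inj′ : Inj s
    σ-inj′ = σ-inj eq
    rρ : r ∙ (s ∙ π) ≡ r
    rρ = trans (∙-assoc r s π) (trans (cong (_∙ π) (r′σ eq)) (∙-cancel-inv r p))
    same : π ▷ φ ≗ inv (σ-inj eq) ▷ φ
    same m = trans (cong φ (trans (cong (_∙ π) (sym (∙-cancel-inv m σ-inj′))) (sym (∙-assoc (m ∙ inv σ-inj′) s π))))
      (trans (Y-semiInvariant (trivial n) r f (∙-inj σ-inj′ p) rρ (m ∙ inv σ-inj′)) (ℚP.*-identityˡ (φ (m ∙ inv σ-inj′))))

  -- The row symmetrizer of the relabelled tableau is a translate of the first one. Expanding the
  -- two symmetrizers in between leaves terms of the kind treated in `translate-multiple`.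
  symmetrize-multiple : ∀ {τ} → Inj τ → {f′ : V n} → τ ▷ f′ ≗ f → ∀ {π} → Inj π →
    Multiple (symmetrize r c f) (symmetrize r c (π ▷ symmetrize (r ∙ τ) (c ∙ τ) f′))
  symmetrize-multiple {τ} t {f′} e {π} p = Y-closed D-subspace (trivial n) r {π ▷ symmetrize (r ∙ τ) (c ∙ τ) f′} (λ {ρ} q →
    ▷-∙ D-subspace {symmetrize (r ∙ τ) (c ∙ τ) f′} ρ π
      (▷Y-closed D-subspace (sign n) (c ∙ τ) {Y (trivial n) (r ∙ τ) f′} inner (∙-inj q p)))
    where
    moved : Y (trivial n) (r ∙ τ) f′ ≗ inv t ▷ φ
    moved m = trans (cong (Y (trivial n) (r ∙ τ) f′) (sym (∙-cancel-inv m t)))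
      (trans (Y-equivariant (trivial n) t r f′ (m ∙ inv t)) (Y-cong (trivial n) r e (m ∙ inv t)))
    inner : ∀ {ρ} → Inj ρ → D (ρ ▷ Y (trivial n) (r ∙ τ) f′)
    inner {ρ} q = resp D-subspace (λ m → trans (cong φ (∙-assoc m ρ (inv t))) (sym (moved (m ∙ ρ))))
      (translate-multiple (∙-inj q (inv-inj t)))

-- Linear independence

mon≟ : (p m : Mon n) → Dec (p ≡ m)
mon≟ = VecP.≡-dec ℕ._≟_

δ : Mon n → V n
δ p m = ⟦ mon≟ p m ⟧

module Semistandard {r c : Vec ℕ n} (tab : Tableau r c) where
  open Tableau tab

  RowWeak-≤ : ∀ {h} → RowWeak r c h → ∀ {x y} → lookup r x ≡ lookup r y → lookup c x ≤ lookup c y → lookup h x ≤ lookup h y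
  RowWeak-≤ {h} weak {x} {y} rxy cxy with ℕP.m≤n⇒m<n∨m≡n cxy
  ... | inj₁ l = weak x y rxy l
  ... | inj₂ e = ℕP.≤-reflexive (cong (lookup h) (separated rxy e))

  ColStrict-< : ∀ {h} → ColStrict r c h → ∀ {x y} → lookup c x ≡ lookup c y → lookup r x < lookup r y → lookup h x < lookup h y
  ColStrict-< {h} strict {x} {y} cxy rxy = go (lookup r y ∸ suc (lookup r x)) y cxy (sym (ℕP.m+[n∸m]≡n rxy))
    where
    go : ∀ k y → lookup c x ≡ lookup c y → lookup r y ≡ suc (lookup r x) ℕ.+ k → lookup h x < lookup h y
    go zero y e e′ = strict x y e (sym (trans e′ (ℕP.+-identityʳ _)))
    go (suc k) y e e′ = let (z , cz , rz) = up {y} {lookup r x ℕ.+ suc k} e′ in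
      ℕP.<-trans (go k z (trans e (sym cz)) (trans rz (ℕP.+-suc (lookup r x) k))) (strict z y cz (trans (cong suc rz) (sym e′)))

  ColStrict-reflects : ∀ {h} → ColStrict r c h → ∀ {x y} → lookup c x ≡ lookup c y → lookup h x < lookup h y → lookup r x < lookup r y
  ColStrict-reflects {h} strict {x} {y} cxy hxy with ℕP.<-cmp (lookup r x) (lookup r y)
  ... | tri< a _ _ = a
  ... | tri≈ _ e _ = ⊥-elim (ℕP.<-irrefl (cong (lookup h) (separated e cxy)) hxy)
  ... | tri> _ _ b = ⊥-elim (ℕP.<-asym hxy (ColStrict-< {h} strict (sym cxy) b))

  -- Within a column, entries and row numbers are ordered alike, so row numbers can be recovered
  -- from the entries.
  depth-strict : ∀ {h} → ColStrict r c h → ∀ y → depth c h y ≡ lookup r y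
  depth-strict {h} strict y = trans
    (∑ₙ.fold-≗ (allFin n) (λ x → ⟦⟧ₙ-cong (below? c h y x) (below? c r y x)
      (λ (a , b) → a , ColStrict-reflects {h} strict a b) (λ (a , b) → a , ColStrict-< {h} strict a b)))
    (depth-row tab y)

  -- The potential of the rearrangement inequality: c x · h y + pot y ≤ pot x + c y · h y for x, y within a row.
  module Rearrange (h : Vec ℕ n) (weak : RowWeak r c h) where

    Fn = allFin n

    left-of : Fin n → Fin n → ℕ
    left-of x z = ⟦ below? r c x z ⟧ₙ

    pot : Fin n → ℕ
    pot x = ∑ₙ Fn (λ z → left-of x z ℕ.* lookup h z)

    column-depth : ∀ x → ∑ₙ Fn (left-of x) ≡ lookup c x
    column-depth = depth-row (transpose tab)

    side : Fin n → Fin n → Fin n → ℕ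
    side x y z = left-of x z ℕ.* lookup h y ℕ.+ left-of y z ℕ.* lookup h z

    pointwise : ∀ {x y} → lookup r x ≡ lookup r y → ∀ z → side x y z ≤ left-of x z ℕ.* lookup h z ℕ.+ left-of y z ℕ.* lookup h y
    pointwise {x} {y} rxy z with below? r c x z | below? r c y z
    ... | yes _ | yes _ = ℕP.≤-reflexive (ℕP.+-comm (1 ℕ.* lookup h y) _)
    ... | no _ | no _ = z≤n
    ... | yes (a , _) | no b = ℕP.+-monoˡ-≤ 0 (ℕP.*-monoʳ-≤ 1 (RowWeak-≤ {h} weak {y} {z} (trans (sym rxy) (sym a))
            (ℕP.≮⇒≥ (λ l → b (trans a rxy , l)))))
    ... | no _ | yes (a , l) = ℕP.*-monoʳ-≤ 1 (weak z y a l)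

    pointwise-< : ∀ {x y} → lookup r x ≡ lookup r y → lookup c x < lookup c y → lookup h x < lookup h y →
      side x y x < left-of x x ℕ.* lookup h x ℕ.+ left-of y x ℕ.* lookup h y
    pointwise-< {x} {y} rxy cxy hxy with below? r c x x | below? r c y x
    ... | yes (_ , l) | _ = ⊥-elim (ℕP.<-irrefl refl l)
    ... | no _ | no b = ⊥-elim (b (rxy , cxy))
    ... | no _ | yes _ = ℕP.*-monoʳ-< 1 hxy

    lhs rhs : Fin n → Fin n → ℕ
    lhs x y = lookup c x ℕ.* lookup h y ℕ.+ pot y
    rhs x y = pot x ℕ.+ lookup c y ℕ.* lookup h y

    ∑side : ∀ x y → ∑ₙ Fn (side x y) ≡ lhs x y
    ∑side x y = trans (∑ₙ.fold-• Fn _ _) (cong (ℕ._+ pot y) (trans (sym (∑ₙ-*ʳ Fn (lookup h y) (left-of x))) (cong (ℕ._* lookup h y) (column-depth x))))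

    ∑other : ∀ x y → ∑ₙ Fn (λ z → left-of x z ℕ.* lookup h z ℕ.+ left-of y z ℕ.* lookup h y) ≡ rhs x y
    ∑other x y = trans (∑ₙ.fold-• Fn _ _) (cong (pot x ℕ.+_) (trans (sym (∑ₙ-*ʳ Fn (lookup h y) (left-of y))) (cong (ℕ._* lookup h y) (column-depth y))))

    inequality : ∀ {x y} → lookup r x ≡ lookup r y → lhs x y ≤ rhs x y
    inequality {x} {y} e = subst₂ _≤_ (∑side x y) (∑other x y) (∑ₙ-mono Fn (λ {z} _ → pointwise e z))

    inequality-< : ∀ {x y} → lookup r x ≡ lookup r y → lookup c x < lookup c y → lookup h x < lookup h y → lhs x y < rhs x y
    inequality-< {x} {y} e a b = subst₂ _<_ (∑side x y) (∑other x y)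
      (∑ₙ-mono-< Fn (λ {z} _ → pointwise e z) (∈P.∈-allFin x) (pointwise-< e a b))

    module _ {τ : Map n} (p : Inj τ) (rτ : r ∙ τ ≡ r) where

      row-of : ∀ x → lookup r x ≡ lookup r (lookup τ x)
      row-of x = trans (sym (≡-lookup rτ x)) (lookup-∙ r τ x)

      base : ℕ
      base = ∑ₙ Fn pot

      ∑lhs : ∑ₙ Fn (λ x → lhs x (lookup τ x)) ≡ moment c (h ∙ τ) ℕ.+ base
      ∑lhs = trans (∑ₙ.fold-• Fn _ _) (cong₂ ℕ._+_
        (∑ₙ.fold-≗ Fn (λ x → cong (lookup c x ℕ.*_) (sym (lookup-∙ h τ x)))) (∑ₙ-relabel p pot))

      ∑rhs : ∑ₙ Fn (λ x → rhs x (lookup τ x)) ≡ moment c h ℕ.+ base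
      ∑rhs = trans (∑ₙ.fold-• Fn _ _) (trans (ℕP.+-comm base _) (cong (ℕ._+ base) (∑ₙ-relabel p (λ y → lookup c y ℕ.* lookup h y))))

      moment-≤-sorted : moment c (h ∙ τ) ≤ moment c h
      moment-≤-sorted = ℕP.+-cancelʳ-≤ base _ _ (subst₂ _≤_ ∑lhs ∑rhs (∑ₙ-mono Fn (λ {x} _ → inequality (row-of x))))

      -- Equality in each summand prevents every entry from growing, and since the sum of the
      -- entries is preserved, none can shrink.
      sorted-unique : moment c (h ∙ τ) ≡ moment c h → h ∙ τ ≡ h
      sorted-unique e = vec-ext λ x → ∑ₙ-tight Fn (λ {x} _ → ℕP.≤-trans (ℕP.≤-reflexive (lookup-∙ h τ x)) (smaller x))
        (total-∙ p h) (∈P.∈-allFin x)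
        where
        tight : ∀ x → lhs x (lookup τ x) ≡ rhs x (lookup τ x)
        tight x = ∑ₙ-tight Fn (λ {x} _ → inequality (row-of x)) (trans ∑lhs (trans (cong (ℕ._+ base) e) (sym ∑rhs))) (∈P.∈-allFin x)
        smaller : ∀ x → lookup h (lookup τ x) ≤ lookup h x
        smaller x with ℕP.<-cmp (lookup c x) (lookup c (lookup τ x))
        ... | tri< l _ _ = ℕP.≮⇒≥ (λ b → ℕP.<-irrefl (tight x) (inequality-< (row-of x) l b))
        ... | tri≈ _ eq _ = RowWeak-≤ {h} weak (sym (row-of x)) (ℕP.≤-reflexive (sym eq))
        ... | tri> _ _ l = weak (lookup τ x) x (sym (row-of x)) l

  -- σ transports the order of the entries in each column. As this order determines the row numbers
  -- on both sides, σ preserves rows besides columns.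
  column-rigid : ∀ {p q} → ColStrict r c p → ColStrict r c q → ∀ {σ} → Inj σ → c ∙ σ ≡ c → q ∙ σ ≡ p → σ ≡ idₘ
  column-rigid {p} {q} sp sq {σ} s cσ e = vec-ext λ x → trans (separated (rows x) (cols x)) (sym (lookup-id x))
    where
    cols : ∀ x → lookup c (lookup σ x) ≡ lookup c x
    cols x = trans (sym (lookup-∙ c σ x)) (≡-lookup cσ x)
    vals : ∀ x → lookup q (lookup σ x) ≡ lookup p x
    vals x = trans (sym (lookup-∙ q σ x)) (≡-lookup e x)
    rows : ∀ x → lookup r (lookup σ x) ≡ lookup r x
    rows x = trans (sym (depth-strict {q} sq (lookup σ x))) (trans
      (trans (sym (∑ₙ-relabel s (λ z → ⟦ below? c q (lookup σ x) z ⟧ₙ)))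
        (∑ₙ.fold-≗ (allFin n) (λ z → ⟦⟧ₙ-cong (below? c q (lookup σ x) (lookup σ z)) (below? c p x z)
          (λ (a , b) → trans (sym (cols z)) (trans a (cols x)) , subst₂ _<_ (vals z) (vals x) b)
          (λ (a , b) → trans (cols z) (trans a (sym (cols x))) , subst₂ _<_ (sym (vals z)) (sym (vals x)) b))))
      (depth-strict {p} sp x))

  -- A column permutation does not change the column moment, and undoing `τ` on the row-sorted `p`
  -- cannot raise it. In the case of equality `p` is fixed by the row permutation, and
  -- `column-rigid` applies.
  triangular : ∀ {p q} → RowWeak r c p → ColStrict r c p → ColStrict r c q →
    ∀ {σ τ} → Inj σ → c ∙ σ ≡ c → Inj τ → r ∙ τ ≡ r → p ≡ q ∙ σ ∙ τ →
    moment c q < moment c p ⊎ (σ ≡ idₘ × p ∙ τ ≡ p)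
  triangular {p} {q} weak sp sq {σ} {τ} s cσ t rτ e with moment c (p ∙ inv t) ℕ.≟ moment c p
  ... | no ne = inj₁ (subst (_< moment c p) moment-q (ℕP.≤∧≢⇒< (Rearrange.moment-≤-sorted p weak (inv-inj t) (stab-inv t rτ)) ne))
    where
    moment-q : moment c (p ∙ inv t) ≡ moment c q
    moment-q = trans (cong (moment c) (trans (cong (_∙ inv t) e) (∙-inv-cancel (q ∙ σ) t)))
      (trans (cong (λ k → moment k (q ∙ σ)) (sym cσ)) (moment-∙ s c q))
  ... | yes eq = inj₂ (column-rigid {p} {q} sp sq s cσ (trans (sym (trans (cong (_∙ inv t) e) (∙-inv-cancel (q ∙ σ) t))) sorted) ,
            trans (cong (_∙ τ) (sym sorted)) (∙-cancel-inv p t))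
    where
    sorted : p ∙ inv t ≡ p
    sorted = Rearrange.sorted-unique p weak (inv-inj t) (stab-inv t rτ) eq

  private
    sym-δ : Mon n → V n
    sym-δ p = symmetrize r c (δ p)

  symδ-terms : ∀ {p q} → RowWeak r c p → ColStrict r c p → ColStrict r c q → ¬ moment c q < moment c p →
    ∀ {σ} → Inj σ → c ∙ σ ≡ c → σ ≢ idₘ ⊎ p ≢ q → Y (trivial n) r (δ p) (q ∙ σ) ≡ 0ℚ
  symδ-terms {p} {q} weak sp sq ¬l {σ} s cσ ne = ∑.fold-ε (allPerms n) (λ {τ} m → go τ (allPerms-inj m))
    where
    excluded : ∀ {τ} → σ ≢ idₘ ⊎ p ≢ q → σ ≡ idₘ × p ∙ τ ≡ p → Inj τ → p ≡ q ∙ σ ∙ τ → ⊥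
    excluded (inj₁ a) (σ≡ , _) _ _ = a σ≡
    excluded {τ} (inj₂ b) (σ≡ , pτ) t e = b (∙-cancelʳ t (trans pτ (trans e (cong (_∙ τ) (trans (cong (q ∙_) σ≡) (∙-id q))))))
    go : ∀ τ → Inj τ → weight (trivial n) r τ * δ p (q ∙ σ ∙ τ) ≡ 0ℚ
    go τ t with stab? r τ
    ... | no _ = trans (cong (_* δ p (q ∙ σ ∙ τ)) (ℚP.*-zeroˡ 1ℚ)) (ℚP.*-zeroˡ (δ p (q ∙ σ ∙ τ)))
    ... | yes rτ = trans (cong (1ℚ * 1ℚ *_) (⟦⟧-no (mon≟ p (q ∙ σ ∙ τ)) impossible)) (ℚP.*-zeroʳ (1ℚ * 1ℚ))
      where
      impossible : p ≢ q ∙ σ ∙ τ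
      impossible e with triangular {p} {q} weak sp sq s cσ t rτ e
      ... | inj₁ l = ¬l l
      ... | inj₂ h = excluded ne h t e

  symδ-off : ∀ {p q} → RowWeak r c p → ColStrict r c p → ColStrict r c q → ¬ moment c q < moment c p → p ≢ q → sym-δ p q ≡ 0ℚ
  symδ-off {p} {q} weak sp sq ¬l ne = ∑.fold-ε (allPerms n) (λ {σ} m → go σ (allPerms-inj m))
    where
    go : ∀ σ → Inj σ → weight (sign n) c σ * Y (trivial n) r (δ p) (q ∙ σ) ≡ 0ℚ
    go σ s with stab? c σ
    ... | no _ = trans (cong (_* Y (trivial n) r (δ p) (q ∙ σ)) (ℚP.*-zeroˡ (sgn σ))) (ℚP.*-zeroˡ (Y (trivial n) r (δ p) (q ∙ σ)))
    ... | yes cσ = trans (cong (1ℚ * sgn σ *_) (symδ-terms {p} {q} weak sp sq ¬l s cσ (inj₂ ne))) (ℚP.*-zeroʳ (1ℚ * sgn σ))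

  fixed? : ∀ p τ → Dec (r ∙ τ ≡ r × p ≡ p ∙ τ)
  fixed? p τ = stab? r τ ×-dec mon≟ p (p ∙ τ)

  -- Only the identity of the column group contributes, with sign 1, so the coefficient counts the
  -- row permutations that fix `p`. For `p = pExp M T` this is the number `sMT M T` by which `F` is
  -- normalized.
  symδ-diagonal : ∀ {p} → RowWeak r c p → ColStrict r c p → sym-δ p p ≢ 0ℚ
  symδ-diagonal {p} weak sp z = ∑-⟦⟧≢0 (allPerms n) (fixed? p) (∈-allPerms id-inj) (∙-id r , sym (∙-id p)) (trans (sym value) z)
    where
    go : ∀ σ → Inj σ → σ ≢ idₘ → weight (sign n) c σ * Y (trivial n) r (δ p) (p ∙ σ) ≡ 0ℚ
    go σ s ne with stab? c σ
    ... | no _ = trans (cong (_* Y (trivial n) r (δ p) (p ∙ σ)) (ℚP.*-zeroˡ (sgn σ))) (ℚP.*-zeroˡ (Y (trivial n) r (δ p) (p ∙ σ)))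
    ... | yes cσ = trans (cong (1ℚ * sgn σ *_) (symδ-terms {p} {p} weak sp sp (ℕP.<-irrefl refl) s cσ (inj₁ ne))) (ℚP.*-zeroʳ (1ℚ * sgn σ))
    at-id : weight (sign n) c idₘ * Y (trivial n) r (δ p) (p ∙ idₘ) ≡ Y (trivial n) r (δ p) p
    at-id = trans (cong₂ (λ a m → a * Y (trivial n) r (δ p) m)
      (trans (cong₂ _*_ (⟦⟧-yes (stab? c idₘ) (∙-id c)) (χ-id (sign n))) (ℚP.*-identityˡ 1ℚ)) (∙-id p)) (ℚP.*-identityˡ (Y (trivial n) r (δ p) p))
    value : sym-δ p p ≡ ∑ (allPerms n) (λ τ → ⟦ fixed? p τ ⟧)
    value = trans (∑.fold-single (λ σ → weight (sign n) c σ * Y (trivial n) r (δ p) (p ∙ σ)) (allPerms-unique n) (∈-allPerms id-inj)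
        (λ {σ} m ne → go σ (allPerms-inj m) ne))
      (trans at-id (∑.fold-≗ (allPerms n) (λ τ → trans (cong (_* δ p (p ∙ τ)) (ℚP.*-identityʳ ⟦ stab? r τ ⟧))
        (sym (⟦⟧-× (stab? r τ) (mon≟ p (p ∙ τ)))))))

  module _ {I : Set} (L : List I) (unique : Unique L) (p : I → Mon n) (E : I → V n)
    (Good : I → Set) (good-weak : ∀ {i} → Good i → RowWeak r c (p i)) (good-strict : ∀ {i} → Good i → ColStrict r c (p i))
    (good-injective : ∀ {i j} → i ∈ L → j ∈ L → Good i → Good j → p i ≡ p j → i ≡ j)
    (split : ∀ {i} → i ∈ L → Zero (E i) ⊎ (Good i × Multiple (symmetrize r c (δ (p i))) (E i)))
    (relation : ∀ m → ∑ L (λ i → E i m) ≡ 0ℚ) where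

    -- The relation is evaluated at `p i`: members of larger moment vanish by induction, and by
    -- `symδ-off` no other member but `E i` involves this monomial.
    independent : ∀ {i} → i ∈ L → Zero (E i)
    independent {i} i∈ = descend {A = Σ I (_∈ L)} {R = λ a → Zero (E (proj₁ a))} (λ a → moment c (p (proj₁ a))) (∑ₙ L (λ i → moment c (p i)))
      (λ (i , i∈) → ∑ₙ-term L (λ i → moment c (p i)) i∈) step (i , i∈)
      where
      step : (a : Σ I (_∈ L)) → ((b : Σ I (_∈ L)) → moment c (p (proj₁ a)) < moment c (p (proj₁ b)) → Zero (E (proj₁ b))) → Zero (E (proj₁ a))
      step (i , i∈) ih with split i∈
      ... | inj₁ z = z
      ... | inj₂ (gi , κ , h) = λ m → trans (h m) (trans (cong (_* sym-δ (p i) m) κ≡0) (ℚP.*-zeroˡ (sym-δ (p i) m)))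
        where
        others : ∀ {j} → j ∈ L → j ≢ i → E j (p i) ≡ 0ℚ
        others {j} j∈ ne with split j∈
        ... | inj₁ z = z (p i)
        ... | inj₂ (gj , κ′ , h′) with moment c (p i) ℕ.<? moment c (p j)
        ... | yes l = ih (j , j∈) l (p i)
        ... | no ¬l = trans (h′ (p i)) (trans (cong (κ′ *_)
                (symδ-off {p j} {p i} (good-weak gj) (good-strict gj) (good-strict gi) ¬l (λ e → ne (good-injective j∈ i∈ gj gi e)))) (ℚP.*-zeroʳ κ′))
        κ≡0 : κ ≡ 0ℚ
        κ≡0 = *≡0⇒ (symδ-diagonal {p i} (good-weak gi) (good-strict gi))
          (trans (ℚP.*-comm (sym-δ (p i) (p i)) κ) (trans (sym (h (p i)))
            (trans (sym (∑.fold-single (λ j → E j (p i)) unique i∈ others)) (relation (p i)))))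

-- Coefficients of the polynomials F_{M,T}

coeff-++ : (p q : Poly n) (a : Mon n) → coeff (p ++ q) a ≡ coeff p a + coeff q a
coeff-++ [] q a = sym (ℚP.+-identityˡ _)
coeff-++ ((c , b) ∷ p) q a with b ≟ₘ a
... | true = trans (cong (c +_) (coeff-++ p q a)) (sym (ℚP.+-assoc c (coeff p a) (coeff q a)))
... | false = coeff-++ p q a

coeff-scale : (c : ℚ) (p : Poly n) (a : Mon n) → coeff (c ·ₚ p) a ≡ c * coeff p a
coeff-scale c [] a = sym (ℚP.*-zeroʳ c)
coeff-scale c ((x , b) ∷ p) a with b ≟ₘ a
... | true = trans (cong (c * x +_) (coeff-scale c p a)) (sym (ℚP.*-distribˡ-+ c x (coeff p a)))
... | false = coeff-scale c p a

coeff-sum : (ps : List (Poly n)) (a : Mon n) → coeff (sumₚ ps) a ≡ ∑ ps (λ p → coeff p a)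
coeff-sum [] a = refl
coeff-sum (p ∷ ps) a = trans (coeff-++ p (sumₚ ps) a) (cong (coeff p a +_) (coeff-sum ps a))

coeff-single : (p : Mon n) → coeff [ (1ℚ , p) ] ≗ δ p
coeff-single p m with mon≟ p m
... | yes _ = ℚP.+-identityʳ 1ℚ
... | no _ = refl

filterᵇ-single : (p : A → Bool) {xs : List A} {a : A} → Unique xs → a ∈ xs → p a ≡ true →
  (∀ {x} → x ∈ xs → p x ≡ true → x ≡ a) → filterᵇ p xs ≡ [ a ]
filterᵇ-single p {x ∷ xs} (x∉ ∷ u) (here refl) pa h rewrite pa = cong (x ∷_) (none xs (λ q e → All.lookup x∉ q (sym (h (there q) e))))
  where
  none : ∀ ys → (∀ {y} → y ∈ ys → p y ≡ true → ⊥) → filterᵇ p ys ≡ []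
  none [] h = refl
  none (y ∷ ys) h with p y in e
  ... | true = ⊥-elim (h (here refl) e)
  ... | false = none ys (h ∘ there)
filterᵇ-single p {x ∷ xs} {a} (x∉ ∷ u) (there q) pa h with p x in e
... | true = ⊥-elim (All.lookup x∉ q (h (here refl) e))
... | false = filterᵇ-single p u q pa (h ∘ there)

-- The fibre of a permutation over each index is a single point, so the sum that defines `actMon`
-- has one term.
actMon-∙ : {σ : Map n} → Inj σ → (b : Mon n) → actMon σ b ∙ σ ≡ b
actMon-∙ {n} {σ} s b = vec-ext λ i → trans (lookup-∙ (actMon σ b) σ i)
  (trans (VecP.lookup∘tabulate _ (lookup σ i))
    (trans (cong (sum ∘ map (lookup b)) (filterᵇ-single (λ j → app σ j ≟ᶠ lookup σ i) (Unique.allFin⁺ n) (∈P.∈-allFin i)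
        (⌊⌋-yes (lookup σ i FinP.≟ lookup σ i) refl) (λ {j} _ e → cancel s (⌊⌋-true (lookup σ j FinP.≟ lookup σ i) e))))
      (ℕP.+-identityʳ (lookup b i))))

⌊⌋-cong : (d : Dec P) (e : Dec Q) → (P → Q) → (Q → P) → ⌊ d ⌋ ≡ ⌊ e ⌋
⌊⌋-cong (yes p) e f g = sym (⌊⌋-yes e (f p))
⌊⌋-cong (no ¬p) e f g = sym (⌊⌋-no e (¬p ∘ g))

coeff-act : {σ : Map n} → Inj σ → (p : Poly n) (a : Mon n) → coeff (act σ p) a ≡ coeff p (a ∙ σ)
coeff-act s [] a = refl
coeff-act {n} {σ} s ((x , b) ∷ p) a rewrite ⌊⌋-cong (mon≟ (actMon σ b) a) (mon≟ b (a ∙ σ))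
    (λ e → trans (sym (actMon-∙ s b)) (cong (_∙ σ) e)) (λ e → ∙-cancelʳ s (trans (actMon-∙ s b) e))
  with b ≟ₘ (a ∙ σ)
... | true = cong (x +_) (coeff-act s p a)
... | false = coeff-act s p a

InBlock : Tab A → ℕ → A → Set
InBlock B j x = ∃ λ b → At₁ B j b × x ∈ b

-- Links a list of blocks, either the rows of `T` or its `columns`, with a labelling. The Boolean
-- test `preservesᵇ` then becomes membership in the stabilizer.
record Blocks (B : Tab (Fin n)) (ℓ : Vec ℕ n) : Set where
  field
    block-label : ∀ {j x} → InBlock B j x → lookup ℓ x ≡ j
    label-block : ∀ x → InBlock B (lookup ℓ x) x

∈-any : {p : A → Bool} {xs : List A} {x : A} → x ∈ xs → p x ≡ true → any p xs ≡ true
∈-any {p = p} (here refl) e rewrite e = refl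
∈-any {p = p} {y ∷ _} (there q) e with p y
... | true = refl
... | false = ∈-any q e

any-∈ : {p : A → Bool} (xs : List A) → any p xs ≡ true → ∃ λ x → x ∈ xs × p x ≡ true
any-∈ {p = p} (x ∷ xs) e with p x in px
... | true = x , here refl , px
... | false = let (y , q , py) = any-∈ xs e in y , there q , py

module _ {B : Tab (Fin n)} {ℓ : Vec ℕ n} (bl : Blocks B ℓ) where
  open Blocks bl

  preserves-sound : {σ : Map n} → preservesᵇ B σ ≡ true → ℓ ∙ σ ≡ ℓ
  preserves-sound {σ} e = vec-ext λ x → trans (lookup-∙ ℓ σ x) (go x (label-block x))
    where
    go : ∀ x → InBlock B (lookup ℓ x) x → lookup ℓ (lookup σ x) ≡ lookup ℓ x
    go x (b , at , x∈) = block-label (b , at , mem (any-∈ b (T-all b (T-all B e (At₁⇒∈ at)) x∈)))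
      where
      mem : (∃ λ y → y ∈ b × (app σ x ≟ᶠ y) ≡ true) → app σ x ∈ b
      mem (y , q , e′) = subst (_∈ b) (sym (⌊⌋-true (app σ x FinP.≟ y) e′)) q

  preserves-complete : {σ : Map n} → ℓ ∙ σ ≡ ℓ → preservesᵇ B σ ≡ true
  preserves-complete {σ} e = all-T B (λ {b} b∈ → all-T b (λ {x} x∈ → stays (∈⇒At₁ b∈) x∈))
    where
    stays : ∀ {b} → (∃ λ j → At₁ B j b) → ∀ {x} → x ∈ b → memᵇ (app σ x) b ≡ true
    stays {b} (j , at) {x} x∈ = same (label-block (app σ x))
      where
      ℓσ : lookup ℓ (app σ x) ≡ j
      ℓσ = trans (sym (lookup-∙ ℓ σ x)) (trans (≡-lookup e x) (block-label (b , at , x∈)))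
      same : InBlock B (lookup ℓ (app σ x)) (app σ x) → memᵇ (app σ x) b ≡ true
      same (b′ , at′ , q) = ∈-any (subst (app σ x ∈_) (At₁-functional (subst (λ j → At₁ B j b′) ℓσ at′) at) q)
        (⌊⌋-yes (app σ x FinP.≟ app σ x) refl)

  ∑-blockGroup : (f : Map n → ℚ) → ∑ (filterᵇ (preservesᵇ B) (allPerms n)) f ≡ ∑ (allPerms n) (λ σ → ⟦ stab? ℓ σ ⟧ * f σ)
  ∑-blockGroup f = go (allPerms n)
    where
    go : ∀ xs → ∑ (filterᵇ (preservesᵇ B) xs) f ≡ ∑ xs (λ σ → ⟦ stab? ℓ σ ⟧ * f σ)
    go [] = refl
    go (σ ∷ xs) with preservesᵇ B σ in e
    ... | true = cong₂ _+_ (sym (trans (cong (_* f σ) (⟦⟧-yes (stab? ℓ σ) (preserves-sound {σ} e))) (ℚP.*-identityˡ (f σ)))) (go xs)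
    ... | false = trans (go xs) (sym (trans (cong (λ z → z * f σ + ∑ xs (λ σ → ⟦ stab? ℓ σ ⟧ * f σ))
            (⟦⟧-no (stab? ℓ σ) (λ e′ → false≢true (trans (sym e) (preserves-complete {σ} e′)))))
            (trans (cong (_+ ∑ xs (λ σ → ⟦ stab? ℓ σ ⟧ * f σ)) (ℚP.*-zeroˡ (f σ))) (ℚP.+-identityˡ _))))
      where
      false≢true : false ≢ true
      false≢true ()

mergeCol-to : (ρ : List A) (cs : Tab A) {j : ℕ} {x : A} → InBlock (mergeCol ρ cs) j x → At₁ ρ j x ⊎ InBlock cs j x
mergeCol-to [] cs h = inj₂ h
mergeCol-to (y ∷ ρ) [] (_ , here , here refl) = inj₁ here
mergeCol-to (y ∷ ρ) [] (b , there at , q) with mergeCol-to ρ [] (b , at , q)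
... | inj₁ p = inj₁ (there p)
... | inj₂ (_ , () , _)
mergeCol-to (y ∷ ρ) (b′ ∷ cs) (_ , here , here refl) = inj₁ here
mergeCol-to (y ∷ ρ) (b′ ∷ cs) (_ , here , there q) = inj₂ (b′ , here , q)
mergeCol-to (y ∷ ρ) (b′ ∷ cs) (b , there at , q) with mergeCol-to ρ cs (b , at , q)
... | inj₁ p = inj₁ (there p)
... | inj₂ (b″ , at′ , q′) = inj₂ (b″ , there at′ , q′)

mergeCol-row : (ρ : List A) (cs : Tab A) {j : ℕ} {x : A} → At₁ ρ j x → InBlock (mergeCol ρ cs) j x
mergeCol-row (y ∷ ρ) [] here = _ , here , here refl
mergeCol-row (y ∷ ρ) (b ∷ cs) here = _ , here , here refl
mergeCol-row (y ∷ ρ) [] (there p) = let (b , at , q) = mergeCol-row ρ [] p in b , there at , q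
mergeCol-row (y ∷ ρ) (_ ∷ cs) (there p) = let (b , at , q) = mergeCol-row ρ cs p in b , there at , q

mergeCol-rest : (ρ : List A) (cs : Tab A) {j : ℕ} {x : A} → InBlock cs j x → InBlock (mergeCol ρ cs) j x
mergeCol-rest [] cs h = h
mergeCol-rest (y ∷ ρ) (b ∷ cs) (_ , here , q) = _ , here , there q
mergeCol-rest (y ∷ ρ) (b′ ∷ cs) (b , there at , q) = let (b″ , at″ , q″) = mergeCol-rest ρ cs (b , at , q) in b″ , there at″ , q″

columns-to : (T : Tab A) {j : ℕ} {x : A} → InBlock (columns T) j x → ∃ λ i → At T i j x
columns-to (ρ ∷ T) h with mergeCol-to ρ (columns T) h
... | inj₁ p = 0 , ρ , here , p
... | inj₂ q = let (i , ρ′ , at , p) = columns-to T q in suc i , ρ′ , there at , p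

columns-from : (T : Tab A) {i j : ℕ} {x : A} → At T i j x → InBlock (columns T) j x
columns-from (ρ ∷ T) (_ , here , p) = mergeCol-row ρ (columns T) p
columns-from (ρ ∷ T) (ρ′ , there at , p) = mergeCol-rest ρ (columns T) (columns-from T (ρ′ , at , p))

module _ {T : Tab (Fin n)} {r c : Vec ℕ n} (co : Coords T r c) where
  open Coords co

  row-blocks : Blocks T r
  row-blocks = record
    { block-label = λ (ρ , at , q) → let (j , p) = ∈⇒At₁ q in proj₁ (sound (ρ , at , p))
    ; label-block = λ x → let (ρ , at , p) = complete x in ρ , at , At₁⇒∈ p
    }

  col-blocks : Blocks (columns T) c
  col-blocks = record
    { block-label = λ h → let (i , at) = columns-to T h in proj₂ (sound at)
    ; label-block = λ x → columns-from T (complete x)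
    }

  coeff-epsilon : (p : Poly n) → coeff (epsilon T p) ≗ symmetrize r c (coeff p)
  coeff-epsilon p a = begin
    coeff (epsilon T p) a
      ≡⟨ coeff-sum (concatMap terms (colGroup T)) a ⟩
    ∑ (concatMap terms (colGroup T)) (λ q → coeff q a)
      ≡⟨ ∑.fold-concatMap (colGroup T) terms _ ⟩
    ∑ (colGroup T) (λ σ → ∑ (terms σ) (λ q → coeff q a))
      ≡⟨ ∑.fold-cong (colGroup T) (λ {σ} s → trans (∑.fold-map (rowGroup T) (term σ) _) (trans (∑.fold-cong (rowGroup T) (λ {τ} t → value (member {columns T} s) (member {T} t)))
           (trans (sym (∑-*ˡ (rowGroup T) (sgn σ) _)) (cong (sgn σ *_) (trans (∑-blockGroup row-blocks _)
             (∑.fold-≗ (allPerms n) (λ τ → cong (_* coeff p (a ∙ σ ∙ τ)) (sym (ℚP.*-identityʳ ⟦ stab? r τ ⟧))))))))) ⟩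
    ∑ (colGroup T) (λ σ → sgn σ * Y (trivial n) r (coeff p) (a ∙ σ))
      ≡⟨ ∑-blockGroup col-blocks _ ⟩
    ∑ (allPerms n) (λ σ → ⟦ stab? c σ ⟧ * (sgn σ * Y (trivial n) r (coeff p) (a ∙ σ)))
      ≡⟨ ∑.fold-≗ (allPerms n) (λ σ → sym (ℚP.*-assoc ⟦ stab? c σ ⟧ (sgn σ) _)) ⟩
    symmetrize r c (coeff p) a ∎
    where
    open ≡-Reasoning
    term : Map n → Map n → Poly n
    term σ τ = sgn σ ·ₚ act σ (act τ p)
    terms : Map n → List (Poly n)
    terms σ = map (term σ) (rowGroup T)
    member : ∀ {B : Tab (Fin n)} {σ} → σ ∈ filterᵇ (preservesᵇ B) (allPerms n) → Inj σ
    member {B} q = allPerms-inj (proj₁ (filterᵇ-⊆ (preservesᵇ B) (allPerms n) q))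
    value : ∀ {σ τ} → Inj σ → Inj τ → coeff (sgn σ ·ₚ act σ (act τ p)) a ≡ sgn σ * coeff p (a ∙ σ ∙ τ)
    value {σ} {τ} s t = trans (coeff-scale (sgn σ) (act σ (act τ p)) a)
      (cong (sgn σ *_) (trans (coeff-act s (act τ p) a) (coeff-act t p (a ∙ σ))))

  coeff-F : (M : Tab ℕ) → coeff (F M T) ≗ (λ a → recip (sMT M T) * symmetrize r c (δ (pExp M T)) a)
  coeff-F M a = trans (coeff-scale (recip (sMT M T)) (epsilon T (pMT M T)) a)
    (cong (recip (sMT M T) *_) (trans (coeff-epsilon (pMT M T) a)
      (Y-cong (sign n) c (Y-cong (trivial n) r (coeff-single (pExp M T))) a)))

  actMon-id : (b : Mon n) → actMon idₘ b ≡ b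
  actMon-id b = trans (sym (∙-id (actMon idₘ b))) (actMon-∙ id-inj b)

  recip≢0 : (M : Tab ℕ) → recip (sMT M T) ≢ 0ℚ
  recip≢0 M = positive (nonempty (filterᵇ-∈ (λ τ → actMon τ (pExp M T) ≟ₘ pExp M T)
      (filterᵇ-∈ (preservesᵇ T) (∈-allPerms id-inj) (preserves-complete row-blocks {idₘ} (∙-id r)))
      (⌊⌋-yes (mon≟ (actMon idₘ (pExp M T)) (pExp M T)) (actMon-id (pExp M T)))))
    where
    nonempty : {xs : List (Map n)} {x : Map n} → x ∈ xs → 1 ≤ length xs
    nonempty (here _) = s≤s z≤n
    nonempty (there _) = s≤s z≤n
    positive : ∀ {k} → 1 ≤ k → recip k ≢ 0ℚ
    positive {suc k} _ e = ℚP.<⇒≢ (ℚP.positive⁻¹ (recip (suc k)) {{ℚP.normalize-pos 1 (suc k)}}) (sym e)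

-- Fillings of a fixed shape

zipped : Tab A → Tab B → List (A × B)
zipped T M = concat (zipWith zip T M)

zip-proj₁ : (xs : List A) (ys : List B) → length xs ≡ length ys → map proj₁ (zip xs ys) ≡ xs
zip-proj₁ [] [] e = refl
zip-proj₁ (x ∷ xs) (y ∷ ys) e = cong (x ∷_) (zip-proj₁ xs ys (ℕP.suc-injective e))

zipped-proj₁ : (T : Tab A) (M : Tab B) → shape T ≡ shape M → map proj₁ (zipped T M) ≡ concat T
zipped-proj₁ [] [] e = refl
zipped-proj₁ (ρ ∷ T) (μ ∷ M) e = trans (ListP.map-++ proj₁ (zip ρ μ) (zipped T M))
  (cong₂ _++_ (zip-proj₁ ρ μ (ListP.∷-injectiveˡ e)) (zipped-proj₁ T M (ListP.∷-injectiveʳ e)))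

zip-reconstruct : (φ : A → B) (xs : List A) (ys : List B) → length xs ≡ length ys →
  (∀ {x y} → (x , y) ∈ zip xs ys → φ x ≡ y) → map φ xs ≡ ys
zip-reconstruct φ [] [] e h = refl
zip-reconstruct φ (x ∷ xs) (y ∷ ys) e h = cong₂ _∷_ (h (here refl)) (zip-reconstruct φ xs ys (ℕP.suc-injective e) (h ∘ there))

zipped-reconstruct : (φ : A → B) (T : Tab A) (M : Tab B) → shape T ≡ shape M →
  (∀ {x y} → (x , y) ∈ zipped T M → φ x ≡ y) → map (map φ) T ≡ M
zipped-reconstruct φ [] [] e h = refl
zipped-reconstruct φ (ρ ∷ T) (μ ∷ M) e h = cong₂ _∷_
  (zip-reconstruct φ ρ μ (ListP.∷-injectiveˡ e) (λ q → h (∈P.∈-++⁺ˡ q)))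
  (zipped-reconstruct φ T M (ListP.∷-injectiveʳ e) (λ q → h (∈P.∈-++⁺ʳ (zip ρ μ) q)))

pExp-at : (M : Tab ℕ) (T : Tab (Fin n)) → shape T ≡ shape M → Unique (concat T) →
  ∀ {x h} → (x , h) ∈ zipped T M → lookup (pExp M T) x ≡ h
pExp-at M T e u {x} {h} q = trans (VecP.lookup∘tabulate _ x) (trans
  (cong (sum ∘ map proj₂) (filterᵇ-single (λ jh → proj₁ jh ≟ᶠ x) (Unique.map⁻ uz) q (⌊⌋-yes (x FinP.≟ x) refl)
    (λ {jh} q′ e′ → same (⌊⌋-true (proj₁ jh FinP.≟ x) e′) q′ q))) (ℕP.+-identityʳ h))
  where
  uz : Unique (map proj₁ (zipped T M))
  uz = subst Unique (sym (zipped-proj₁ T M e)) u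
  keys : {zs : List (Fin _ × ℕ)} → Unique (map proj₁ zs) → ∀ {a b} → a ∈ zs → b ∈ zs → proj₁ a ≡ proj₁ b → a ≡ b
  keys (x∉ ∷ v) (here refl) (here refl) _ = refl
  keys (x∉ ∷ v) (here refl) (there q) e = ⊥-elim (All.lookup x∉ (∈P.∈-map⁺ proj₁ q) e)
  keys (x∉ ∷ v) (there p) (here refl) e = ⊥-elim (All.lookup x∉ (∈P.∈-map⁺ proj₁ p) (sym e))
  keys (x∉ ∷ v) (there p) (there q) e = keys v p q e
  same : ∀ {a b} → proj₁ a ≡ proj₁ b → a ∈ zipped T M → b ∈ zipped T M → a ≡ b
  same e p q = keys uz p q e

reconstruct : (M : Tab ℕ) (T : Tab (Fin n)) → shape T ≡ shape M → Unique (concat T) → map (map (lookup (pExp M T))) T ≡ M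
reconstruct M T e u = zipped-reconstruct (lookup (pExp M T)) T M e (pExp-at M T e u)

shape-map : (φ : A → B) (T : Tab A) → shape (map (map φ) T) ≡ shape T
shape-map φ T = trans (sym (ListP.map-∘ T)) (ListP.map-cong (ListP.length-map φ) T)

map-≡-∈ : {φ ψ : A → B} (xs : List A) → map φ xs ≡ map ψ xs → ∀ {x} → x ∈ xs → φ x ≡ ψ x
map-≡-∈ (x ∷ xs) e (here refl) = ListP.∷-injectiveˡ e
map-≡-∈ (x ∷ xs) e (there q) = map-≡-∈ xs (ListP.∷-injectiveʳ e) q

toList-allFin : (v : Vec A n) → Vec.toList v ≡ map (lookup v) (allFin n)
toList-allFin {n = n} v = sym (trans (ListP.map-tabulate id (lookup v)) (go v))
  where
  go : ∀ {n} (v : Vec A n) → List.tabulate (lookup v) ≡ Vec.toList v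
  go [] = refl
  go (x ∷ v) = cong (x ∷_) (go v)

toList-∙ : {σ : Map n} → Inj σ → (m : Vec A n) → Vec.toList (m ∙ σ) ↭ Vec.toList m
toList-∙ {n} {σ = σ} s m = subst₂ _↭_
  (sym (trans (toList-allFin (m ∙ σ)) (trans (ListP.map-cong (lookup-∙ m σ) (allFin n)) (ListP.map-∘ (allFin n)))))
  (sym (toList-allFin m))
  (↭P.map⁺ (lookup m) (map-↭-self {f = lookup σ} (Unique.allFin⁺ n) (λ _ → ∈P.∈-allFin _) (λ _ _ → cancel s)))

sum-concat : (M : Tab ℕ) → entrySum M ≡ sum (content M)
sum-concat [] = refl
sum-concat (ρ ∷ M) = trans (cong (sum ρ ℕ.+_) (sum-concat M)) (sym (SumP.sum-++ ρ (concat M)))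

sum-toList : (m : Mon n) → Vec.sum m ≡ sum (Vec.toList m)
sum-toList [] = refl
sum-toList (x ∷ m) = cong (x ℕ.+_) (sum-toList m)

lookup-≤-sum : (m : Mon n) (i : Fin n) → lookup m i ≤ sum (Vec.toList m)
lookup-≤-sum (x ∷ m) Fin.zero = ℕP.m≤m+n x _
lookup-≤-sum (x ∷ m) (Fin.suc i) = ℕP.≤-trans (lookup-≤-sum m i) (ℕP.m≤n+m _ x)

AllPairs-At₁ : {R : A → A → Set} {xs : List A} → AllPairs R xs → ∀ {i j x y} → At₁ xs i x → At₁ xs j y → i < j → R x y
AllPairs-At₁ (h ∷ _) here (there q) l = All.lookup h (At₁⇒∈ q)
AllPairs-At₁ (_ ∷ ap) (there p) (there q) (s≤s l) = AllPairs-At₁ ap p q l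

At₁-take : {xs : List A} {k j : ℕ} {x : A} → j < k → At₁ xs j x → At₁ (take k xs) j x
At₁-take (s≤s l) here = here
At₁-take (s≤s l) (there p) = there (At₁-take l p)

Pointwise-At₁ : {R : A → B → Set} {xs : List A} {ys : List B} → Pointwise R xs ys → ∀ {j x y} → At₁ xs j x → At₁ ys j y → R x y
Pointwise-At₁ (h ∷ _) here here = h
Pointwise-At₁ (_ ∷ hs) (there p) (there q) = Pointwise-At₁ hs p q

Pointwise-take : {R : A → B → Set} (xs : List A) (ys : List B) → length ys ≤ length xs →
  (∀ {j x y} → At₁ xs j x → At₁ ys j y → R x y) → Pointwise R (take (length ys) xs) ys
Pointwise-take xs [] l h = []
Pointwise-take (x ∷ xs) (y ∷ ys) (s≤s l) h = h here here ∷ Pointwise-take xs ys l (λ p q → h (there p) (there q))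

At₁-ext : (xs ys : List A) → (∀ {i x} → At₁ xs i x → At₁ ys i x) → (∀ {i x} → At₁ ys i x → At₁ xs i x) → xs ≡ ys
At₁-ext [] [] f g = refl
At₁-ext [] (y ∷ ys) f g with () ← g here
At₁-ext (x ∷ xs) [] f g with () ← f here
At₁-ext (x ∷ xs) (y ∷ ys) f g = cong₂ _∷_ (At₁-functional (f here) here)
  (At₁-ext xs ys (λ p → tail (f (there p))) (λ p → tail (g (there p))))
  where
  tail : ∀ {z} {zs : List _} {i w} → At₁ (z ∷ zs) (suc i) w → At₁ zs i w
  tail (there p) = p

At-shape : (T : Tab A) (T′ : Tab B) → shape T ≡ shape T′ → ∀ {i j x} → At T i j x → ∃ (At T′ i j)
At-shape T T′ e {i} {j} (ρ , at , p) = let (ρ′ , at′ , eρ) = At₁-unmap length (subst (λ s → At₁ s i (length ρ)) e (At₁-map length at))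
                                           (y , q) = At₁-exists ρ′ (subst (j <_) (sym eρ) (At₁-< p))
                                       in y , ρ′ , at′ , q

At-map : {T : Tab A} {i j : ℕ} {x : A} (φ : A → B) → At T i j x → At (map (map φ) T) i j (φ x)
At-map φ (ρ , at , p) = map φ ρ , At₁-map (map φ) at , At₁-map φ p

module _ {T : Tab (Fin n)} {r c : Vec ℕ n} (co : Coords T r c) where
  open Coords co

  private
    fill : Mon n → Tab ℕ
    fill h = map (map (lookup h)) T

  fill-pExp : (M : Tab ℕ) → shape T ≡ shape M → fill (pExp M T) ≡ M
  fill-pExp M e = reconstruct M T e concat-unique

  -- Reading off `fill h` and filling again gives the same tableau by `reconstruct`; since every
  -- index occurs in some cell, the exponents agree everywhere.
  pExp-fill : (h : Mon n) → pExp (fill h) T ≡ h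
  pExp-fill h = vec-ext λ x → map-≡-∈ (concat T) (trans (sym (ListP.concat-map T))
    (trans (cong concat (reconstruct (fill h) T (sym (shape-map (lookup h) T)) concat-unique)) (ListP.concat-map T))) (At⇒∈concat (complete x))

  toList-fill : (h : Mon n) → Vec.toList h ↭ content (fill h)
  toList-fill h = subst₂ _↭_ (sym (toList-allFin h)) (sym (ListP.concat-map T)) (↭P.map⁺ (lookup h) (↭-sym concat-↭))

  toList-pExp : (M : Tab ℕ) → shape T ≡ shape M → Vec.toList (pExp M T) ↭ content M
  toList-pExp M e = subst (λ N → Vec.toList (pExp M T) ↭ content N) (fill-pExp M e) (toList-fill (pExp M T))

  row-weak : (h : Mon n) → All (Linked _≤_) (fill h) → RowWeak r c h
  row-weak h all x y rxy cxy = at (complete x) (complete y)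
    where
    at : At T (lookup r x) (lookup c x) x → At T (lookup r y) (lookup c y) y → lookup h x ≤ lookup h y
    at (ρ , p , q) (ρ′ , p′ , q′) = AllPairs-At₁ (LinkedP.Linked⇒AllPairs ℕP.≤-trans (All.lookup all (At₁⇒∈ (At₁-map (map (lookup h)) p))))
      (At₁-map (lookup h) q) (At₁-map (lookup h) (subst (λ σ → At₁ σ (lookup c y) y) (At₁-functional (subst (λ i → At₁ T i ρ′) (sym rxy) p′) p) q′)) cxy

  col-strict : (h : Mon n) → Linked StrictBelow (fill h) → ColStrict r c h
  col-strict h linked x y cxy rxy = at (complete x) (complete y)
    where
    at : At T (lookup r x) (lookup c x) x → At T (lookup r y) (lookup c y) y → lookup h x < lookup h y
    at (ρ , p , q) (ρ′ , p′ , q′) = Pointwise-At₁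
      (At₁-Linked linked (At₁-map (map (lookup h)) p) (subst (λ i → At₁ (fill h) i (map (lookup h) ρ′)) (sym rxy) (At₁-map (map (lookup h)) p′)))
      (At₁-take (subst (lookup c x <_) (sym (ListP.length-map (lookup h) ρ′)) (At₁-< q″)) (At₁-map (lookup h) q)) (At₁-map (lookup h) q″)
      where
      q″ : At₁ ρ′ (lookup c x) y
      q″ = subst (λ j → At₁ ρ′ j y) (sym cxy) q′

  fill-SSYT : IsPartition n (shape T) → (h : Mon n) → RowWeak r c h → ColStrict r c h → IsSSYT n (fill h)
  fill-SSYT part h weak strict = subst (IsPartition n) (sym (shape-map (lookup h) T)) part ,
    AllP.map⁺ (All-At₁ T (λ {i} {ρ} at → LinkedP.map⁺ (Linked-At₁ ρ (λ {j} {x} {y} p q →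
      let (rx , cx) = sound (ρ , at , p) ; (ry , cy) = sound (ρ , at , q)
      in weak x y (trans rx (sym ry)) (subst₂ _<_ (sym cx) (sym cy) (ℕP.n<1+n j)))))) ,
    LinkedP.map⁺ (Linked-At₁ T (λ {i} {ρ} {ρ′} at at′ →
      Pointwise-take (map (lookup h) ρ) (map (lookup h) ρ′)
        (subst₂ _≤_ (sym (ListP.length-map (lookup h) ρ′)) (sym (ListP.length-map (lookup h) ρ))
          (At₁-Linked (proj₁ (proj₂ part)) (At₁-map length at) (At₁-map length at′)))
        (λ p q → entry at at′ (At₁-unmap (lookup h) p) (At₁-unmap (lookup h) q))))
    where
    entry : ∀ {i ρ ρ′ j a b} → At₁ T i ρ → At₁ T (suc i) ρ′ →
      (∃ λ x → At₁ ρ j x × lookup h x ≡ a) → (∃ λ y → At₁ ρ′ j y × lookup h y ≡ b) → a < b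
    entry {ρ = ρ} {ρ′} at at′ (x , p , refl) (y , q , refl) =
      let (rx , cx) = sound (ρ , at , p) ; (ry , cy) = sound (ρ′ , at′ , q)
      in strict x y (trans cx (sym cy)) (trans (cong suc rx) (sym ry))

  row-size : ∀ {i ρ} → At₁ T i ρ → length ρ ≡ size r i
  row-size {i} {ρ} at = ℕP.≤-antisym
    (ℕP.≤-trans (ℕP.≤-reflexive (sym (∑ₙ-ones ρ)))
      (ℕP.≤-trans (∑ₙ-mono ρ (λ {x} q → ℕP.≤-reflexive (sym (⟦⟧ₙ-yes (lookup r x ℕ.≟ i) (in-row q)))))
        (count-≤ {xs = ρ} {ys = allFin n} FinP._≟_ (λ x → lookup r x ℕ.≟ i) (λ x → lookup r x ℕ.≟ i) id id unique-ρ (λ _ _ e → e)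
          (λ {x} q → x , ∈P.∈-allFin x , q , refl))))
    (ℕP.≤-trans (count-≤ {xs = allFin n} {ys = ρ} FinP._≟_ (λ x → lookup r x ℕ.≟ i) {S = λ _ → ⊤} (λ _ → yes tt) id id (Unique.allFin⁺ n) (λ _ _ e → e)
        (λ {x} rx → x , inside x rx , tt , refl))
      (ℕP.≤-reflexive (∑ₙ-ones ρ)))
    where
    inside : ∀ x → lookup r x ≡ i → x ∈ ρ
    inside x rx = let (ρ′ , at′ , p) = complete x in subst (x ∈_) (At₁-functional (subst (λ i → At₁ T i ρ′) rx at′) at) (At₁⇒∈ p)
    in-row : ∀ {x} → x ∈ ρ → lookup r x ≡ i
    in-row q = let (j , p) = ∈⇒At₁ q in proj₁ (sound (ρ , at , p))
    unique-ρ : Unique ρ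
    unique-ρ = At₁-unique⁻ ρ (λ p q → trans (sym (proj₂ (sound (ρ , at , p)))) (proj₂ (sound (ρ , at , q))))

module _ {T T′ : Tab (Fin n)} {r c r′ c′ : Vec ℕ n} (co : Coords T r c) (co′ : Coords T′ r′ c′) where
  private
    module C = Coords co
    module C′ = Coords co′

  -- τ sends `x` to the entry of `T` in the cell that `x` occupies in `T′`.
  relabelling : shape T′ ≡ shape T → (∀ {x y} → lookup r′ x ≡ lookup r′ y → lookup c′ x ≡ lookup c′ y → x ≡ y) →
    ∃ λ τ → Inj τ × r ∙ τ ≡ r′ × c ∙ τ ≡ c′ × (∀ M → shape T ≡ shape M → pExp M T ∙ τ ≡ pExp M T′)
  relabelling e sep = τ , mkInj inj , rτ , cτ , λ M eM → vec-ext λ x → trans (lookup-∙ (pExp M T) τ x) (entry M eM x)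
    where
    partner : ∀ x → ∃ (At T (lookup r′ x) (lookup c′ x))
    partner x = At-shape T′ T e (C′.complete x)
    τ : Map n
    τ = tabulate (proj₁ ∘ partner)
    at : ∀ x → At T (lookup r′ x) (lookup c′ x) (lookup τ x)
    at x = subst (At T (lookup r′ x) (lookup c′ x)) (sym (VecP.lookup∘tabulate (proj₁ ∘ partner) x)) (proj₂ (partner x))
    rτ : r ∙ τ ≡ r′
    rτ = vec-ext λ x → trans (lookup-∙ r τ x) (proj₁ (C.sound (at x)))
    cτ : c ∙ τ ≡ c′
    cτ = vec-ext λ x → trans (lookup-∙ c τ x) (proj₂ (C.sound (at x)))
    inj : ∀ {x y} → lookup τ x ≡ lookup τ y → x ≡ y
    inj {x} {y} eq = sep (trans (sym (proj₁ (C.sound (at x)))) (trans (cong (lookup r) eq) (proj₁ (C.sound (at y)))))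
      (trans (sym (proj₂ (C.sound (at x)))) (trans (cong (lookup c) eq) (proj₂ (C.sound (at y)))))
    entry : ∀ M → shape T ≡ shape M → ∀ x → lookup (pExp M T) (lookup τ x) ≡ lookup (pExp M T′) x
    entry M eM x = At-functional
      (subst (λ N → At N (lookup r′ x) (lookup c′ x) (lookup (pExp M T) (lookup τ x))) (fill-pExp co M eM) (At-map (lookup (pExp M T)) (at x)))
      (subst (λ N → At N (lookup r′ x) (lookup c′ x) (lookup (pExp M T′) x)) (fill-pExp co′ M (trans e eM)) (At-map (lookup (pExp M T′)) (C′.complete x)))

size-∙ : {π : Map n} → Inj π → (r : Vec ℕ n) (i : ℕ) → size (r ∙ π) i ≡ size r i
size-∙ {n} {π} p r i = trans (∑ₙ.fold-≗ (allFin n) (λ x → cong (λ a → ⟦ a ℕ.≟ i ⟧ₙ) (lookup-∙ r π x)))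
  (∑ₙ-relabel p (λ x → ⟦ lookup r x ℕ.≟ i ⟧ₙ))

shape-⊆ : {T T′ : Tab (Fin n)} {r c r′ c′ : Vec ℕ n} → Coords T r c → Coords T′ r′ c′ → All (1 ≤_) (shape T) →
  (∀ i → size r i ≡ size r′ i) → ∀ {i a} → At₁ (shape T) i a → At₁ (shape T′) i a
shape-⊆ {n} {T} {T′} {r} {c} {r′} {c′} co co′ pos e {i} {a} p = from-row (At₁-unmap length p)
  where
  from-row : (∃ λ ρ → At₁ T i ρ × length ρ ≡ a) → At₁ (shape T′) i a
  from-row (ρ , at , refl) = go (∑ₙ-exists (allFin n) (λ x → lookup r′ x ℕ.≟ i)
      (ℕP.≤-trans (All.lookup pos (At₁⇒∈ p)) (ℕP.≤-reflexive (trans (row-size co at) (e i)))))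
    where
    go : (∃ λ x → x ∈ allFin n × lookup r′ x ≡ i) → At₁ (shape T′) i (length ρ)
    go (x , _ , rx) = let (ρ′ , at′ , _) = Coords.complete co′ x
                          at″ = subst (λ i → At₁ T′ i ρ′) rx at′
                      in subst (At₁ (shape T′) i) (trans (row-size co′ at″) (trans (sym (e i)) (sym (row-size co at)))) (At₁-map length at″)

-- Row lengths are block sizes, which a permutation preserves. Positivity of the parts excludes
-- additional empty rows.
shape-≡ : {T T′ : Tab (Fin n)} {r c r′ c′ : Vec ℕ n} → Coords T r c → Coords T′ r′ c′ →
  All (1 ≤_) (shape T) → All (1 ≤_) (shape T′) → ∀ {π} → Inj π → r′ ∙ π ≡ r → shape T ≡ shape T′
shape-≡ {T = T} {T′} {r} {r′ = r′} co co′ pos pos′ {π} p e = At₁-ext (shape T) (shape T′)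
  (shape-⊆ co co′ pos sizes) (shape-⊆ co′ co pos′ (sym ∘ sizes))
  where
  sizes : ∀ i → size r i ≡ size r′ i
  sizes i = trans (cong (λ k → size k i) (sym e)) (size-∙ p r′ i)

-- The subspaces V_M

scaled : {D : V n → Set} → Subspace D → (k : ℚ) {f : V n} → D f → D (λ m → k * f m)
scaled S k h = resp S (λ m → ℚP.+-identityʳ _) (lin S k h (zeroᵥ S))

coeff-combination : (M : Tab ℕ) (cs : List (ℚ × Tab (Fin n))) (a : Mon n) →
  coeff (sumₚ (map (λ cT → proj₁ cT ·ₚ F M (proj₂ cT)) cs)) a ≡ ∑ cs (λ cT → proj₁ cT * coeff (F M (proj₂ cT)) a)
coeff-combination M cs a = trans (coeff-sum (map (λ cT → proj₁ cT ·ₚ F M (proj₂ cT)) cs) a)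
  (trans (∑.fold-map cs _ _) (∑.fold-≗ cs (λ cT → coeff-scale (proj₁ cT) (F M (proj₂ cT)) a)))

-- Statements about all of V_M are reduced to the symmetrized monomials, the scalars 1/s being
-- absorbed by the subspace.
InV-subspace : {D : V n → Set} → Subspace D → {M : Tab ℕ} →
  (∀ {T r c} → IsFilling n (shape M) T → Coords T r c → D (symmetrize r c (δ (pExp M T)))) → ∀ {v} → InV n M v → D (coeff v)
InV-subspace {n} {D} S {M} h {v} (cs , fill , e) = resp S (λ a → sym (trans (e a) (coeff-combination M cs a)))
  (∑-closed S cs proj₁ (λ cT → coeff (F M (proj₂ cT))) (λ q → each (All.lookup fill q)))
  where
  each : ∀ {T} → IsFilling n (shape M) T → D (coeff (F M T))
  each {T} f with r , c , co ← filling-coords T (proj₂ f) = resp S (λ a → sym (coeff-F co M a)) (scaled S (recip (sMT M T)) (h f co))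

δ-translate : {τ : Map n} → Inj τ → (p q : Mon n) → p ∙ τ ≡ q → τ ▷ δ q ≗ δ p
δ-translate {τ = τ} t p q e m = ⟦⟧-cong (mon≟ q (m ∙ τ)) (mon≟ p m)
  (λ e′ → ∙-cancelʳ t (trans e e′)) (λ e′ → trans (sym e) (cong (_∙ τ) e′))

Y-∑ : (X : Character n) (r : Vec ℕ n) (xs : List A) (g : A → V n) → Y X r (λ m → ∑ xs (λ a → g a m)) ≗ (λ m → ∑ xs (λ a → Y X r (g a) m))
Y-∑ {n} X r xs g m = trans (∑.fold-≗ (allPerms n) (λ σ → ∑-*ˡ xs (weight X r σ) (λ a → g a (m ∙ σ)))) (∑.fold-swap (allPerms n) xs _)

unique-keys : {xs : List (A × B)} → Unique (map proj₁ xs) → ∀ {x y} → x ∈ xs → y ∈ xs → proj₁ x ≡ proj₁ y → x ≡ y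
unique-keys (x∉ ∷ u) (here refl) (here refl) _ = refl
unique-keys (x∉ ∷ u) (here refl) (there q) e = ⊥-elim (All.lookup x∉ (∈P.∈-map⁺ proj₁ q) e)
unique-keys (x∉ ∷ u) (there p) (here refl) e = ⊥-elim (All.lookup x∉ (∈P.∈-map⁺ proj₁ p) (sym e))
unique-keys (x∉ ∷ u) (there p) (there q) e = unique-keys u p q e

-- Enumeration of tableaux

listsUpTo : ℕ → List A → List (List A)
listsUpTo zero L = [ [] ]
listsUpTo (suc k) L = [] ∷ concatMap (λ xs → map (_∷ xs) L) (listsUpTo k L)

∈-listsUpTo : ∀ k {L xs : List A} → length xs ≤ k → (∀ {x} → x ∈ xs → x ∈ L) → xs ∈ listsUpTo k L
∈-listsUpTo zero {xs = []} l h = here refl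
∈-listsUpTo (suc k) {xs = []} l h = here refl
∈-listsUpTo (suc k) {L} {x ∷ xs} (s≤s l) h = there (∈P.∈-concatMap⁺ (λ xs → map (_∷ xs) L)
  (lose (∈-listsUpTo k l (h ∘ there)) (∈P.∈-map⁺ (_∷ xs) (h (here refl)))))

↭-dec : DecidableEquality A → (xs ys : List A) → Dec (xs ↭ ys)
↭-dec _≟_ [] [] = yes ↭-refl
↭-dec _≟_ [] (y ∷ ys) = no (λ p → contradiction (↭P.↭-length p) λ ())
↭-dec _≟_ (x ∷ xs) ys with x ∈? ys
  where open import Data.List.Membership.DecPropositional _≟_ using (_∈?_)
... | no x∉ = no (λ p → x∉ (↭P.∈-resp-↭ p (here refl)))
... | yes x∈ with ∈P.∈-∃++ x∈
... | as , bs , refl with ↭-dec _≟_ xs (as ++ bs)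
... | yes p = yes (↭-trans (prep x p) (↭-sym (↭P.shift x as bs)))
... | no ¬p = no (λ p → ¬p (↭P.drop-∷ (↭-trans p (↭P.shift x as bs))))

isSSYT? : ∀ n (M : Tab ℕ) → Dec (IsSSYT n M)
isSSYT? n M = (All.all? (1 ℕ.≤?_) (shape M) ×-dec Linked.linked? (λ a b → b ℕ.≤? a) (shape M) ×-dec (sum (shape M) ℕ.≟ n))
  ×-dec All.all? (Linked.linked? ℕ._≤?_) M ×-dec Linked.linked? (λ r r′ → Pointwise.decidable ℕ._<?_ (take (length r′) r) r′) M

length-≤-sum : (xs : List ℕ) → All (1 ≤_) xs → length xs ≤ sum xs
length-≤-sum [] [] = z≤n
length-≤-sum (x ∷ xs) (h ∷ hs) = ℕP.+-mono-≤ h (length-≤-sum xs hs)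

∈-≤-sum : {x : ℕ} {xs : List ℕ} → x ∈ xs → x ≤ sum xs
∈-≤-sum {xs = x ∷ xs} (here refl) = ℕP.m≤m+n x (sum xs)
∈-≤-sum {xs = x ∷ xs} (there p) = ℕP.≤-trans (∈-≤-sum p) (ℕP.m≤n+m (sum xs) x)

∈-tabs : {n : ℕ} {λ′ : List ℕ} → IsPartition n λ′ → {L : List A} (T : Tab A) → shape T ≡ λ′ → (∀ {x} → x ∈ concat T → x ∈ L) →
  T ∈ listsUpTo n (listsUpTo n L)
∈-tabs {n = n} (pos , _ , s) T refl h = ∈-listsUpTo n
  (ℕP.≤-trans (ℕP.≤-reflexive (sym (ListP.length-map length T))) (ℕP.≤-trans (length-≤-sum (shape T) pos) (ℕP.≤-reflexive s)))
  (λ {ρ} ρ∈ → ∈-listsUpTo n (ℕP.≤-trans (∈-≤-sum (∈P.∈-map⁺ length ρ∈)) (ℕP.≤-reflexive s)) (λ x∈ → h (∈P.∈-concat⁺′ x∈ ρ∈)))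

-- Spanning and directness for a class of exponent multisets

module Decompose (n d : ℕ) (R : List ℕ → Set) (R? : ∀ xs → Dec (R xs)) (R-resp : ∀ {xs ys} → xs ↭ ys → R xs → R ys)
  (R-sum : ∀ {xs} → R xs → sum xs ≡ d) where

  open Inner n d

  -- `R` is later taken as "has sum d" or as "is a rearrangement of μ", so that the graded and the
  -- multigraded statement have one proof.
  Index : Tab ℕ → Set
  Index M = IsSSYT n M × R (content M)

  OnR : V n → Set
  OnR = On (R ∘ Vec.toList)

  onR-▷ : {f : V n} → OnR f → ∀ {π} → Inj π → OnR (π ▷ f)
  onR-▷ h {π} p m with h (m ∙ π)
  ... | inj₁ z = inj₁ z
  ... | inj₂ q = inj₂ (R-resp (toList-∙ p m) q)

  onR-Y : (X : Character n) (r : Vec ℕ n) {f : V n} → OnR f → OnR (Y X r f)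
  onR-Y X r {f} h = Y-closed (on-subspace (R ∘ Vec.toList)) X r {f} (onR-▷ {f} h)

  onR-supported : {f : V n} → OnR f → Supported f
  onR-supported h m with h m
  ... | inj₁ z = inj₁ z
  ... | inj₂ q = inj₂ (∈-monomials d m (λ i → ℕP.≤-trans (lookup-≤-sum m i) (ℕP.≤-reflexive (R-sum q))))

  δ-onR : (p : Mon n) → R (Vec.toList p) → OnR (δ p)
  δ-onR p h m with mon≟ p m
  ... | yes refl = inj₂ h
  ... | no _ = inj₁ refl

  InV-onR : {M : Tab ℕ} → Index M → {v : Poly n} → InV n M v → OnR (coeff v)
  InV-onR {M} (_ , RM) {v} = InV-subspace (on-subspace (R ∘ Vec.toList)) {M} (λ {T} {r} {c} (e , _) co →
    onR-Y (sign n) c {Y (trivial n) r (δ (pExp M T))} (onR-Y (trivial n) r {δ (pExp M T)}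
      (δ-onR (pExp M T) (R-resp (↭-sym (toList-pExp co M e)) RM)))) {v}

  contained : {M : Tab ℕ} → Index M → (v : Poly n) → InV n M v → ∀ a → coeff v a ≢ 0ℚ → R (Vec.toList a)
  contained {M} ix v iv a ne = decide (InV-onR {M} ix {v} iv a)
    where
    decide : coeff v a ≡ 0ℚ ⊎ R (Vec.toList a) → R (Vec.toList a)
    decide (inj₁ z) = ⊥-elim (ne z)
    decide (inj₂ q) = q

  inner-symmetrize : (r c : Vec ℕ n) (f v : V n) → ⟨ symmetrize r c f , v ⟩ ≡ ⟨ f , Y (trivial n) r (Y (sign n) c v) ⟩
  inner-symmetrize r c f v = trans (Y-adjoint (sign n) c (Y (trivial n) r f) v) (Y-adjoint (trivial n) r f (Y (sign n) c v))

  inner-δ : (p : Mon n) (g : V n) → p ∈ S → ⟨ δ p , g ⟩ ≡ g p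
  inner-δ p g p∈ = trans (∑.fold-single (λ m → δ p m * g m) (monomials-unique n d) p∈
      (λ {m} _ ne → trans (cong (_* g m) (⟦⟧-no (mon≟ p m) (ne ∘ sym))) (ℚP.*-zeroˡ (g m))))
    (trans (cong (_* g p) (⟦⟧-yes (mon≟ p p) refl)) (ℚP.*-identityˡ (g p)))

  Pair : Set
  Pair = Tab ℕ × Tab (Fin n)

  Valid : Pair → Set
  Valid (M , T) = Index M × IsFilling n (shape M) T

  valid? : ∀ x → Dec (Valid x)
  valid? (M , T) = (isSSYT? n M ×-dec R? (content M)) ×-dec (ListP.≡-dec ℕ._≟_ (shape T) (shape M) ×-dec ↭-dec FinP._≟_ (concat T) (allFin n))

  candidates : List Pair
  candidates = cartesianProduct (listsUpTo n (listsUpTo n (upTo (suc d)))) (listsUpTo n (listsUpTo n (allFin n)))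

  valid-pairs : List Pair
  valid-pairs = List.filter valid? candidates

  ∈-valid-pairs : ∀ {M T} → Valid (M , T) → (M , T) ∈ valid-pairs
  ∈-valid-pairs {M} {T} val@((ss , RM) , (e , _)) = ∈P.∈-filter⁺ valid?
    (∈P.∈-cartesianProduct⁺
      (∈-tabs (proj₁ ss) M refl (λ {x} q → ∈P.∈-upTo⁺ (s≤s (ℕP.≤-trans (∈-≤-sum q) (ℕP.≤-reflexive (R-sum RM))))))
      (∈-tabs (proj₁ ss) T e (λ _ → ∈P.∈-allFin _)))
    val

  vec : Pair → V n
  vec (M , T) = coeff (F M T)

  orthogonal-zero : (u : V n) → OnR u → (∀ {x} → x ∈ valid-pairs → ⟨ vec x , u ⟩ ≡ 0ℚ) → Zero u
  orthogonal-zero u onR ortho = tableaux-complete u λ r c tab → Straighten.straighten r c tab u (semistandard r c tab)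
    where
    semistandard : ∀ r c (tab : Tableau r c) h → RowWeak r c h → ColStrict r c h → Y (trivial n) r (Y (sign n) c u) h ≡ 0ℚ
    semistandard r c tab h weak strict = decide (onR-Y (trivial n) r {Y (sign n) c u} (onR-Y (sign n) c {u} onR) h)
      where
      open ToList r c tab using (tab-list; coords; partition)
      M : Tab ℕ
      M = map (map (lookup h)) tab-list
      g : V n
      g = Y (trivial n) r (Y (sign n) c u)
      decide : g h ≡ 0ℚ ⊎ R (Vec.toList h) → g h ≡ 0ℚ
      decide (inj₁ z) = z
      -- By adjointness `g h` is the inner product of `u` with the symmetrized monomial `h`. That
      -- vector is a nonzero multiple of `F M tab-list`, where `M` is the tableau with the entries
      -- of `h`.
      decide (inj₂ q) = trans (sym (inner-δ h g h∈)) (trans (sym (inner-symmetrize r c (δ h) u)) sym-zero)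
        where
        h∈ : h ∈ S
        h∈ = ∈-monomials d h (λ i → ℕP.≤-trans (lookup-≤-sum h i) (ℕP.≤-reflexive (R-sum q)))
        valid : Valid (M , tab-list)
        valid = (fill-SSYT coords partition h weak strict , R-resp (toList-fill coords h) q) ,
          sym (shape-map (lookup h) tab-list) , Coords.concat-↭ coords
        F-eq : coeff (F M tab-list) ≗ (λ a → recip (sMT M tab-list) * symmetrize r c (δ h) a + 0ℚ)
        F-eq a = trans (coeff-F coords M a) (trans (cong (λ p → recip (sMT M tab-list) * symmetrize r c (δ p) a) (pExp-fill coords h))
          (sym (ℚP.+-identityʳ _)))
        sym-zero : ⟨ symmetrize r c (δ h) , u ⟩ ≡ 0ℚ
        sym-zero = *≡0⇒ (recip≢0 coords M) (begin
          recip (sMT M tab-list) * ⟨ symmetrize r c (δ h) , u ⟩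
            ≡⟨ sym (ℚP.+-identityʳ _) ⟩
          recip (sMT M tab-list) * ⟨ symmetrize r c (δ h) , u ⟩ + 0ℚ
            ≡⟨ cong (recip (sMT M tab-list) * ⟨ symmetrize r c (δ h) , u ⟩ +_) (sym (zeroᵥ (orthogonal u))) ⟩
          recip (sMT M tab-list) * ⟨ symmetrize r c (δ h) , u ⟩ + ⟨ (λ _ → 0ℚ) , u ⟩
            ≡⟨ sym (inner-lin (recip (sMT M tab-list)) (symmetrize r c (δ h)) (λ _ → 0ℚ) u) ⟩
          ⟨ (λ a → recip (sMT M tab-list) * symmetrize r c (δ h) a + 0ℚ) , u ⟩
            ≡⟨ inner-cong {g = u} {g′ = u} (λ a → sym (F-eq a)) (λ _ → refl) ⟩
          ⟨ coeff (F M tab-list) , u ⟩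
            ≡⟨ ortho (∈-valid-pairs valid) ⟩
          0ℚ ∎)
          where open ≡-Reasoning

  -- Summands with the same `M` are merged, since the keys of a decomposition have to be distinct.
  insert : Tab ℕ → Poly n → Family n → Family n
  insert M w [] = [ (M , w) ]
  insert M w ((N , v) ∷ fam) with ListP.≡-dec (ListP.≡-dec ℕ._≟_) N M
  ... | yes _ = (N , w +ₚ v) ∷ fam
  ... | no _ = (N , v) ∷ insert M w fam

  insert-coeff : ∀ M w fam a → coeff (familySum (insert M w fam)) a ≡ coeff w a + coeff (familySum fam) a
  insert-coeff M w [] a = coeff-++ w [] a
  insert-coeff M w ((N , v) ∷ fam) a with ListP.≡-dec (ListP.≡-dec ℕ._≟_) N M
  ... | yes _ = trans (cong (λ p → coeff p a) (ListP.++-assoc w v (familySum fam))) (coeff-++ w (v ++ familySum fam) a)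
  ... | no _ = trans (coeff-++ v (familySum (insert M w fam)) a) (trans (cong (coeff v a +_) (insert-coeff M w fam a))
          (trans (left-comm (coeff v a) (coeff w a) (coeff (familySum fam) a)) (cong (coeff w a +_) (sym (coeff-++ v (familySum fam) a)))))
    where
    left-comm : ∀ x y z → x + (y + z) ≡ y + (x + z)
    left-comm = Solver.solve-∀ ℚring

  insert-keys : ∀ M w fam {N} → N ∈ map proj₁ (insert M w fam) → N ≡ M ⊎ N ∈ map proj₁ fam
  insert-keys M w [] (here e) = inj₁ e
  insert-keys M w ((N , v) ∷ fam) q with ListP.≡-dec (ListP.≡-dec ℕ._≟_) N M
  insert-keys M w ((N , v) ∷ fam) q | yes _ = inj₂ q
  insert-keys M w ((N , v) ∷ fam) (here e) | no _ = inj₂ (here e)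
  insert-keys M w ((N , v) ∷ fam) (there q) | no _ with insert-keys M w fam q
  ... | inj₁ e = inj₁ e
  ... | inj₂ p = inj₂ (there p)

  insert-unique : ∀ M w fam → Unique (map proj₁ fam) → Unique (map proj₁ (insert M w fam))
  insert-unique M w [] u = [] ∷ []
  insert-unique M w ((N , v) ∷ fam) (N∉ ∷ u) with ListP.≡-dec (ListP.≡-dec ℕ._≟_) N M
  ... | yes _ = N∉ ∷ u
  ... | no N≢M = All.tabulate (λ q e → fresh (insert-keys M w fam q) e) ∷ insert-unique M w fam u
    where
    fresh : ∀ {N′} → N′ ≡ M ⊎ N′ ∈ map proj₁ fam → N ≢ N′
    fresh (inj₁ e) e′ = N≢M (trans e′ e)
    fresh (inj₂ q) e′ = All.lookup N∉ q e′

  InV-F : ∀ {M T} c → IsFilling n (shape M) T → InV n M (c ·ₚ F M T)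
  InV-F {M} {T} c f = [ (c , T) ] , f ∷ [] , λ a → cong (λ p → coeff p a) (sym (ListP.++-identityʳ (c ·ₚ F M T)))

  InV-+ : ∀ {M v w} → InV n M v → InV n M w → InV n M (v +ₚ w)
  InV-+ {M} {v} {w} (cs , f , e) (cs′ , f′ , e′) = cs ++ cs′ , AllP.++⁺ f f′ , λ a → trans (coeff-++ v w a)
    (trans (cong₂ _+_ (trans (e a) (coeff-combination M cs a)) (trans (e′ a) (coeff-combination M cs′ a)))
      (trans (sym (∑.fold-++ cs cs′ _)) (sym (coeff-combination M (cs ++ cs′) a))))

  insert-admissible : ∀ {M w} → Index M → InV n M w → ∀ fam → Admissible n Index fam → Admissible n Index (insert M w fam)
  insert-admissible ix iw [] [] = (ix , iw) ∷ []
  insert-admissible {M} {w} ix iw ((N , v) ∷ fam) ((ixN , iv) ∷ adm) with ListP.≡-dec (ListP.≡-dec ℕ._≟_) N M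
  ... | yes refl = (ixN , InV-+ {N} {w} {v} iw iv) ∷ adm
  ... | no _ = (ixN , iv) ∷ insert-admissible {M} {w} ix iw fam adm

  Decomposition : V n → Set
  Decomposition f = Σ (Family n) λ fam → Admissible n Index fam × Unique (map proj₁ fam) × f ≗ coeff (familySum fam)

  decompose-combination : (cs : List (ℚ × Pair)) → All (Valid ∘ proj₂) cs → Decomposition (combination vec cs)
  decompose-combination [] [] = [] , [] , [] , λ _ → refl
  decompose-combination ((t , M , T) ∷ cs) ((ix , f) ∷ vs) = extend (decompose-combination cs vs)
    where
    extend : Decomposition (combination vec cs) → Decomposition (combination vec ((t , M , T) ∷ cs))
    extend (fam , adm , u , e) = insert M (t ·ₚ F M T) fam , insert-admissible {M} {t ·ₚ F M T} ix (InV-F {M} {T} t f) fam adm ,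
      insert-unique M (t ·ₚ F M T) fam u ,
      λ a → trans (cong₂ _+_ (sym (coeff-scale t (F M T) a)) (e a)) (sym (insert-coeff M (t ·ₚ F M T) fam a))

  spanning : (p : Poly n) → (∀ a → coeff p a ≢ 0ℚ → R (Vec.toList a)) → Decomposition (coeff p)
  spanning p h = finish (project vec valid-pairs (coeff p))
    where
    onR-p : OnR (coeff p)
    onR-p a with coeff p a ℚ.≟ 0ℚ
    ... | yes z = inj₁ z
    ... | no ne = inj₂ (h a ne)
    finish : Projection vec valid-pairs (coeff p) → Decomposition (coeff p)
    finish (cs , cs∈ , ortho) = transport (decompose-combination cs valid)
      where
      valid : All (Valid ∘ proj₂) cs
      valid = All.map (λ q → proj₂ (∈P.∈-filter⁻ valid? {xs = candidates} q)) cs∈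
      onR-vec : ∀ {x} → Valid x → OnR (vec x)
      onR-vec {M , T} (ix , f) = resp (on-subspace (R ∘ Vec.toList)) (λ a → trans (coeff-scale 1ℚ (F M T) a) (ℚP.*-identityˡ _))
        (InV-onR {M} ix {1ℚ ·ₚ F M T} (InV-F {M} {T} 1ℚ f))
      onR-combination : OnR (combination vec cs)
      onR-combination = ∑-closed (on-subspace (R ∘ Vec.toList)) cs proj₁ (vec ∘ proj₂) (λ q → onR-vec (All.lookup valid q))
      zero-residual : Zero (residual vec (coeff p) cs)
      zero-residual = orthogonal-zero (residual vec (coeff p) cs)
        (lin (on-subspace (R ∘ Vec.toList)) {combination vec cs} {coeff p} -1ℚ onR-combination onR-p) ortho
      coeff≡ : coeff p ≗ combination vec cs
      coeff≡ a = trans (split (combination vec cs a) (coeff p a)) (trans (cong (combination vec cs a +_) (zero-residual a)) (ℚP.+-identityʳ _))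
        where
        split : ∀ x y → y ≡ x + (-1ℚ * x + y)
        split = Solver.solve-∀ ℚring
      transport : Decomposition (combination vec cs) → Decomposition (coeff p)
      transport (fam , adm , u , e) = fam , adm , u , λ a → trans (coeff≡ a) (e a)

  module Direct (fam : Family n) (adm : Admissible n Index fam) (uniq : Unique (map proj₁ fam)) (sum-zero : familySum fam ≈ₚ 0ₚ) where

    -- All translates by π are covered because `flip-zero` expands the antisymmetrizer that stands
    -- next to `v`.
    annihilated : ∀ {M v} → (M , v) ∈ fam → ∀ {T r c} → IsFilling n (shape M) T → Coords T r c → ∀ {π} → Inj π →
      Zero (symmetrize r c (π ▷ coeff v))
    annihilated {M} {v} Mv∈ {T} {r} {c} (eT , _) co {π} p = Semistandard.independent tab fam (Unique.map⁻ uniq) (λ i → pExp (proj₁ i) T) E Good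
        (λ {i} → good-weak {i}) (λ {i} → good-strict {i}) good-injective split relation Mv∈
      where
      part : IsPartition n (shape T)
      part = subst (IsPartition n) (sym eT) (proj₁ (proj₁ (proj₁ (All.lookup adm Mv∈))))
      tab : Tableau r c
      tab = coords-tableau co (proj₁ (proj₂ part))
      E : Tab ℕ × Poly n → V n
      E i = symmetrize r c (π ▷ coeff (proj₂ i))
      Good : Tab ℕ × Poly n → Set
      Good i = IsSSYT n (proj₁ i) × shape T ≡ shape (proj₁ i)
      good-weak : ∀ {i} → Good i → RowWeak r c (pExp (proj₁ i) T)
      good-weak {N , _} (ss , e) = row-weak co (pExp N T) (subst (All (Linked _≤_)) (sym (fill-pExp co N e)) (proj₁ (proj₂ ss)))
      good-strict : ∀ {i} → Good i → ColStrict r c (pExp (proj₁ i) T)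
      good-strict {N , _} (ss , e) = col-strict co (pExp N T) (subst (Linked StrictBelow) (sym (fill-pExp co N e)) (proj₂ (proj₂ ss)))
      good-injective : ∀ {i j} → i ∈ fam → j ∈ fam → Good i → Good j → pExp (proj₁ i) T ≡ pExp (proj₁ j) T → i ≡ j
      good-injective {N , _} {N′ , _} a b (_ , e) (_ , e′) eq = unique-keys uniq a b
        (trans (sym (fill-pExp co N e)) (trans (cong (λ h → map (map (lookup h)) T) eq) (fill-pExp co N′ e′)))
      split : ∀ {i} → i ∈ fam → Zero (E i) ⊎ (Good i × Multiple (symmetrize r c (δ (pExp (proj₁ i) T))) (E i))
      split {N , w} i∈ with ListP.≡-dec ℕ._≟_ (shape T) (shape N)
      ... | no ne = inj₁ (InV-subspace (▷-preimage π (symmetrize-zero r c)) {N} (λ {T′} {r′} {c′} (e′ , _) co′ →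
              let partN = proj₁ (proj₁ (proj₁ (All.lookup adm i∈)))
                  part′ = subst (IsPartition n) (sym e′) partN
              in cross-zero tab (coords-tableau co′ (proj₁ (proj₂ part′)))
                (λ {ρ} q eq → ne (trans (shape-≡ co co′ (proj₁ part) (proj₁ part′) q eq) e′)) (δ (pExp N T′)) p)
              {w} (proj₂ (All.lookup adm i∈)))
      ... | yes e = inj₂ ((proj₁ (proj₁ (All.lookup adm i∈)) , e) ,
              InV-subspace (▷-preimage π (Y-preimage (trivial n) r (Y-preimage (sign n) c (multiple-subspace (symmetrize r c (δ (pExp N T)))))))
                {N} (λ {T′} {r′} {c′} (e′ , _) co′ → same-shape co′ e′) {w} (proj₂ (All.lookup adm i∈)))
        where
        same-shape : ∀ {T′ r′ c′} → Coords T′ r′ c′ → shape T′ ≡ shape N →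
          Multiple (symmetrize r c (δ (pExp N T))) (symmetrize r c (π ▷ symmetrize r′ c′ (δ (pExp N T′))))
        same-shape {T′} {r′} {c′} co′ e′ = use (relabelling co co′ (trans e′ (sym e)) (Tableau.separated (coords-tableau co′
            (subst (Linked ℕ._≥_) (trans e (sym e′)) (proj₁ (proj₂ part))))))
          where
          use : (∃ λ τ → Inj τ × r ∙ τ ≡ r′ × c ∙ τ ≡ c′ × (∀ M → shape T ≡ shape M → pExp M T ∙ τ ≡ pExp M T′)) →
            Multiple (symmetrize r c (δ (pExp N T))) (symmetrize r c (π ▷ symmetrize r′ c′ (δ (pExp N T′))))
          use (τ , t , refl , refl , ep) = symmetrize-multiple tab (δ (pExp N T)) t {δ (pExp N T′)} (δ-translate t (pExp N T) (pExp N T′) (ep N e)) p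
      relation : ∀ m → ∑ fam (λ i → E i m) ≡ 0ℚ
      relation m = trans (sym (trans (Y-cong (sign n) c (Y-∑ (trivial n) r fam (λ i → π ▷ coeff (proj₂ i))) m)
          (Y-∑ (sign n) c fam (λ i → Y (trivial n) r (π ▷ coeff (proj₂ i))) m)))
        (Y-zero (sign n) c (Y-zero (trivial n) r (λ a → trans (sym (trans (coeff-sum (map proj₂ fam) (a ∙ π)) (∑.fold-map fam proj₂ _))) (sum-zero (a ∙ π)))) m)

    summand-zero : ∀ {M v} → (M , v) ∈ fam → Zero (coeff v)
    summand-zero {M} {v} Mv∈ = definite supported (InV-subspace (orthogonal (coeff v)) {M} (λ {T} {r} {c} f co →
        trans (inner-symmetrize r c (δ (pExp M T)) (coeff v))
          (inner-zeroʳ (δ (pExp M T)) (flip-zero (trivial n) (sign n) r c supported (annihilated Mv∈ f co))))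
        {v} (proj₂ (All.lookup adm Mv∈)))
      where
      supported : Supported (coeff v)
      supported = onR-supported {coeff v} (InV-onR {M} (proj₁ (All.lookup adm Mv∈)) {v} (proj₂ (All.lookup adm Mv∈)))

    direct : All (λ Mv → proj₂ Mv ≈ₚ 0ₚ) fam
    direct = All.tabulate summand-zero


theorem2p34 : (n d : ℕ) → 1 ≤ n →
  -- each V_M (λ ⊢ n, M ∈ SSYT_d(λ)) lies in ℚ[x]_d
  ((M : Tab ℕ) → IndexDeg n d M → (v : Poly n) → InV n M v → Homog d v)
  -- ℚ[x]_d is contained in the sum of the V_M
  × ((p : Poly n) → Homog d p →
       Σ (Family n) λ fam → Admissible n (IndexDeg n d) fam
         × Unique (map proj₁ fam) × p ≈ₚ familySum fam)
  -- the sum is direct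
  × ((fam : Family n) → Admissible n (IndexDeg n d) fam → Unique (map proj₁ fam) →
       familySum fam ≈ₚ 0ₚ → All (λ Mv → proj₂ Mv ≈ₚ 0ₚ) fam)
  -- for every multiset μ of n non-negative integers with sum d:
  -- ℚ[x]_μ = ⊕_{λ ⊢ n} ⊕_{M ∈ SSYT_μ(λ)} V_M
  × ((μ : List ℕ) → length μ ≡ n → sum μ ≡ d →
       ((M : Tab ℕ) → IndexMulti n μ M → (v : Poly n) → InV n M v → InMultidegree μ v)
       × ((p : Poly n) → InMultidegree μ p →
            Σ (Family n) λ fam → Admissible n (IndexMulti n μ) fam
              × Unique (map proj₁ fam) × p ≈ₚ familySum fam))
theorem2p34 n d _ =
  (λ M ix v iv a ne → trans (sum-toList a) (Deg.contained (toDeg ix) v iv a ne)) ,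
  (λ p h → let (fam , adm , u , e) = Deg.spanning p (λ a ne → trans (sym (sum-toList a)) (h a ne))
           in fam , All.map (λ (ix , iv) → fromDeg ix , iv) adm , u , e) ,
  (λ fam adm u z → Deg.Direct.direct fam (All.map (λ (ix , iv) → toDeg ix , iv) adm) u z) ,
  λ μ _ sum-μ →
    let module Multi = Decompose n d (_↭ μ) (λ xs → ↭-dec ℕ._≟_ xs μ) (λ p q → ↭-trans (↭-sym p) q)
                         (λ p → trans (SumP.sum-↭ p) sum-μ)
    in (λ M ix v iv a ne → Multi.contained ix v iv a ne) , (λ p h → Multi.spanning p h)
  where
  module Deg = Decompose n d (λ xs → sum xs ≡ d) (λ xs → sum xs ℕ.≟ d) (λ p e → trans (sym (SumP.sum-↭ p)) e) id
  toDeg : ∀ {M} → IndexDeg n d M → Deg.Index M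
  toDeg {M} (ss , e) = ss , trans (sym (sum-concat M)) e
  fromDeg : ∀ {M} → Deg.Index M → IndexDeg n d M
  fromDeg {M} (ss , e) = ss , trans (sum-concat M) e
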